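{- Let $n \ge 2$, let $G$ be a dicyclic group of order $4n$, and let $S$ be a sequence over $G$. (1) Suppose $n$ is even. Then the following are equivalent: (a) $|S| = \mathsf s(G)-1$ and $S$ has no product-one subsequence of length $\exp(G)=2n$; (b) there exist $\alpha,\tau\in G$ with $G = \langle \alpha,\tau \mid \alpha^{2n}=1_G,\ \tau^2=\alpha^n,\ \tau\alpha=\alpha^{ -1}\tau\rangle$ such that either (i) $n \ge 4$ and $S = (\alpha^{r_1})^{[2n-1]} \boldsymbol{\cdot} (\alpha^{r_2})^{[2n-1]} \boldsymbol{\cdot} \alpha^{r_3}\tau$ with $r_1,r_2,r_3\in[0,2n-1]$ and $\gcd(r_1-r_2,2n)=1$; or (ii) $n=2$ and $S \in \{ (\alpha^{t_1})^{[3]} \boldsymbol{\cdot} (\alpha^{t_2})^{[3]} \boldsymbol{\cdot} \alpha^{t_3}\tau,\ (\alpha^{t_1})^{[3]} \boldsymbol{\cdot} (\alpha^{t_3}\tau)^{[3]} \boldsymbol{\cdot} \alpha^{t_2},\ (\alpha^{t_1})^{[3]} \boldsymbol{\cdot} (\alpha^{t_3}\tau)^{[3]} \boldsymbol{\cdot} \alpha^{t_4}\tau \}$, where $t_1,t_2,t_3,t_4\in[0,3]$, $t_1$ is even, $t_2$ is odd, and $t_3 \not\equiv t_4 \pmod 2$. (2) The following are equivalent: (a) $|S| = \mathsf E(G)-1$ and $S$ has no product-one subsequence of length $|G|$; (b) there exist $\alpha,\tau\in G$ with $G = \langle \alpha,\tau \mid \alpha^{2n}=1_G,\ \tau^2=\alpha^n,\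 \tau\alpha=\alpha^{ -1}\tau\rangle$ such that either (i) $n\ge 3$ and $S = (\alpha^{r_1})^{[4n-1]} \boldsymbol{\cdot} (\alpha^{r_2})^{[2n-1]} \boldsymbol{\cdot} \alpha^{r_3}\tau$ with $r_1,r_2,r_3\in[0,2n-1]$ and $\gcd(r_1-r_2,2n)=1$; or (ii) $n=2$ and $S \in \{ ((\alpha^{t_1})^{[3]} \boldsymbol{\cdot} (\alpha^{t_2})^{[3]} \boldsymbol{\cdot} \alpha^{t_3}\tau) \boldsymbol{\cdot} S_0,\ ((\alpha^{t_1})^{[3]} \boldsymbol{\cdot} (\alpha^{t_3}\tau)^{[3]} \boldsymbol{\cdot} \alpha^{t_2}) \boldsymbol{\cdot} S_1,\ ((\alpha^{t_1})^{[3]} \boldsymbol{\cdot} (\alpha^{t_3}\tau)^{[3]} \boldsymbol{\cdot} \alpha^{t_4}\tau) \boldsymbol{\cdot} S_1 \}$, where $S_0 \in \{(\alpha^{t_1})^{[4]}, (\alpha^{t_2})^{[4]}\}$, $S_1 \in \{(\alpha^{t_1})^{[4]}, (\alpha^{t_3}\tau)^{[4]}\}$, $t_1,t_2,t_3,t_4\in[0,3]$, $t_1$ is even, $t_2$ is odd, and $t_3\not\equiv t_4 \pmod 2$.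
   Context: A sequence over a finite group $G$ is a finite unordered list of elements of $G$ with repetitions allowed; $|S|$ is its length, a subsequence is a sub-multiset, $S_1 \boldsymbol{\cdot} S_2$ denotes concatenation and $g^{[k]}$ denotes $g$ repeated $k$ times. A sequence is product-one if its terms can be ordered so that their product equals $1_G$. $\exp(G) = \operatorname{lcm}\{\operatorname{ord}(g)\mid g\in G\}$. $\mathsf s(G)$ (resp. $\mathsf E(G)$) is the smallest integer $\ell$ such that every sequence over $G$ of length at least $\ell$ has a product-one subsequence of length $\exp(G)$ (resp. $|G|$). $[a,b]=\{x\in\mathbb Z\mid a\le x\le b\}$. A dicyclic group of order $4n$ is a group with presentation $\langle \alpha,\tau \mid \alpha^{2n}=1,\ \tau^2=\alpha^n,\ \tau\alpha=\alpha^{ -1}\tau\rangle$. -}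

module Defs where

open import Level using (0ℓ)
open import Data.Nat using (ℕ; zero; suc; _+_; _*_; _∸_; _≤_; _<_; ∣_-_∣)
open import Data.Nat.Divisibility using (_∣_)
open import Data.Nat.GCD using (gcd)
open import Data.Fin using (Fin)
open import Data.List using (List; []; _∷_; _++_; [_]; length; foldr; replicate)
open import Data.List.Relation.Binary.Permutation.Propositional using (_↭_)
open import Data.Product using (Σ; ∃; ∃-syntax; _×_; _,_)
open import Data.Sum using (_⊎_)
open import Relation.Nullary using (¬_)
open import Relation.Binary.PropositionalEquality using (_≡_; _≢_)
open import Algebra.Core using (Op₁; Op₂)
open import Algebra.Structures using (IsGroup)
open import Function.Bundles using (_↔_; _⇔_)

record FinGroup : Set₁ where
  field
    Carrier : Set
    _∙_     : Op₂ Carrier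
    ε       : Carrier
    _⁻¹     : Op₁ Carrier
    isGroup : IsGroup _≡_ _∙_ ε _⁻¹
    order   : ℕ
    enum    : Carrier ↔ Fin order

module _ (G : FinGroup) where
  open FinGroup G

  pow : Carrier → ℕ → Carrier
  pow g zero    = ε
  pow g (suc k) = g ∙ pow g k

  IsOrd : Carrier → ℕ → Set
  IsOrd g k = 1 ≤ k × pow g k ≡ ε × (∀ j → 1 ≤ j → pow g j ≡ ε → k ≤ j)

  IsExp : ℕ → Set
  IsExp e = (∀ g k → IsOrd g k → k ∣ e)
          × (∀ m → (∀ g k → IsOrd g k → k ∣ m) → e ∣ m)

  -- Sequences over G: lists, considered up to permutation.
  Seq : Set
  Seq = List Carrier

  prod : Seq → Carrier
  prod = foldr _∙_ ε

  _⊑_ : Seq → Seq → Set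
  T ⊑ S = ∃[ R ] (S ↭ (T ++ R))

  ProductOne : Seq → Set
  ProductOne T = ∃[ T′ ] ((T ↭ T′) × prod T′ ≡ ε)

  HasPOSub : ℕ → Seq → Set
  HasPOSub k S = ∃[ T ] (T ⊑ S × length T ≡ k × ProductOne T)

  Forces : ℕ → ℕ → Set
  Forces k ℓ = ∀ (S : Seq) → ℓ ≤ length S → HasPOSub k S

  data Letter : Set where
    a a⁻ t t⁻ : Letter

  evalWord : Carrier → Carrier → List Letter → Carrier
  evalWord α τ []        = ε
  evalWord α τ (a  ∷ w) = α ∙ evalWord α τ w
  evalWord α τ (a⁻ ∷ w) = (α ⁻¹) ∙ evalWord α τ w
  evalWord α τ (t  ∷ w) = τ ∙ evalWord α τ w
  evalWord α τ (t⁻ ∷ w) = (τ ⁻¹) ∙ evalWord α τ w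

  Generates : Carrier → Carrier → Set
  Generates α τ = ∀ g → ∃[ w ] (evalWord α τ w ≡ g)

  -- G = ⟨ α, τ | α^{2n} = 1, τ² = α^n, τα = α⁻¹τ ⟩  (for a group of order 4n)
  DicPresentation : ℕ → Carrier → Carrier → Set
  DicPresentation n α τ =
    pow α (2 * n) ≡ ε × (τ ∙ τ) ≡ pow α n × (τ ∙ α) ≡ ((α ⁻¹) ∙ τ) × Generates α τ

IsLeast : (ℕ → Set) → ℕ → Set
IsLeast P m = P m × (∀ ℓ → P ℓ → m ≤ ℓ)

IsDicyclic : FinGroup → ℕ → Set
IsDicyclic G n = FinGroup.order G ≡ 4 * n × ∃[ α ] ∃[ τ ] DicPresentation G n α τ

module Shapes (G : FinGroup) where
  open FinGroup G

  Even Odd : ℕ → Set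
  Even x = 2 ∣ x
  Odd x = ¬ (2 ∣ x)

  Cond1b : ℕ → Seq G → Set
  Cond1b n S = ∃[ α ] ∃[ τ ] (DicPresentation G n α τ ×
      ((4 ≤ n × ∃[ r₁ ] ∃[ r₂ ] ∃[ r₃ ] (r₁ < 2 * n × r₂ < 2 * n × r₃ < 2 * n
          × gcd ∣ r₁ - r₂ ∣ (2 * n) ≡ 1
          × S ↭ (replicate (2 * n ∸ 1) (pow G α r₁) ++ replicate (2 * n ∸ 1) (pow G α r₂)
                  ++ [ pow G α r₃ ∙ τ ])))
      ⊎ (n ≡ 2 × ∃[ t₁ ] ∃[ t₂ ] ∃[ t₃ ] ∃[ t₄ ] (t₁ < 4 × t₂ < 4 × t₃ < 4 × t₄ < 4
          × Even t₁ × Odd t₂ × (Even t₃ × Odd t₄ ⊎ Odd t₃ × Even t₄)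
          × (  S ↭ (replicate 3 (pow G α t₁) ++ replicate 3 (pow G α t₂) ++ [ pow G α t₃ ∙ τ ])
             ⊎ S ↭ (replicate 3 (pow G α t₁) ++ replicate 3 (pow G α t₃ ∙ τ) ++ [ pow G α t₂ ])
             ⊎ S ↭ (replicate 3 (pow G α t₁) ++ replicate 3 (pow G α t₃ ∙ τ) ++ [ pow G α t₄ ∙ τ ]))))))

  Cond2b : ℕ → Seq G → Set
  Cond2b n S = ∃[ α ] ∃[ τ ] (DicPresentation G n α τ ×
      ((3 ≤ n × ∃[ r₁ ] ∃[ r₂ ] ∃[ r₃ ] (r₁ < 2 * n × r₂ < 2 * n × r₃ < 2 * n
          × gcd ∣ r₁ - r₂ ∣ (2 * n) ≡ 1
          × S ↭ (replicate (4 * n ∸ 1) (pow G α r₁) ++ replicate (2 * n ∸ 1) (pow G α r₂)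
                  ++ [ pow G α r₃ ∙ τ ])))
      ⊎ (n ≡ 2 × ∃[ t₁ ] ∃[ t₂ ] ∃[ t₃ ] ∃[ t₄ ] (t₁ < 4 × t₂ < 4 × t₃ < 4 × t₄ < 4
          × Even t₁ × Odd t₂ × (Even t₃ × Odd t₄ ⊎ Odd t₃ × Even t₄)
          × (  ∃[ S₀ ] ((S₀ ≡ replicate 4 (pow G α t₁) ⊎ S₀ ≡ replicate 4 (pow G α t₂))
                 × S ↭ ((replicate 3 (pow G α t₁) ++ replicate 3 (pow G α t₂) ++ [ pow G α t₃ ∙ τ ]) ++ S₀))
             ⊎ ∃[ S₁ ] ((S₁ ≡ replicate 4 (pow G α t₁) ⊎ S₁ ≡ replicate 4 (pow G α t₃ ∙ τ))
                 × (  S ↭ ((replicate 3 (pow G α t₁) ++ replicate 3 (pow G α t₃ ∙ τ) ++ [ pow G α t₂ ]) ++ S₁)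
                    ⊎ S ↭ ((replicate 3 (pow G α t₁) ++ replicate 3 (pow G α t₃ ∙ τ) ++ [ pow G α t₄ ∙ τ ]) ++ S₁))))))))

{-# OPTIONS --safe #-}

-- Put m = 2n and identify ⟨α⟩ with ℤ/m.  A sequence consisting of terms x ∈ ℤ/m
-- and of terms α^c τ is product-one if Σ ± x + Σ (c - c′ + n) = 0 for some pairing
-- of the c and, provided that there is at least one pair, some choice of signs.
-- Let k be the number of terms of S outside ⟨α⟩.
--
-- k ≤ 1: only zero-sums in ℤ/m count.  After translating the most frequent term to
-- 0, short zero-sums are removed greedily; Scherk's theorem on |A + B| bounds what
-- remains, and in the extremal case forces it to consist of copies of a generator.
--
-- 2 ≤ k ≤ n: the same procedure leaves more than n = m/2 subset sums, so that every
-- residue is a difference of two of them; such a signed sum compensates one pair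
-- outside ⟨α⟩, and the required length is reached with pairs x - x.
--
-- k > n: pair the terms of S congruent mod n, inside and outside ⟨α⟩ separately.
-- Each pair contributes 0 or n, so only a parity has to be corrected.
--
-- n = 2: pair the terms that agree modulo the centre {1, z}; products of pairs are
-- central, and exchanging two non-commuting neighbours changes the sign.
module Submission where

open import Defs hiding (a; a⁻; t; t⁻)
open import Data.Nat using (ℕ; _≤_; _∸_; _*_)
open import Data.Nat.Divisibility using (_∣_)
open import Data.List using (length)
open import Data.Product using (_×_)
open import Relation.Nullary using (¬_)
open import Relation.Binary.PropositionalEquality using (_≡_)
open import Function.Bundles using (_⇔_)

open import Algebra.Bundles using (AbelianGroup; Group)
import Algebra.Definitions.RawMonoid
import Algebra.Solver.CommutativeMonoid as CMS
open import Algebra.Structures using (IsAbelianGroup; IsGroup)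
open import Data.Bool using (Bool; true; false; not; _xor_; _∧_; if_then_else_)
import Data.Bool.Properties as 𝔹
open import Data.Empty using (⊥; ⊥-elim)
open import Data.Fin using (Fin; toℕ; fromℕ<; join; punchOut)
import Data.Fin as Fin
import Data.Fin.Properties as Finₚ
open import Data.List using (List; []; _∷_; _++_; [_]; replicate; map; concat; filter; take; drop; mapMaybe)
import Data.List.Properties as Lₚ
import Data.List.Membership.DecPropositional as DecMem
open import Data.List.Membership.Propositional using (_∈_; _∉_; find)
open import Data.List.Membership.Propositional.Properties using (∈-∃++; ∈-lookup; ∈-++⁺ˡ; ∈-++⁺ʳ; ∈-++⁻; ∈-map⁻; ∈-filter⁻; ∈-filter⁺; ∈-concat⁻)
open import Data.List.Relation.Binary.Permutation.Propositional using (_↭_; refl; prep; swap; trans; ↭-refl; ↭-sym; ↭-trans; ↭-reflexive)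
import Data.List.Relation.Binary.Permutation.Propositional.Properties as P
open import Data.List.Relation.Unary.All using (All; []; _∷_)
import Data.List.Relation.Unary.All as All
import Data.List.Relation.Unary.All.Properties as Allₚ
open import Data.List.Relation.Unary.AllPairs using (AllPairs; []; _∷_)
open import Data.List.Relation.Unary.Any using (here; there)
open import Data.List.Relation.Unary.Unique.Propositional using (Unique)
import Data.List.Relation.Unary.Unique.Propositional.Properties as Uniqueₚ
open import Data.Maybe using (Maybe; just; nothing)
open import Data.Nat as ℕ using (zero; suc; _<_; z≤n; s≤s; NonZero; _%_; _/_; ∣_-_∣)
open import Data.Nat.Coprimality using (Coprime; coprime-divisor)
open import Data.Nat.DivMod using (_mod_; %-distribˡ-+; m<n⇒m%n≡m; m%n<n; n%n≡0; m≡m%n+[m/n]*n)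
open import Data.Nat.Divisibility using (divides; m%n≡0⇒n∣m; n∣m⇒m%n≡0; *-cancelˡ-∣; m∣m*n; ∣m+n∣m⇒∣n; ∣m∣n⇒∣m+n; ∣1⇒≡1; ∣⇒≤; ∣n⇒∣m*n; ∣-antisym; %-presˡ-∣)
open import Data.Nat.GCD using (gcd; gcd[m,n]∣m; gcd[m,n]∣n; gcd-greatest)
import Data.Nat.Properties as ℕₚ
open import Data.Nat.Tactic.RingSolver using (solve-∀)
open import Data.Product using (∃; ∃₂; _,_; proj₁; proj₂)
open import Data.Product.Properties using (≡-dec)
open import Data.Sum using (_⊎_; inj₁; inj₂)
import Data.Sum.Properties as Sumₚ
open import Data.Vec as Vec using (Vec)
open import Function using (_∘_)
open import Function.Bundles using (Inverse; mk⇔)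
open import Relation.Binary.Definitions using (DecidableEquality)
open import Relation.Binary.PropositionalEquality as ≡ using (_≢_; refl; sym; cong; cong₂; subst; subst₂)
open import Relation.Nullary using (yes; no; Dec; ¬?)
open import Relation.Nullary.Decidable using (_→-dec_; _×-dec_; from-yes; map′; does)
open import Relation.Unary using (Decidable)

-- The obstacle is the exact length M. Greedy removal of zero-sums reaches it only if no removed
-- piece is longer than the supply f of zeros that fills the last gap. Hence f is the largest
-- multiplicity: a sequence whose terms occur at most f times splits into at most f sets, a sum with
-- at most one term from each set has at most f terms, and Scherk's theorem applied set by set
-- yields either such a zero-sum or more sums than there are terms. When the removal stops, counting
-- fixes what is left: m - 1 terms in the extremal case, at least m - k terms when 2 ≤ k ≤ n. With
-- signs available, a second obstacle is parity: modulo n everything cancels in pairs, but a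
-- product-one order also needs the right multiple of ν. An even number K = M/2 of pairs makes this
-- correctable. The case n = 2 is separate because the inequality 2(n - 1) > n behind the collision
-- argument fails there and further extremal sequences appear. The values of s(G) and E(G) are not
-- assumed: one extremal sequence and the forcing property one length higher determine them.

module Lists where

  open import Data.Nat using (_+_)

  -- Linear arithmetic: a ≤ b follows from the summed hypotheses X ≤ Y with slack k.
  comb : ∀ {X Y a b} k → X ≤ Y → a + Y + k ≡ b + X → a ≤ b
  comb {X} {Y} {a} {b} k X≤Y eq = ℕₚ.+-cancelʳ-≤ Y a b (begin
    a + Y     ≤⟨ ℕₚ.m≤m+n (a + Y) k ⟩
    a + Y + k ≡⟨ eq ⟩
    b + X     ≤⟨ ℕₚ.+-monoʳ-≤ b X≤Y ⟩
    b + Y     ∎)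
    where open ℕₚ.≤-Reasoning

  infixl 6 _⊹_
  _⊹_ : ∀ {a b c d} → a ≤ b → c ≤ d → a + c ≤ b + d
  _⊹_ = ℕₚ.+-mono-≤

  eq≤ : ∀ {a b} → a ≡ b → a ≤ b
  eq≤ = ℕₚ.≤-reflexive

  eq≥ : ∀ {a b} → a ≡ b → b ≤ a
  eq≥ e = ℕₚ.≤-reflexive (sym e)

  double-suc : ∀ k → suc (suc (2 * k)) ≡ 2 * suc k
  double-suc = solve-∀

  halve : ∀ {a b} → 2 * a ≤ suc (2 * b) → a ≤ b
  halve {a} {b} le with a ℕₚ.≤? b
  ... | yes a≤b = a≤b
  ... | no a≰b = ⊥-elim (ℕₚ.<-irrefl refl (comb 0 (le ⊹ ℕₚ.≰⇒> a≰b ⊹ ℕₚ.≰⇒> a≰b) (lem a b)))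
    where
    lem : ∀ a b → suc (2 * b) + (suc (2 * b) + a + a) + 0 ≡ 2 * b + (2 * a + suc b + suc b)
    lem = solve-∀

  -- Sub-multisets, multiplicities and pairings of lists.

  module _ {A : Set} where

    module PS = CMS (P.++-commutativeMonoid {A = A})
    open PS using (_⊕_; _⊜_) public
    psolve = PS.solve

    infix 4 _≼_
    _≼_ : List A → List A → Set
    X ≼ Y = ∃ λ R → Y ↭ X ++ R

    ≼-refl : ∀ {X} → X ≼ X
    ≼-refl = [] , ↭-sym (P.++-identityʳ _)

    ≼-trans : ∀ {X Y W} → X ≼ Y → Y ≼ W → X ≼ W
    ≼-trans {X} (R , p) (R' , q) =
      R ++ R' , ↭-trans q (↭-trans (P.++⁺ʳ R' p) (P.++-assoc X R R'))

    ≼-respˡ : ∀ {X Y W} → X ↭ Y → X ≼ W → Y ≼ W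
    ≼-respˡ p (R , q) = R , ↭-trans q (P.++⁺ʳ R p)

    ≼-respʳ : ∀ {X Y W} → Y ↭ W → X ≼ Y → X ≼ W
    ≼-respʳ p (R , q) = R , ↭-trans (↭-sym p) q

    ≼-++ˡ : ∀ X Y → X ≼ X ++ Y
    ≼-++ˡ X Y = Y , ↭-refl

    ≼-++ʳ : ∀ X Y → Y ≼ X ++ Y
    ≼-++ʳ X Y = X , P.++-comm X Y

    ≼-++⁺ : ∀ {X Y X' Y'} → X ≼ X' → Y ≼ Y' → X ++ Y ≼ X' ++ Y'
    ≼-++⁺ {X} {Y} (R , p) (R' , q) = R ++ R' , ↭-trans (P.++⁺ p q)
      (psolve 4 (λ x r y r' → (x ⊕ r) ⊕ (y ⊕ r') ⊜ (x ⊕ y) ⊕ (r ⊕ r')) ↭-refl X R Y R')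

    ≼-∷ : ∀ {x X Y} → X ≼ Y → x ∷ X ≼ x ∷ Y
    ≼-∷ (R , p) = R , prep _ p

    ≼-length : ∀ {X Y} → X ≼ Y → length X ≤ length Y
    ≼-length {X} (R , p) = ℕₚ.≤-trans (ℕₚ.m≤m+n (length X) (length R))
      (eq≤ (sym (≡.trans (P.↭-length p) (Lₚ.length-++ X))))

    ≼-∈ : ∀ {X Y x} → X ≼ Y → x ∈ X → x ∈ Y
    ≼-∈ (R , p) x∈ = P.∈-resp-↭ (↭-sym p) (∈-++⁺ˡ x∈)

    ≼-take : ∀ k (X : List A) → take k X ≼ X
    ≼-take k X = drop k X , ↭-reflexive (sym (Lₚ.take++drop≡id k X))

    length-take≤ : ∀ k (X : List A) → k ≤ length X → length (take k X) ≡ k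
    length-take≤ k X k≤ = ≡.trans (Lₚ.length-take k X) (ℕₚ.m≤n⇒m⊓n≡m k≤)

    ∈⇒↭ : ∀ {x : A} {X} → x ∈ X → ∃ λ X' → X ↭ x ∷ X'
    ∈⇒↭ x∈ with ∈-∃++ x∈
    ... | ys , zs , refl = ys ++ zs , P.shift _ ys zs

    replicate-+ : ∀ i j (x : A) → replicate (i + j) x ≡ replicate i x ++ replicate j x
    replicate-+ zero    j x = refl
    replicate-+ (suc i) j x = cong (x ∷_) (replicate-+ i j x)

    replicate-≼ : ∀ {i j} (x : A) → i ≤ j → replicate i x ≼ replicate j x
    replicate-≼ {i} {j} x i≤j with ℕₚ.m≤n⇒∃[o]m+o≡n i≤j
    ... | o , refl = replicate o x , ↭-reflexive (replicate-+ i o x)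

    All-≡-replicate : ∀ {x : A} {X} → All (_≡ x) X → X ≡ replicate (length X) x
    All-≡-replicate []          = refl
    All-≡-replicate (refl ∷ ps) = cong (_ ∷_) (All-≡-replicate ps)

    Unique-resp-↭ : ∀ {X Y : List A} → X ↭ Y → Unique X → Unique Y
    Unique-resp-↭ refl       u = u
    Unique-resp-↭ (prep x p) (x∉ ∷ u) = P.All-resp-↭ p x∉ ∷ Unique-resp-↭ p u
    Unique-resp-↭ (swap x y p) ((x≢y ∷ x∉) ∷ y∉ ∷ u) =
      ((λ e → x≢y (sym e)) ∷ P.All-resp-↭ p y∉) ∷ P.All-resp-↭ p x∉ ∷ Unique-resp-↭ p u
    Unique-resp-↭ (trans p q) u = Unique-resp-↭ q (Unique-resp-↭ p u)

    Unique-++ˡ : ∀ (X : List A) {Y} → Unique (X ++ Y) → Unique X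
    Unique-++ˡ []      u        = []
    Unique-++ˡ (x ∷ X) (x∉ ∷ u) = All.tabulate (λ y∈ → All.lookup x∉ (∈-++⁺ˡ y∈)) ∷ Unique-++ˡ X u

    Unique-≼ : ∀ {X Y : List A} → X ≼ Y → Unique Y → Unique X
    Unique-≼ (R , p) u = Unique-++ˡ _ (Unique-resp-↭ p u)

    lookup-injective : ∀ {X : List A} → Unique X → ∀ {i j} → Data.List.lookup X i ≡ Data.List.lookup X j → i ≡ j
    lookup-injective (x∉ ∷ u) {Fin.zero}  {Fin.zero}  e = refl
    lookup-injective (x∉ ∷ u) {Fin.zero}  {Fin.suc j} e = ⊥-elim (All.lookup x∉ (∈-lookup j) e)
    lookup-injective (x∉ ∷ u) {Fin.suc i} {Fin.zero}  e = ⊥-elim (All.lookup x∉ (∈-lookup i) (sym e))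
    lookup-injective (x∉ ∷ u) {Fin.suc i} {Fin.suc j} e = cong Fin.suc (lookup-injective u e)

    module Dec≡ (_≟_ : DecidableEquality A) where
      open DecMem _≟_ using (_∈?_) public

      indicator : ∀ {x y : A} → Dec (x ≡ y) → ℕ
      indicator (yes _) = 1
      indicator (no _)  = 0

      count : A → List A → ℕ
      count x []      = 0
      count x (y ∷ X) = indicator (x ≟ y) + count x X

      count-++ : ∀ x X Y → count x (X ++ Y) ≡ count x X + count x Y
      count-++ x []      Y = refl
      count-++ x (y ∷ X) Y = ≡.trans (cong (indicator (x ≟ y) +_) (count-++ x X Y))
        (sym (ℕₚ.+-assoc (indicator (x ≟ y)) (count x X) (count x Y)))

      count-↭ : ∀ x {X Y} → X ↭ Y → count x X ≡ count x Y
      count-↭ x refl = refl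
      count-↭ x (prep y p) = cong (indicator (x ≟ y) +_) (count-↭ x p)
      count-↭ x {_ ∷ _ ∷ X} {_ ∷ _ ∷ Y} (swap y z p) = ≡.trans
        (cong (λ k → indicator (x ≟ y) + (indicator (x ≟ z) + k)) (count-↭ x p))
        (≡.trans (sym (ℕₚ.+-assoc (indicator (x ≟ y)) (indicator (x ≟ z)) _))
          (≡.trans (cong (_+ count x Y) (ℕₚ.+-comm (indicator (x ≟ y)) (indicator (x ≟ z))))
            (ℕₚ.+-assoc (indicator (x ≟ z)) (indicator (x ≟ y)) _)))
      count-↭ x (trans p q) = ≡.trans (count-↭ x p) (count-↭ x q)

      count-≼ : ∀ x {X Y} → X ≼ Y → count x X ≤ count x Y
      count-≼ x {X} (R , p) = ℕₚ.≤-trans (ℕₚ.m≤m+n _ (count x R))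
        (eq≤ (sym (≡.trans (count-↭ x p) (count-++ x X R))))

      count-replicate : ∀ x k → count x (replicate k x) ≡ k
      count-replicate x zero    = refl
      count-replicate x (suc k) with x ≟ x
      ... | yes _  = cong suc (count-replicate x k)
      ... | no x≢x = ⊥-elim (x≢x refl)

      count-replicate-≢ : ∀ {x y} k → x ≢ y → count x (replicate k y) ≡ 0
      count-replicate-≢ zero    x≢y = refl
      count-replicate-≢ {x} {y} (suc k) x≢y with x ≟ y
      ... | yes e = ⊥-elim (x≢y e)
      ... | no _  = count-replicate-≢ k x≢y

      replicate-≼⇒≤count : ∀ {x k X} → replicate k x ≼ X → k ≤ count x X
      replicate-≼⇒≤count {x} {k} s = ℕₚ.≤-trans (eq≤ (sym (count-replicate x k))) (count-≼ x s)

      gather : ∀ x X → ∃ λ W → X ↭ replicate (count x X) x ++ W × x ∉ W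
      gather x []      = [] , refl , λ ()
      gather x (y ∷ X) with gather x X | x ≟ y
      ... | W , p , x∉W | yes refl = W , prep x p , x∉W
      ... | W , p , x∉W | no x≢y   = y ∷ W
          , ↭-trans (prep y p) (↭-sym (P.shift y (replicate (count x X) x) W))
          , λ { (here e) → x≢y e ; (there i) → x∉W i }

      argmax-count : ∀ x₀ (Y : List A) (X : List A) → ∃ λ t → ∀ x → x ∈ x₀ ∷ Y → count x X ≤ count t X
      argmax-count x₀ []      X = x₀ , λ { x (here refl) → ℕₚ.≤-refl ; x (there ()) }
      argmax-count x₀ (y ∷ Y) X with argmax-count y Y X
      ... | t , mx with ℕₚ.≤-total (count x₀ X) (count t X)
      ... | inj₁ le = t , λ { x (here refl) → le ; x (there i) → mx x i }
      ... | inj₂ ge = x₀ , λ { x (here refl) → ℕₚ.≤-refl ; x (there i) → ℕₚ.≤-trans (mx x i) ge }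

      count-∉ : ∀ {x X} → x ∉ X → count x X ≡ 0
      count-∉ {x} {[]}    x∉ = refl
      count-∉ {x} {y ∷ X} x∉ with x ≟ y
      ... | yes e = ⊥-elim (x∉ (here e))
      ... | no _  = count-∉ (λ i → x∉ (there i))

      remove-≼ : ∀ {x J U U₁} → x ∉ J → U ↭ x ∷ U₁ → J ≼ U → J ≼ U₁
      remove-≼ {x} {J} x∉J p (R , q) with ∈-++⁻ J (P.∈-resp-↭ (↭-trans (↭-sym p) q) (here refl))
      ... | inj₁ x∈J = ⊥-elim (x∉J x∈J)
      ... | inj₂ x∈R with ∈⇒↭ x∈R
      ... | R₁ , r = R₁ , P.drop-∷ (↭-trans (↭-sym p) (↭-trans q (↭-trans (P.++⁺ˡ J r) (P.shift x J R₁))))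

      -- Two subsequences of `U` may claim the same occurrence of a term. Once the common part `K`
      -- is taken out of both, they share no value, so they fit into `U` side by side.
      cancel : ∀ I J {U} → I ≼ U → J ≼ U →
               ∃ λ K → ∃₂ λ I' J' → I ↭ K ++ I' × J ↭ K ++ J' × I' ++ J' ≼ U
      cancel []      J s s' = [] , [] , J , refl , refl , s'
      cancel (x ∷ I) J {U} (R , p) s' with x ∈? J
      ... | yes x∈J with ∈⇒↭ x∈J
      ... | J₁ , q with cancel I J₁ {I ++ R} (R , refl)
                         (proj₁ s' , P.drop-∷ (↭-trans (↭-sym p) (↭-trans (proj₂ s') (P.++⁺ʳ _ q))))
      ... | K , I' , J' , a , b , c = x ∷ K , I' , J' , prep x a , ↭-trans q (prep x b)
          , ≼-trans c (≼-respʳ (↭-sym p) (≼-++ʳ [ x ] (I ++ R)))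
      cancel (x ∷ I) J {U} (R , p) s' | no x∉J with cancel I J {I ++ R} (R , refl) (remove-≼ x∉J p s')
      ... | K , I' , J' , a , b , c = K , x ∷ I' , J'
          , ↭-trans (prep x a) (↭-sym (P.shift x K I')) , b , ≼-respʳ (↭-sym p) (≼-∷ c)

      meet : ∀ (X Y : List A) → (∃ λ x → x ∈ X × x ∈ Y) ⊎ (∀ {x} → ¬ (x ∈ X × x ∈ Y))
      meet []      Y = inj₂ λ { (() , _) }
      meet (x ∷ X) Y with x ∈? Y | meet X Y
      ... | yes x∈Y | _ = inj₁ (x , here refl , x∈Y)
      ... | no _    | inj₁ (z , a , b) = inj₁ (z , there a , b)
      ... | no x∉Y  | inj₂ d = inj₂ λ { (here refl , b) → x∉Y b ; (there a , b) → d (a , b) }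

      pairUp : ∀ X → ∃₂ λ Y R → X ↭ Y ++ Y ++ R × Unique R
      pairUp []      = [] , [] , refl , []
      pairUp (x ∷ X) with pairUp X
      ... | Y , R , p , u with x ∈? R
      ... | no x∉R  = Y , x ∷ R
          , ↭-trans (prep x p) (psolve 3 (λ a y r → a ⊕ (y ⊕ (y ⊕ r)) ⊜ y ⊕ (y ⊕ (a ⊕ r))) ↭-refl [ x ] Y R)
          , All.tabulate (λ { i refl → x∉R i }) ∷ u
      ... | yes x∈R with ∈⇒↭ x∈R
      ... | R' , q = x ∷ Y , R'
          , ↭-trans (prep x (↭-trans p (P.++⁺ˡ Y (P.++⁺ˡ Y q))))
              (psolve 3 (λ a y r → a ⊕ (y ⊕ (y ⊕ (a ⊕ r))) ⊜ (a ⊕ y) ⊕ ((a ⊕ y) ⊕ r)) ↭-refl [ x ] Y R')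
          , Unique-≼ (≼-++ʳ [ x ] R') (Unique-resp-↭ q u)

open Lists

-- Finiteness, the exponent and the uniqueness of the involution ν are all that is used of ℤ/2n.
record EvenGroup (n : ℕ) : Set₁ where
  infixl 6 _+_ _-_
  infix  9 -_
  infixr 8 _·_
  field
    Z   : Set
    _+_ : Z → Z → Z
    0#  : Z
    -_  : Z → Z
    isAbelianGroup : IsAbelianGroup _≡_ _+_ 0# -_
    _≟_ : DecidableEquality Z
    index : Z → Fin (2 ℕ.* n)
    index-injective : ∀ {x y} → index x ≡ index y → x ≡ y
    ν   : Z
    ν≢0 : ν ≢ 0#
    ν+ν≡0 : ν + ν ≡ 0#
    involution : ∀ x → x + x ≡ 0# → x ≡ 0# ⊎ x ≡ ν

  abelianGroup : AbelianGroup _ _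
  abelianGroup = record { isAbelianGroup = isAbelianGroup }

  _-_ : Z → Z → Z
  x - y = x + - y

  _·_ : ℕ → Z → Z
  _·_ = Algebra.Definitions.RawMonoid._×_ (AbelianGroup.rawMonoid abelianGroup)

  field
    order· : ∀ x → (2 ℕ.* n) · x ≡ 0#

-- The residues modulo m as an abelian group on `Fin m`.

module Mod (m : ℕ) .{{_ : NonZero m}} where

  ⟨_⟩ : ℕ → Fin m
  ⟨ a ⟩ = a mod m

  toℕ-⟨⟩ : ∀ a → toℕ ⟨ a ⟩ ≡ a % m
  toℕ-⟨⟩ a = Finₚ.toℕ-fromℕ< (m%n<n a m)

  ⟨⟩-cong : ∀ {a b} → a % m ≡ b % m → ⟨ a ⟩ ≡ ⟨ b ⟩
  ⟨⟩-cong {a} {b} e = Finₚ.toℕ-injective (≡.trans (toℕ-⟨⟩ a) (≡.trans e (sym (toℕ-⟨⟩ b))))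

  ⟨⟩-toℕ : ∀ x → ⟨ toℕ x ⟩ ≡ x
  ⟨⟩-toℕ x = Finₚ.toℕ-injective (≡.trans (toℕ-⟨⟩ (toℕ x)) (m<n⇒m%n≡m (Finₚ.toℕ<n x)))

  infixl 6 _+ₘ_
  _+ₘ_ : Fin m → Fin m → Fin m
  x +ₘ y = ⟨ toℕ x ℕ.+ toℕ y ⟩

  -ₘ_ : Fin m → Fin m
  -ₘ x = ⟨ m ℕ.∸ toℕ x ⟩

  ⟨⟩-+ : ∀ a b → ⟨ a ⟩ +ₘ ⟨ b ⟩ ≡ ⟨ a ℕ.+ b ⟩
  ⟨⟩-+ a b = ⟨⟩-cong (≡.trans (cong₂ (λ i j → (i ℕ.+ j) % m) (toℕ-⟨⟩ a) (toℕ-⟨⟩ b)) (sym (%-distribˡ-+ a b m)))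

  ⟨⟩-+ˡ : ∀ a y → ⟨ a ⟩ +ₘ y ≡ ⟨ a ℕ.+ toℕ y ⟩
  ⟨⟩-+ˡ a y = ≡.trans (cong (⟨ a ⟩ +ₘ_) (sym (⟨⟩-toℕ y))) (⟨⟩-+ a (toℕ y))

  ⟨⟩-+ʳ : ∀ x b → x +ₘ ⟨ b ⟩ ≡ ⟨ toℕ x ℕ.+ b ⟩
  ⟨⟩-+ʳ x b = ≡.trans (cong (_+ₘ ⟨ b ⟩) (sym (⟨⟩-toℕ x))) (⟨⟩-+ (toℕ x) b)

  +ₘ-comm : ∀ x y → x +ₘ y ≡ y +ₘ x
  +ₘ-comm x y = cong ⟨_⟩ (ℕₚ.+-comm (toℕ x) (toℕ y))

  +ₘ-assoc : ∀ x y z → x +ₘ y +ₘ z ≡ x +ₘ (y +ₘ z)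
  +ₘ-assoc x y z = ≡.trans (⟨⟩-+ˡ (toℕ x ℕ.+ toℕ y) z)
    (≡.trans (cong ⟨_⟩ (ℕₚ.+-assoc (toℕ x) (toℕ y) (toℕ z))) (sym (⟨⟩-+ʳ x (toℕ y ℕ.+ toℕ z))))

  +ₘ-identityˡ : ∀ x → ⟨ 0 ⟩ +ₘ x ≡ x
  +ₘ-identityˡ x = ≡.trans (⟨⟩-+ˡ 0 x) (⟨⟩-toℕ x)

  ⟨m⟩≡⟨0⟩ : ⟨ m ⟩ ≡ ⟨ 0 ⟩
  ⟨m⟩≡⟨0⟩ = ⟨⟩-cong (≡.trans (n%n≡0 m) (sym (n∣m⇒m%n≡0 0 m (divides 0 refl))))

  -ₘ-inverseˡ : ∀ x → -ₘ x +ₘ x ≡ ⟨ 0 ⟩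
  -ₘ-inverseˡ x = ≡.trans (⟨⟩-+ˡ (m ℕ.∸ toℕ x) x) (≡.trans (cong ⟨_⟩ (ℕₚ.m∸n+n≡m (ℕₚ.<⇒≤ (Finₚ.toℕ<n x)))) ⟨m⟩≡⟨0⟩)

  isAbelianGroup : IsAbelianGroup _≡_ _+ₘ_ ⟨ 0 ⟩ -ₘ_
  isAbelianGroup = record
    { isGroup = record
      { isMonoid = record
        { isSemigroup = record
          { isMagma = record { isEquivalence = ≡.isEquivalence ; ∙-cong = cong₂ _+ₘ_ }
          ; assoc = +ₘ-assoc }
        ; identity = +ₘ-identityˡ , λ x → ≡.trans (+ₘ-comm x ⟨ 0 ⟩) (+ₘ-identityˡ x) }
      ; inverse = -ₘ-inverseˡ , λ x → ≡.trans (+ₘ-comm x (-ₘ x)) (-ₘ-inverseˡ x)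
      ; ⁻¹-cong = cong -ₘ_ }
    ; comm = +ₘ-comm }

  open import Algebra.Bundles using (AbelianGroup)
  abGroup : AbelianGroup _ _
  abGroup = record { isAbelianGroup = isAbelianGroup }
  open import Algebra.Definitions.RawMonoid (AbelianGroup.rawMonoid abGroup) using () renaming (_×_ to _·ₘ_)

  ·ₘ-⟨⟩ : ∀ k x → k ·ₘ x ≡ ⟨ k ℕ.* toℕ x ⟩
  ·ₘ-⟨⟩ zero    x = refl
  ·ₘ-⟨⟩ (suc k) x = ≡.trans (cong (x +ₘ_) (·ₘ-⟨⟩ k x)) (⟨⟩-+ʳ x (k ℕ.* toℕ x))

  order·ₘ : ∀ x → m ·ₘ x ≡ ⟨ 0 ⟩
  order·ₘ x = ≡.trans (·ₘ-⟨⟩ m x) (⟨⟩-cong (≡.trans (n∣m⇒m%n≡0 (m ℕ.* toℕ x) m (m∣m*n (toℕ x))) (sym (n∣m⇒m%n≡0 0 m (divides 0 refl)))))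

  ⟨⟩≡0⇒∣ : ∀ {a} → ⟨ a ⟩ ≡ ⟨ 0 ⟩ → m ∣ a
  ⟨⟩≡0⇒∣ {a} e = m%n≡0⇒n∣m a m (≡.trans (sym (toℕ-⟨⟩ a)) (≡.trans (cong toℕ e) (≡.trans (toℕ-⟨⟩ 0) (n∣m⇒m%n≡0 0 m (divides 0 refl)))))

module _ (n : ℕ) .{{_ : NonZero n}} where

  private instance
    2n≢0 : NonZero (2 ℕ.* n)
    2n≢0 = ℕₚ.m*n≢0 2 n

  open Mod (2 ℕ.* n)

  n<2n : n < 2 ℕ.* n
  n<2n = ℕₚ.m<m+n n (ℕₚ.≤-trans (ℕ.>-nonZero⁻¹ n) (eq≥ (ℕₚ.+-identityʳ n)))

  private
    ν-nonzero : ⟨ n ⟩ ≢ ⟨ 0 ⟩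
    ν-nonzero e with ⟨⟩≡0⇒∣ {n} e
    ... | divides zero e′    = ℕₚ.<-irrefl (sym e′) (ℕ.>-nonZero⁻¹ n)
    ... | divides (suc q) e′ = ℕₚ.<-irrefl refl (ℕₚ.≤-trans n<2n (ℕₚ.≤-trans (ℕₚ.m≤m+n _ (q ℕ.* (2 ℕ.* n))) (eq≥ e′)))

    -- 2n divides 2x, so n divides x, and the only multiples of n below 2n are 0 and n.
    involution′ : ∀ x → x +ₘ x ≡ ⟨ 0 ⟩ → x ≡ ⟨ 0 ⟩ ⊎ x ≡ ⟨ n ⟩
    involution′ x e with *-cancelˡ-∣ {n} {toℕ x} 2 (subst (2 ℕ.* n ∣_) (cong (toℕ x ℕ.+_) (sym (ℕₚ.+-identityʳ (toℕ x)))) (⟨⟩≡0⇒∣ e))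
    ... | divides zero e′       = inj₁ (≡.trans (sym (⟨⟩-toℕ x)) (cong ⟨_⟩ e′))
    ... | divides (suc zero) e′ = inj₂ (≡.trans (sym (⟨⟩-toℕ x)) (cong ⟨_⟩ (≡.trans e′ (ℕₚ.+-identityʳ n))))
    ... | divides (suc (suc q)) e′ = ⊥-elim (ℕₚ.<-irrefl refl (ℕₚ.≤-trans (Finₚ.toℕ<n x)
          (ℕₚ.≤-trans (ℕₚ.+-monoʳ-≤ n (ℕₚ.+-monoʳ-≤ n z≤n)) (eq≥ e′))))

  residues : EvenGroup n
  residues = record
    { Z = Fin (2 ℕ.* n) ; _+_ = _+ₘ_ ; 0# = ⟨ 0 ⟩ ; -_ = -ₘ_ ; isAbelianGroup = isAbelianGroup
    ; _≟_ = Finₚ._≟_ ; index = λ x → x ; index-injective = λ e → e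
    ; ν = ⟨ n ⟩ ; ν≢0 = ν-nonzero
    ; ν+ν≡0 = ≡.trans (⟨⟩-+ n n) (≡.trans (cong (λ k → ⟨ n ℕ.+ k ⟩) (sym (ℕₚ.+-identityʳ n))) ⟨m⟩≡⟨0⟩)
    ; involution = involution′ ; order· = order·ₘ }

-- Linear identities in an abelian group by reflection.

module Solver {n : ℕ} (𝔾 : EvenGroup n) where

  open EvenGroup 𝔾
  open import Data.Vec using ([]; _∷_)
  open import Data.Fin using (zero; suc)

  open AbelianGroup abelianGroup public using (comm; assoc; identityˡ; identityʳ; inverseˡ; inverseʳ)
  open AbelianGroup abelianGroup using (commutativeMonoid; monoid; group)
  open import Algebra.Properties.AbelianGroup abelianGroup using (⁻¹-∙-comm)
  open import Algebra.Properties.Group group using (⁻¹-involutive; ε⁻¹≈ε)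
  open import Algebra.Properties.Monoid.Mult monoid public using () renaming (×-homo-+ to ·-homo-+; ×-assocˡ to ·-assoc)
  open import Algebra.Properties.CommutativeMonoid.Mult commutativeMonoid public using () renaming (×-distrib-+ to ·-distrib-+)
  import Algebra.Solver.CommutativeMonoid commutativeMonoid as CM

  open ≡.≡-Reasoning

  infixl 6 _⊞_
  infix 8 ⊟_
  data Expr (k : ℕ) : Set where
    var : Fin k → Expr k
    𝟎   : Expr k
    _⊞_ : Expr k → Expr k → Expr k
    ⊟_  : Expr k → Expr k

  ⟦_⟧ : ∀ {k} → Expr k → Vec Z k → Z
  ⟦ var i ⟧ ρ = Vec.lookup ρ i
  ⟦ 𝟎 ⟧     ρ = 0#
  ⟦ e ⊞ f ⟧ ρ = ⟦ e ⟧ ρ + ⟦ f ⟧ ρ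
  ⟦ ⊟ e ⟧   ρ = - ⟦ e ⟧ ρ

  -- The coefficient (p , q) stands for p - q.
  Coef : Set
  Coef = ℕ × ℕ

  val : Coef → Z → Z
  val (p , q) x = (p · x) + (- (q · x))

  -- Cancelling until one component is 0 makes the coefficient canonical. Equal linear expressions
  -- then have identical normal forms, and `refl` closes each call of `solve`.
  reduce : ℕ → ℕ → Coef
  reduce (suc p) (suc q) = reduce p q
  reduce p       q       = p , q

  medial : ∀ a b c d → (a + b) + (c + d) ≡ (a + c) + (b + d)
  medial = CM.solve 4 (λ a b c d → (a CM.⊕ b) CM.⊕ (c CM.⊕ d) CM.⊜ (a CM.⊕ c) CM.⊕ (b CM.⊕ d)) refl

  reduce-val : ∀ p q x → val (reduce p q) x ≡ val (p , q) x
  reduce-val zero    q       x = refl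
  reduce-val (suc p) zero    x = refl
  reduce-val (suc p) (suc q) x = begin
    val (reduce p q) x                          ≡⟨ reduce-val p q x ⟩
    (p · x) + (- (q · x))                       ≡⟨ identityˡ _ ⟨
    0# + ((p · x) + (- (q · x)))                ≡⟨ cong (_+ (p · x + - (q · x))) (inverseʳ x) ⟨
    (x + (- x)) + ((p · x) + (- (q · x)))       ≡⟨ medial x (- x) (p · x) (- (q · x)) ⟩
    (x + (p · x)) + ((- x) + (- (q · x)))       ≡⟨ cong ((x + (p · x)) +_) (⁻¹-∙-comm x (q · x)) ⟩
    (x + (p · x)) + (- (x + (q · x)))           ∎

  addC : Coef → Coef → Coef
  addC (p , q) (p' , q') = reduce (p ℕ.+ p') (q ℕ.+ q')

  negC : Coef → Coef
  negC (p , q) = q , p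

  addC-val : ∀ c d x → val (addC c d) x ≡ val c x + val d x
  addC-val (p , q) (p' , q') x = begin
    val (reduce (p ℕ.+ p') (q ℕ.+ q')) x                    ≡⟨ reduce-val (p ℕ.+ p') (q ℕ.+ q') x ⟩
    ((p ℕ.+ p') · x) + (- ((q ℕ.+ q') · x))                 ≡⟨ cong₂ (λ a b → a + (- b)) (·-homo-+ x p p') (·-homo-+ x q q') ⟩
    ((p · x) + (p' · x)) + (- ((q · x) + (q' · x)))         ≡⟨ cong (((p · x) + (p' · x)) +_) (⁻¹-∙-comm (q · x) (q' · x)) ⟨
    ((p · x) + (p' · x)) + ((- (q · x)) + (- (q' · x)))     ≡⟨ medial _ _ _ _ ⟩
    val (p , q) x + val (p' , q') x                         ∎

  negC-val : ∀ c x → val (negC c) x ≡ - val c x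
  negC-val (p , q) x = begin
    (q · x) + (- (p · x))         ≡⟨ comm _ _ ⟩
    (- (p · x)) + (q · x)         ≡⟨ cong ((- (p · x)) +_) (⁻¹-involutive (q · x)) ⟨
    (- (p · x)) + (- (- (q · x))) ≡⟨ ⁻¹-∙-comm _ _ ⟩
    - ((p · x) + (- (q · x)))     ∎

  NF : ℕ → Set
  NF k = Vec Coef k

  ⟦_⟧N : ∀ {k} → NF k → Vec Z k → Z
  ⟦ [] ⟧N    []      = 0#
  ⟦ c ∷ cs ⟧N (x ∷ ρ) = val c x + ⟦ cs ⟧N ρ

  zeroN : ∀ k → NF k
  zeroN k = Vec.replicate k (0 , 0)

  unitN : ∀ {k} → Fin k → NF k
  unitN zero    = (1 , 0) ∷ zeroN _
  unitN (suc i) = (0 , 0) ∷ unitN i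

  norm : ∀ {k} → Expr k → NF k
  norm (var i) = unitN i
  norm 𝟎       = zeroN _
  norm (e ⊞ f) = Vec.zipWith addC (norm e) (norm f)
  norm (⊟ e)   = Vec.map negC (norm e)

  val-0 : ∀ x → val (0 , 0) x ≡ 0#
  val-0 x = inverseʳ 0#

  zeroN-val : ∀ {k} (ρ : Vec Z k) → ⟦ zeroN k ⟧N ρ ≡ 0#
  zeroN-val []      = refl
  zeroN-val (x ∷ ρ) = ≡.trans (cong₂ _+_ (val-0 x) (zeroN-val ρ)) (identityˡ 0#)

  unitN-val : ∀ {k} (i : Fin k) (ρ : Vec Z k) → ⟦ unitN i ⟧N ρ ≡ Vec.lookup ρ i
  unitN-val zero (x ∷ ρ) = begin
    (1 · x) + (- 0#) + ⟦ zeroN _ ⟧N ρ ≡⟨ cong₂ _+_ (cong₂ _+_ (identityʳ x) ε⁻¹≈ε) (zeroN-val ρ) ⟩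
    (x + 0#) + 0#                     ≡⟨ ≡.trans (identityʳ _) (identityʳ x) ⟩
    x                                 ∎
  unitN-val (suc i) (x ∷ ρ) = ≡.trans (cong₂ _+_ (val-0 x) (unitN-val i ρ)) (identityˡ _)

  add-val : ∀ {k} (u v : NF k) ρ → ⟦ Vec.zipWith addC u v ⟧N ρ ≡ ⟦ u ⟧N ρ + ⟦ v ⟧N ρ
  add-val []      []      []      = sym (identityˡ 0#)
  add-val (c ∷ u) (d ∷ v) (x ∷ ρ) = ≡.trans (cong₂ _+_ (addC-val c d x) (add-val u v ρ)) (medial _ _ _ _)

  neg-val : ∀ {k} (u : NF k) ρ → ⟦ Vec.map negC u ⟧N ρ ≡ - ⟦ u ⟧N ρ
  neg-val []      []      = sym ε⁻¹≈ε
  neg-val (c ∷ u) (x ∷ ρ) = ≡.trans (cong₂ _+_ (negC-val c x) (neg-val u ρ)) (⁻¹-∙-comm _ _)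

  correct : ∀ {k} (e : Expr k) ρ → ⟦ norm e ⟧N ρ ≡ ⟦ e ⟧ ρ
  correct (var i) ρ = unitN-val i ρ
  correct 𝟎       ρ = zeroN-val ρ
  correct (e ⊞ f) ρ = ≡.trans (add-val (norm e) (norm f) ρ) (cong₂ _+_ (correct e ρ) (correct f ρ))
  correct (⊟ e)   ρ = ≡.trans (neg-val (norm e) ρ) (cong -_ (correct e ρ))

  open import Relation.Binary.Reflection (≡.setoid Z) var ⟦_⟧ (λ e → ⟦ norm e ⟧N) correct public
    using (solve) renaming (_⊜_ to _≗_)

-- Scherk's theorem, its iteration over layers, and the greedy removal of zero-sums.

module Scherk {n : ℕ} (𝔾 : EvenGroup n) where
  open EvenGroup 𝔾
  open Solver 𝔾
  open Dec≡ _≟_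

  infix 4 _⊆_
  _⊆_ : List Z → List Z → Set
  X ⊆ Y = ∀ x → x ∈ X → x ∈ Y

  sum : List Z → Z
  sum []      = 0#
  sum (x ∷ X) = x + sum X

  sum-++ : ∀ X Y → sum (X ++ Y) ≡ sum X + sum Y
  sum-++ []      Y = sym (identityˡ _)
  sum-++ (x ∷ X) Y = ≡.trans (cong (x +_) (sum-++ X Y)) (sym (assoc x (sum X) (sum Y)))

  sum-↭ : ∀ {X Y} → X ↭ Y → sum X ≡ sum Y
  sum-↭ _↭_.refl   = refl
  sum-↭ (prep x p) = cong (x +_) (sum-↭ p)
  sum-↭ {_ ∷ _ ∷ X} {_ ∷ _ ∷ Y} (swap x y p) = ≡.trans (cong (λ s → x + (y + s)) (sum-↭ p))
    (solve 3 (λ x y s → x ⊞ (y ⊞ s) ≗ y ⊞ (x ⊞ s)) refl x y (sum Y))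
  sum-↭ (trans p q) = ≡.trans (sum-↭ p) (sum-↭ q)

  sum-replicate : ∀ k x → sum (replicate k x) ≡ k · x
  sum-replicate zero    x = refl
  sum-replicate (suc k) x = cong (x +_) (sum-replicate k x)

  +-cancelˡ : ∀ x {y z} → x + y ≡ x + z → y ≡ z
  +-cancelˡ x {y} {z} e = ≡.trans (solve 2 (λ x y → y ≗ (⊟ x) ⊞ (x ⊞ y)) refl x y)
    (≡.trans (cong (- x +_) e) (solve 2 (λ x y → (⊟ x) ⊞ (x ⊞ y) ≗ y) refl x z))

  unique-length : ∀ {X : List Z} → Unique X → length X ≤ 2 ℕ.* n
  unique-length {X} u = Finₚ.injective⇒≤ {f = λ i → index (Data.List.lookup X i)}
    (λ e → lookup-injective u (index-injective e))

  filter-split : ∀ {P : Z → Set} (P? : Decidable P) X →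
                 length (filter P? X) ℕ.+ length (filter (¬? ∘ P?) X) ≡ length X
  filter-split P? []      = refl
  filter-split P? (x ∷ X) with P? x
  ... | yes _ = cong suc (filter-split P? X)
  ... | no  _ = ≡.trans (ℕₚ.+-suc _ _) (cong suc (filter-split P? X))

  ∈⇒1≤ : ∀ {x} {X : List Z} → x ∈ X → 1 ≤ length X
  ∈⇒1≤ (here _)  = s≤s z≤n
  ∈⇒1≤ (there _) = s≤s z≤n

  Growth : List Z → List Z → Set
  Growth A B =
    (∃₂ λ a b → a ∈ A × b ∈ B × a + b ≡ 0#) ⊎
    (∃ λ C → Unique C × length A ℕ.+ length B ≤ length C × A ⊆ C ×
       (∀ {c} → c ∈ C → c ∈ A ⊎ (∃₂ λ a b → a ∈ A × b ∈ B × c ≡ a + b)))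

  -- Scherk's theorem: if 0 = a + b has no solution with a ∈ A and b ∈ B then
  -- A + (B ∪ {0}) has at least |A| + |B| elements.  When some a + b is not in A,
  -- the elements b with this property are moved from B into A as a + b.
  scherk : ∀ k A B → length B ≤ k → Unique A → Unique B → 0# ∉ B → 0# ∈ A →
           Growth A B
  scherk k A [] _ uA uB 0∉B 0∈A = inj₂ (A , uA , eq≤ (ℕₚ.+-identityʳ _) , (λ _ i → i) , inj₁)
  scherk (suc k) A B@(b₀ ∷ _) B≤k uA uB 0∉B 0∈A
    with All.all? (λ a → All.all? (λ b → (a + b) ∈? A) B) A
  -- A set that contains 0 and is closed under adding `b₀` contains all multiples of `b₀`, in
  -- particular (m - 1) b₀ = - b₀.
  ... | yes closed = inj₁ (((2 ℕ.* n) ℕ.∸ 1) · b₀ , b₀ , multiple ((2 ℕ.* n) ℕ.∸ 1) , here refl , last)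
    where
    multiple : ∀ j → j · b₀ ∈ A
    multiple zero    = 0∈A
    multiple (suc j) = subst (_∈ A) (comm _ b₀) (All.head (All.lookup closed (multiple j)))
    pred : ∀ j → 1 ≤ j → (j ℕ.∸ 1) · b₀ + b₀ ≡ j · b₀
    pred (suc j) _ = comm _ b₀
    last : ((2 ℕ.* n) ℕ.∸ 1) · b₀ + b₀ ≡ 0#
    last = ≡.trans (pred (2 ℕ.* n) (unique-length {[ b₀ ]} ([] ∷ []))) (order· b₀)
  ... | no ¬closed with find (Allₚ.¬All⇒Any¬ (λ a → All.all? (λ b → (a + b) ∈? A) B) A ¬closed)
  ... | a , a∈A , ¬all = finish (scherk k (A ++ map (a +_) B⁻) B⁺ B⁺≤k uA′ uB⁺ 0∉B⁺ (∈-++⁺ˡ 0∈A))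
    where
    P? : Decidable (λ b → (a + b) ∈ A)
    P? b = (a + b) ∈? A
    B⁺ B⁻ : List Z
    B⁺ = filter P? B
    B⁻ = filter (¬? ∘ P?) B
    B⁻≥1 : 1 ≤ length B⁻
    B⁻≥1 with find (Allₚ.¬All⇒Any¬ P? B ¬all)
    ... | b , b∈ , a+b∉ = ∈⇒1≤ (∈-filter⁺ (¬? ∘ P?) b∈ a+b∉)
    B⁺≤k : length B⁺ ≤ k
    B⁺≤k = ℕₚ.≤-pred (ℕₚ.≤-trans (ℕₚ.≤-trans (ℕₚ.+-monoˡ-≤ (length B⁺) B⁻≥1)
      (eq≤ (≡.trans (ℕₚ.+-comm (length B⁻) (length B⁺)) (filter-split P? B)))) B≤k)
    uB⁺ = Uniqueₚ.filter⁺ P? uB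
    0∉B⁺ : 0# ∉ B⁺
    0∉B⁺ i = 0∉B (proj₁ (∈-filter⁻ P? i))
    uA′ : Unique (A ++ map (a +_) B⁻)
    uA′ = Uniqueₚ.++⁺ uA (Uniqueₚ.map⁺ (+-cancelˡ a) (Uniqueₚ.filter⁺ (¬? ∘ P?) uB)) disjoint
      where
      disjoint : ∀ {x} → ¬ (x ∈ A × x ∈ map (a +_) B⁻)
      disjoint (x∈A , x∈) with ∈-map⁻ (a +_) x∈
      ... | b , b∈ , refl = proj₂ (∈-filter⁻ (¬? ∘ P?) {xs = B} b∈) x∈A
    old : ∀ {x} → x ∈ A ++ map (a +_) B⁻ → x ∈ A ⊎ (∃ λ b → b ∈ B × x ≡ a + b)
    old x∈ with ∈-++⁻ A x∈
    ... | inj₁ i = inj₁ i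
    ... | inj₂ i with ∈-map⁻ (a +_) i
    ... | b , b∈ , e = inj₂ (b , proj₁ (∈-filter⁻ (¬? ∘ P?) b∈) , e)
    -- A sum of the enlarged `A` and the reduced `B` is again one of the old sets: a + b lies in `A`
    -- because `b` stayed in `B⁺`, and b′ belongs to `B`. So the transformation creates no new sums.
    swap+ : ∀ b b′ → (a + b′) + b ≡ (a + b) + b′
    swap+ b b′ = solve 3 (λ a b c → (a ⊞ c) ⊞ b ≗ (a ⊞ b) ⊞ c) refl a b b′
    finish : Growth (A ++ map (a +_) B⁻) B⁺ → Growth A B
    finish (inj₁ (a′ , b , a′∈ , b∈ , e)) with old a′∈ | ∈-filter⁻ P? {xs = B} b∈
    ... | inj₁ i              | b∈B , _ = inj₁ (a′ , b , i , b∈B , e)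
    ... | inj₂ (b′ , i , refl) | b∈B , q = inj₁ (a + b , b′ , q , i , ≡.trans (sym (swap+ b b′)) e)
    finish (inj₂ (C , uC , C≥ , A′⊆C , split)) = inj₂ (C , uC , ℕₚ.≤-trans (eq≤ size) C≥ , (λ _ i → A′⊆C _ (∈-++⁺ˡ i)) , split′)
      where
      open ≡.≡-Reasoning
      size : length A ℕ.+ length B ≡ length (A ++ map (a +_) B⁻) ℕ.+ length B⁺
      size = begin
        length A ℕ.+ length B                            ≡⟨ cong (length A ℕ.+_) (filter-split P? B) ⟨
        length A ℕ.+ (length B⁺ ℕ.+ length B⁻)           ≡⟨ cong (length A ℕ.+_) (ℕₚ.+-comm (length B⁺) _) ⟩
        length A ℕ.+ (length B⁻ ℕ.+ length B⁺)           ≡⟨ ℕₚ.+-assoc (length A) _ _ ⟨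
        length A ℕ.+ length B⁻ ℕ.+ length B⁺             ≡⟨ cong (λ l → length A ℕ.+ l ℕ.+ length B⁺) (Lₚ.length-map (a +_) B⁻) ⟨
        length A ℕ.+ length (map (a +_) B⁻) ℕ.+ length B⁺ ≡⟨ cong (ℕ._+ length B⁺) (Lₚ.length-++ A) ⟨
        length (A ++ map (a +_) B⁻) ℕ.+ length B⁺        ∎
      split′ : ∀ {c} → c ∈ C → c ∈ A ⊎ (∃₂ λ a b → a ∈ A × b ∈ B × c ≡ a + b)
      split′ c∈ with split c∈
      ... | inj₁ i with old i
      ... | inj₁ j = inj₁ j
      ... | inj₂ (b , j , e) = inj₂ (a , b , a∈A , j , e)
      split′ c∈ | inj₂ (a′ , b , a′∈ , b∈ , e) with old a′∈ | ∈-filter⁻ P? {xs = B} b∈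
      ... | inj₁ i               | b∈B , _ = inj₂ (a′ , b , i , b∈B , e)
      ... | inj₂ (b′ , i , refl) | b∈B , q = inj₂ (a + b , b′ , q , i , ≡.trans e (swap+ b b′))

  -- The conjugate of the multiplicity partition: the i-th layer holds the values that occur at
  -- least i times. A sum with at most one term from each layer is then short, and the layers are
  -- sets, as Scherk's theorem demands.
  record Layered (U : List Z) : Set where
    field
      layers   : List (List Z)
      union    : concat layers ↭ U
      unique   : All Unique layers
      nonempty : All (λ l → 1 ≤ length l) layers
      chain    : AllPairs (λ l l′ → l′ ⊆ l) layers

  insert : Z → List (List Z) → List (List Z)
  insert x []       = [ [ x ] ]
  insert x (l ∷ Ls) with x ∈? l
  ... | yes _ = l ∷ insert x Ls
  ... | no  _ = (x ∷ l) ∷ Ls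

  insert-union : ∀ x Ls → concat (insert x Ls) ↭ x ∷ concat Ls
  insert-union x []       = ↭-refl
  insert-union x (l ∷ Ls) with x ∈? l
  ... | yes _ = ↭-trans (P.++⁺ˡ l (insert-union x Ls)) (P.shift x l (concat Ls))
  ... | no  _ = ↭-refl

  insert-All : ∀ {P : List Z → Set} x Ls → P [ x ] → (∀ {l} → x ∉ l → P l → P (x ∷ l)) →
               All P Ls → All P (insert x Ls)
  insert-All x []       p[] p∷ []       = p[] ∷ []
  insert-All x (l ∷ Ls) p[] p∷ (p ∷ ps) with x ∈? l
  ... | yes _   = p ∷ insert-All x Ls p[] p∷ ps
  ... | no  x∉l = p∷ x∉l p ∷ ps

  ∷-⊆ : ∀ {x : Z} {X Y} → x ∈ Y → X ⊆ Y → x ∷ X ⊆ Y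
  ∷-⊆ x∈ X⊆ _ (here refl) = x∈
  ∷-⊆ x∈ X⊆ _ (there i)   = X⊆ _ i

  insert-chain : ∀ x Ls → AllPairs (λ l l′ → l′ ⊆ l) Ls → AllPairs (λ l l′ → l′ ⊆ l) (insert x Ls)
  insert-chain x []       []       = [] ∷ []
  insert-chain x (l ∷ Ls) (p ∷ ps) with x ∈? l
  ... | yes x∈l = insert-All x Ls (∷-⊆ x∈l (λ _ ())) (λ _ → ∷-⊆ x∈l) p ∷ insert-chain x Ls ps
  ... | no  _   = All.map (λ s z i → there (s z i)) p ∷ ps

  layer : ∀ U → Layered U
  layer []      = record { layers = [] ; union = ↭-refl ; unique = [] ; nonempty = [] ; chain = [] }
  layer (x ∷ U) = record
    { layers   = insert x layers
    ; union    = ↭-trans (insert-union x layers) (prep x union)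
    ; unique   = insert-All x layers ([] ∷ []) (λ x∉ u → All.tabulate (λ { i refl → x∉ i }) ∷ u) unique
    ; nonempty = insert-All x layers (s≤s z≤n) (λ _ _ → s≤s z≤n) nonempty
    ; chain    = insert-chain x layers chain
    }
    where open Layered (layer U)

  common : ∀ l Ls → All (λ l → 1 ≤ length l) (l ∷ Ls) → AllPairs (λ l l′ → l′ ⊆ l) (l ∷ Ls) →
           ∃ λ x → All (x ∈_) (l ∷ Ls)
  common (x ∷ l) []        _        _                 = x , here refl ∷ []
  common l       (l′ ∷ Ls) (_ ∷ ne) ((s ∷ _) ∷ ch) with common l′ Ls ne ch
  ... | x , x∈l′ ∷ x∈ = x , s x x∈l′ ∷ x∈l′ ∷ x∈

  tower : ∀ {x} {Ls : List (List Z)} → All (x ∈_) Ls → replicate (length Ls) x ≼ concat Ls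
  tower []        = ≼-refl
  tower (x∈ ∷ xs) with ∈⇒↭ x∈
  ... | l , p = ≼-++⁺ (≼-respʳ (↭-sym p) (≼-++ˡ _ l)) (tower xs)

  -- The layers decrease, so an element of the last one lies in all of them, and its multiplicity in
  -- `U` is at least the number of layers.
  layers≤ : ∀ {U} (L : Layered U) f → (∀ x → count x U ≤ f) → length (Layered.layers L) ≤ f
  layers≤ {U} L f bound = go (Layered.layers L) (Layered.nonempty L) (Layered.chain L) (Layered.union L)
    where
    go : ∀ Ls → All (λ l → 1 ≤ length l) Ls → AllPairs (λ l l′ → l′ ⊆ l) Ls → concat Ls ↭ U → length Ls ≤ f
    go []       ne ch p = z≤n
    go (l ∷ Ls) ne ch p with common l Ls ne ch
    ... | x , x∈ = ℕₚ.≤-trans (replicate-≼⇒≤count (≼-respʳ p (tower x∈))) (bound x)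

  ZeroSum : ℕ → List Z → Set
  ZeroSum q U = ∃ λ V → V ≼ U × 1 ≤ length V × length V ≤ q × sum V ≡ 0#

  Sums : ℕ → List Z → Z → Set
  Sums q U a = ∃ λ I → I ≼ U × length I ≤ q × sum I ≡ a

  ZeroSum-mono : ∀ {q q′ U U′} → q ≤ q′ → U ≼ U′ → ZeroSum q U → ZeroSum q′ U′
  ZeroSum-mono q≤ s (V , s′ , V≥1 , V≤ , e) = V , ≼-trans s′ s , V≥1 , ℕₚ.≤-trans V≤ q≤ , e

  Sums-mono : ∀ {q q′ U U′ a} → q ≤ q′ → U ≼ U′ → Sums q U a → Sums q′ U′ a
  Sums-mono q≤ s (I , s′ , I≤ , e) = I , ≼-trans s′ s , ℕₚ.≤-trans I≤ q≤ , e

  ManySums : ℕ → List Z → ℕ → Set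
  ManySums q U k = ∃ λ A → Unique A × k ≤ length A × (∀ {a} → a ∈ A → Sums q U a)

  private
    -- Starting from the empty sum, each layer enlarges the set of sums by its own size, and a sum
    -- takes at most one term from each layer. If instead a + b = 0 for an old sum a and a term b of
    -- the new layer, this is a zero-sum with the same bound on its length.
    scherk-layers′ : ∀ Ls → All Unique Ls → All (0# ∉_) Ls →
      ZeroSum (length Ls) (concat Ls) ⊎
      (∃ λ A → Unique A × 0# ∈ A × suc (length (concat Ls)) ≤ length A ×
         (∀ {a} → a ∈ A → Sums (length Ls) (concat Ls) a))
    scherk-layers′ [] _ _ = inj₂ ([ 0# ] , [] ∷ [] , here refl , s≤s z≤n , λ { (here refl) → [] , ≼-refl , z≤n , refl })
    scherk-layers′ (l ∷ Ls) (u ∷ us) (0∉l ∷ 0∉) with scherk-layers′ Ls us 0∉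
    ... | inj₁ zs = inj₁ (ZeroSum-mono (ℕₚ.n≤1+n _) (≼-++ʳ l (concat Ls)) zs)
    ... | inj₂ (A , uA , 0∈A , A≥ , sums) with scherk _ A l ℕₚ.≤-refl uA u 0∉l 0∈A
    ... | inj₁ (a , b , a∈ , b∈ , e) with sums a∈ | ∈⇒↭ b∈
    ... | I , s , I≤ , refl | l′ , p = inj₁ (b ∷ I , ≼-++⁺ (≼-respʳ (↭-sym p) (≼-++ˡ [ b ] l′)) s
        , s≤s z≤n , s≤s I≤ , ≡.trans (comm b (sum I)) e)
    scherk-layers′ (l ∷ Ls) (u ∷ us) (0∉l ∷ 0∉) | inj₂ (A , uA , 0∈A , A≥ , sums) | inj₂ (C , uC , C≥ , A⊆C , split) =
      inj₂ (C , uC , A⊆C _ 0∈A , size , reach)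
      where
      size : suc (length (l ++ concat Ls)) ≤ length C
      size = ℕₚ.≤-trans (eq≤ (cong suc (≡.trans (Lₚ.length-++ l) (ℕₚ.+-comm (length l) _))))
        (ℕₚ.≤-trans (ℕₚ.+-monoˡ-≤ (length l) A≥) C≥)
      reach : ∀ {c} → c ∈ C → Sums (suc (length Ls)) (l ++ concat Ls) c
      reach c∈ with split c∈
      ... | inj₁ i = Sums-mono (ℕₚ.n≤1+n _) (≼-++ʳ l (concat Ls)) (sums i)
      ... | inj₂ (a , b , a∈ , b∈ , refl) with sums a∈ | ∈⇒↭ b∈
      ... | I , s , I≤ , refl | l′ , p = b ∷ I , ≼-++⁺ (≼-respʳ (↭-sym p) (≼-++ˡ [ b ] l′)) s
          , s≤s I≤ , comm b (sum I)

  scherk-layers : ∀ Ls → All Unique Ls → All (0# ∉_) Ls →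
    ZeroSum (length Ls) (concat Ls) ⊎ ManySums (length Ls) (concat Ls) (suc (length (concat Ls)))
  scherk-layers Ls us 0∉ with scherk-layers′ Ls us 0∉
  ... | inj₁ zs                        = inj₁ zs
  ... | inj₂ (A , uA , _ , A≥ , sums) = inj₂ (A , uA , A≥ , sums)

  concat-∉ : ∀ {x : Z} Ls → x ∉ concat Ls → All (x ∉_) Ls
  concat-∉ []       x∉ = []
  concat-∉ (l ∷ Ls) x∉ = (λ i → x∉ (∈-++⁺ˡ i)) ∷ concat-∉ Ls (λ i → x∉ (∈-++⁺ʳ l i))

  -- Zero-sum subsequences of length at most f are removed from W until either the
  -- removed part T can be completed to length M by at most f zeros, or the
  -- remaining part U satisfies the alternative offered by step.
  extract : ∀ {Rest : List Z → Set} f M W → f < M →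
    (∀ U → U ≼ W → ZeroSum f U ⊎ Rest U) →
    (∃ λ X → X ≼ W × sum X ≡ 0# × length X ≤ M × M ≤ length X ℕ.+ f) ⊎
    (∃₂ λ T U → W ↭ T ++ U × sum T ≡ 0# × length T ℕ.+ f < M × Rest U)
  extract {Rest} f M W f<M step = go (length W) [] W ℕₚ.≤-refl ↭-refl refl f<M
    where
    go : ∀ k T U → length U ≤ k → W ↭ T ++ U → sum T ≡ 0# → length T ℕ.+ f < M →
      (∃ λ X → X ≼ W × sum X ≡ 0# × length X ≤ M × M ≤ length X ℕ.+ f) ⊎
      (∃₂ λ T U → W ↭ T ++ U × sum T ≡ 0# × length T ℕ.+ f < M × Rest U)
    go k T U U≤ p e T< with step U (≼-respʳ (↭-sym p) (≼-++ʳ T U))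
    ... | inj₂ r = inj₂ (T , U , p , e , T< , r)
    ... | inj₁ (V , (U′ , q) , V≥1 , V≤f , eV) = continue
      where
      p′ : W ↭ (T ++ V) ++ U′
      p′ = ↭-trans p (↭-trans (P.++⁺ˡ T q) (↭-sym (P.++-assoc T V U′)))
      e′ : sum (T ++ V) ≡ 0#
      e′ = ≡.trans (sum-++ T V) (≡.trans (cong₂ _+_ e eV) (identityˡ 0#))
      -- A piece has at most f terms and is added only while `length T` + f < M, so the length M is
      -- never overshot.
      T′≤ : length (T ++ V) ≤ M
      T′≤ = ℕₚ.≤-trans (eq≤ (Lₚ.length-++ T)) (ℕₚ.≤-trans (ℕₚ.+-monoʳ-≤ (length T) V≤f) (ℕₚ.<⇒≤ T<))
      descend : ∀ k → length U ≤ k → ∃ λ k′ → k ≡ suc k′ × length U′ ≤ k′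
      descend zero    le = ⊥-elim (ℕₚ.<-irrefl refl
        (ℕₚ.≤-trans V≥1 (ℕₚ.≤-trans (ℕₚ.m≤m+n _ (length U′)) (ℕₚ.≤-trans (eq≥ (≡.trans (P.↭-length q) (Lₚ.length-++ V))) le))))
      descend (suc k) le = k , refl , ℕₚ.≤-pred (ℕₚ.≤-trans (ℕₚ.+-monoˡ-≤ (length U′) V≥1)
        (ℕₚ.≤-trans (eq≥ (≡.trans (P.↭-length q) (Lₚ.length-++ V))) le))
      continue : _
      continue with M ℕ.≤? length (T ++ V) ℕ.+ f
      ... | yes M≤ = inj₁ (T ++ V , ≼-respʳ (↭-sym p′) (≼-++ˡ (T ++ V) U′) , e′ , T′≤ , M≤)
      ... | no  M≰ with descend k U≤
      ... | k′ , refl , U′≤ = go k′ (T ++ V) U′ U′≤ p′ e′ (ℕₚ.≰⇒> M≰)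

-- Winning configurations in residues, and zero-sums of prescribed length.

module Extraction {n : ℕ} (𝔾 : EvenGroup n) where
  open EvenGroup 𝔾
  open Solver 𝔾
  open Dec≡ _≟_
  open Scherk 𝔾

  m : ℕ
  m = 2 ℕ.* n

  1≤m : 1 ≤ m
  1≤m = unique-length {[ 0# ]} ([] ∷ [])

  flat : List (Z × Z) → List Z
  flat []            = []
  flat ((c , d) ∷ E) = c ∷ d ∷ flat E

  -- The product of α^c τ and α^d τ is α^(c - d + n), and n is the residue ν; `twist` is the
  -- exponent of a product of such pairs.
  twist : List (Z × Z) → Z
  twist []            = 0#
  twist ((c , d) ∷ E) = (c - d + ν) + twist E

  WinH : ℕ → List Z → Set
  WinH M Hs = ∃ λ X → X ≼ Hs × length X ≡ M × sum X ≡ 0#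

  -- The terms of `P` are placed before the first outside term, those of `N` between the first two,
  -- where τ inverts them. Signs exist only if some pair is present, so the list of pairs is
  -- nonempty.
  WinT : ℕ → List Z → List Z → Set
  WinT M Hs Ts = ∃₂ λ P N → ∃₂ λ e E →
    P ++ N ≼ Hs × flat (e ∷ E) ≼ Ts × length P ℕ.+ length N ℕ.+ 2 ℕ.* suc (length E) ≡ M ×
    sum P + twist (e ∷ E) ≡ sum N

  map-≼ : ∀ (g : Z → Z) {X Y} → X ≼ Y → map g X ≼ map g Y
  map-≼ g {X} (R , p) = map g R , ↭-trans (P.map⁺ g p) (↭-reflexive (Lₚ.map-++ g X R))

  sum-shift : ∀ t X → sum (map (t +_) X) ≡ length X · t + sum X
  sum-shift t []      = sym (identityˡ 0#)
  sum-shift t (x ∷ X) = ≡.trans (cong ((t + x) +_) (sum-shift t X))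
    (solve 4 (λ t x k s → (t ⊞ x) ⊞ (k ⊞ s) ≗ (t ⊞ k) ⊞ (x ⊞ s)) refl t x (length X · t) (sum X))

  count-map : ∀ {g : Z → Z} → (∀ {x y} → g x ≡ g y → x ≡ y) → ∀ x X → count (g x) (map g X) ≡ count x X
  count-map {g} inj x []      = refl
  count-map {g} inj x (y ∷ X) with g x ≟ g y | x ≟ y
  ... | yes _ | yes _ = cong suc (count-map inj x X)
  ... | yes e | no ¬e = ⊥-elim (¬e (inj e))
  ... | no ¬e | yes e = ⊥-elim (¬e (cong g e))
  ... | no _  | no _  = count-map inj x X

  ·-zero : ∀ k → k · 0# ≡ 0#
  ·-zero zero    = refl
  ·-zero (suc k) = ≡.trans (identityˡ _) (·-zero k)

  record Centred (Hs : List Z) : Set where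
    field
      t   : Z
      f   : ℕ
      W   : List Z
      eq  : Hs ↭ map (t +_) (replicate f 0# ++ W)
      0∉W : 0# ∉ W
      max : ∀ x → count x W ≤ f

  centre : ∀ Hs → 1 ≤ length Hs → Centred Hs
  centre Hs@(h ∷ Hs′) _ with argmax-count h Hs′ Hs
  ... | t , mx with gather t Hs
  ... | W₀ , p , t∉ = record
    { t = t ; f = f ; W = W ; eq = eq′
    ; 0∉W = λ i → t∉ (back i)
    ; max = λ x → ℕₚ.≤-trans (eq≥ (count-map (+-cancelˡ t) x W)) (ℕₚ.≤-trans
        (count-≼ (t + x) (≼-respʳ (↭-sym eq′) (map-≼ (t +_) (≼-++ʳ (replicate f 0#) W))))
        (bound (t + x)))
    }
    where
    f = count t Hs
    W = map (λ w → w - t) W₀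
    restore : ∀ X → map (t +_) (map (λ w → w - t) X) ≡ X
    restore X = ≡.trans (sym (Lₚ.map-∘ X)) (≡.trans
      (Lₚ.map-cong (λ w → solve 2 (λ t w → t ⊞ (w ⊞ (⊟ t)) ≗ w) refl t w) X) (Lₚ.map-id X))
    eq′ : Hs ↭ map (t +_) (replicate f 0# ++ W)
    eq′ = ↭-trans p (↭-reflexive (sym (≡.trans (Lₚ.map-++ (t +_) (replicate f 0#) W)
      (cong₂ _++_ (≡.trans (Lₚ.map-replicate (t +_) f 0#) (cong (replicate f) (identityʳ t))) (restore W₀)))))
    back : 0# ∈ W → t ∈ W₀
    back i with ∈-map⁻ (λ w → w - t) i
    ... | w , w∈ , e = subst (_∈ W₀) (≡.trans (solve 2 (λ t w → w ≗ (w ⊞ (⊟ t)) ⊞ t) refl t w)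
      (≡.trans (cong (_+ t) (sym e)) (identityˡ t))) w∈
    bound : ∀ x → count x Hs ≤ f
    bound x with x ∈? Hs
    ... | yes x∈ = mx x x∈
    ... | no x∉  = ℕₚ.≤-trans (eq≤ (count-∉ x∉)) z≤n

  module Gao (M : ℕ) (M· : ∀ x → M · x ≡ 0#) {Hs : List Z} (C : Centred Hs) where
    open Centred C

    length-eq : length Hs ≡ f ℕ.+ length W
    length-eq = ≡.trans (P.↭-length eq) (≡.trans (Lₚ.length-map (t +_) (replicate f 0# ++ W))
      (≡.trans (Lₚ.length-++ (replicate f 0#) {W}) (cong (ℕ._+ length W) (Lₚ.length-replicate f))))

    -- The gap up to M terms is filled by zeros, that is, by copies of the most frequent term.
    -- Undoing the translation of M terms by `t` adds M · t = 0.
    win-pad : ∀ {X} → X ≼ W → sum X ≡ 0# → length X ≤ M → M ≤ length X ℕ.+ f → WinH M Hs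
    win-pad {X} s e X≤M M≤ with ℕₚ.m≤n⇒∃[o]m+o≡n X≤M
    ... | o , refl = map (t +_) Y , ≼-respʳ (↭-sym eq) (map-≼ (t +_) Y≼)
        , ≡.trans (Lₚ.length-map (t +_) Y) lenY
        , ≡.trans (sum-shift t Y) (≡.trans (cong₂ _+_ (≡.trans (cong (_· t) lenY) (M· t)) sumY) (identityˡ 0#))
      where
      Y = replicate o 0# ++ X
      Y≼ : Y ≼ replicate f 0# ++ W
      Y≼ = ≼-++⁺ (replicate-≼ 0# (ℕₚ.+-cancelˡ-≤ (length X) o f M≤)) s
      lenY : length Y ≡ length X ℕ.+ o
      lenY = ≡.trans (Lₚ.length-++ (replicate o 0#)) (≡.trans (cong (ℕ._+ length X) (Lₚ.length-replicate o)) (ℕₚ.+-comm o _))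
      sumY : sum Y ≡ 0#
      sumY = ≡.trans (sum-++ (replicate o 0#) X) (≡.trans (cong₂ _+_ (≡.trans (sum-replicate o 0#) (·-zero o)) e) (identityˡ 0#))

    record Stuck (Rest : List Z → Set) : Set where
      field
        T U  : List Z
        W↭   : W ↭ T ++ U
        ΣT   : sum T ≡ 0#
        T<   : length T ℕ.+ f < M
        rest : Rest U

      total : f ℕ.+ (length T ℕ.+ length U) ≡ length Hs
      total = sym (≡.trans length-eq (cong (f ℕ.+_) (≡.trans (P.↭-length W↭) (Lₚ.length-++ T))))

    gao : ∀ {Rest} → (∀ U → U ≼ W → ZeroSum f U ⊎ Rest U) → WinH M Hs ⊎ Stuck Rest
    gao step with M ℕ.≤? f
    ... | yes M≤f = inj₁ (win-pad {[]} (W , ↭-refl) refl z≤n M≤f)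
    ... | no  M≰f with extract f M W (ℕₚ.≰⇒> M≰f) step
    ... | inj₁ (X , s , e , X≤ , ≤X)     = inj₁ (win-pad s e X≤ ≤X)
    ... | inj₂ (T , U , p , e , T< , r) = inj₂ record { T = T ; U = U ; W↭ = p ; ΣT = e ; T< = T< ; rest = r }

    layered : ∀ U → U ≼ W → ∃ λ (L : Layered U) → length (Layered.layers L) ≤ f × All (0# ∉_) (Layered.layers L)
    layered U s = layer U , layers≤ (layer U) f (λ x → ℕₚ.≤-trans (count-≼ x s) (max x))
      , concat-∉ _ (λ i → 0∉W (≼-∈ s (P.∈-resp-↭ (Layered.union (layer U)) i)))

    -- No value occurs more than f times in `W`, so f layers suffice and every sum obtained stays
    -- within the supply of zeros.
    grow : ∀ U → U ≼ W → ZeroSum f U ⊎ ManySums f U (suc (length U))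
    grow U s with layered U s
    ... | L , L≤ , 0∉ with scherk-layers (Layered.layers L) (Layered.unique L) 0∉
    ... | inj₁ zs = inj₁ (ZeroSum-mono L≤ ([] , ↭-trans (↭-sym (Layered.union L)) (↭-sym (P.++-identityʳ _))) zs)
    ... | inj₂ (A , uA , A≥ , sums) = inj₂ (A , uA
        , ℕₚ.≤-trans (eq≤ (cong suc (sym (P.↭-length (Layered.union L))))) A≥
        , λ i → Sums-mono L≤ ([] , ↭-trans (↭-sym (Layered.union L)) (↭-sym (P.++-identityʳ _))) (sums i))

  -- If the removal got stuck, at least m terms would be left in `U`, and their more than m distinct
  -- sums do not fit among m residues.
  egz : ∀ {M Hs} → (∀ x → M · x ≡ 0#) → suc (length Hs) ≡ M ℕ.+ m → 1 ≤ length Hs → WinH M Hs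
  egz {M} {Hs} M· len ne with Gao.gao M M· C (Gao.grow M M· C)
    where C = centre Hs ne
  ... | inj₁ w = w
  ... | inj₂ S = ⊥-elim (ℕₚ.<-irrefl refl (arith (Centred.f (centre Hs ne)) (length T) (length U) total len T< (ℕₚ.≤-trans (proj₁ (proj₂ (proj₂ rest))) (unique-length (proj₁ (proj₂ rest))))))
    where
    open Gao.Stuck S
    arith : ∀ f t u {h} → f ℕ.+ (t ℕ.+ u) ≡ h → suc h ≡ M ℕ.+ m → t ℕ.+ f < M → suc u ≤ m → m < m
    arith f t u refl e t< u< = comb 0 (t< ⊹ u< ⊹ eq≥ e) (lem f t u M m)
      where
      lem : ∀ f t u M m → suc m ℕ.+ (M ℕ.+ m ℕ.+ suc (f ℕ.+ (t ℕ.+ u))) ℕ.+ 0 ≡ m ℕ.+ (suc (t ℕ.+ f) ℕ.+ suc u ℕ.+ (M ℕ.+ m))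
      lem = solve-∀

-- Sequences in ℤ/m that are one term too short: the extremal ones.

module InverseTheorem {n : ℕ} (𝔾 : EvenGroup n) where
  open EvenGroup 𝔾
  open Solver 𝔾
  open Dec≡ _≟_
  open Scherk 𝔾
  open Extraction 𝔾

  Closed : List Z → Set
  Closed l = ∀ u u′ → u ∈ l → u′ ∈ l → u ≢ u′ → u + u′ ∈ l

  -- The next step is blocked only if x = y + k x. For k = 0 this says x = y; otherwise y + (k - 1)
  -- x = 0 would already lie in `l`.
  closed-walk : ∀ {l} → 0# ∉ l → Closed l → ∀ {x y} → x ∈ l → y ∈ l → x ≢ y → ∀ k → y + k · x ∈ l
  closed-walk 0∉ cl {x} {y} x∈ y∈ x≢y zero    = subst (_∈ _) (sym (identityʳ y)) y∈
  closed-walk {l} 0∉ cl {x} {y} x∈ y∈ x≢y (suc k) = subst (_∈ l)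
    (solve 3 (λ x y z → x ⊞ (y ⊞ z) ≗ y ⊞ (x ⊞ z)) refl x y (k · x))
    (cl x (y + k · x) x∈ (closed-walk 0∉ cl x∈ y∈ x≢y k) (avoid k))
    where
    avoid : ∀ k → x ≢ y + k · x
    avoid zero    e = x≢y (≡.trans e (identityʳ y))
    avoid (suc k) e = 0∉ (subst (_∈ l) (+-cancelˡ x (≡.trans
      (solve 3 (λ x y z → x ⊞ (y ⊞ z) ≗ y ⊞ (x ⊞ z)) refl x y (k · x))
      (≡.trans (sym e) (sym (identityʳ x))))) (closed-walk 0∉ cl x∈ y∈ x≢y k))

  -- If 2x ≠ 0, then y and y + 2x are distinct. From y + 2x, m - 1 steps of size y lead to 2x, and
  -- from there m - 2 steps of size x lead to 0, which is excluded.
  closed-double : ∀ {l} → 0# ∉ l → Closed l → ∀ {x y} → x ∈ l → y ∈ l → x ≢ y → x + x ≡ 0#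
  closed-double {l} 0∉ cl {x} {y} x∈ y∈ x≢y with (x + x) ≟ 0#
  ... | yes e = e
  ... | no x+x≢0 = ⊥-elim (0∉ (subst (_∈ l) back (closed-walk 0∉ cl x∈ 2x∈ x≢2x (m ℕ.∸ 2))))
    where
    z = y + 2 · x
    z∈ : z ∈ l
    z∈ = closed-walk 0∉ cl x∈ y∈ x≢y 2
    pred : ∀ j → 1 ≤ j → ∀ w → w + (j ℕ.∸ 1) · w ≡ j · w
    pred (suc j) _ w = refl
    2x∈ : x + x ∈ l
    2x∈ = subst (_∈ l)
      (≡.trans (solve 3 (λ x y k → (y ⊞ (x ⊞ (x ⊞ 𝟎))) ⊞ k ≗ (x ⊞ x) ⊞ (y ⊞ k)) refl x y ((m ℕ.∸ 1) · y))
        (≡.trans (cong ((x + x) +_) (≡.trans (pred m 1≤m y) (order· y))) (identityʳ _)))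
      (closed-walk 0∉ cl y∈ z∈ y≢z (m ℕ.∸ 1))
      where
      y≢z : y ≢ z
      y≢z e = x+x≢0 (sym (+-cancelˡ y (≡.trans (identityʳ y) (≡.trans e (cong (λ w → y + (x + w)) (identityʳ x))))))
    x≢2x : x ≢ x + x
    x≢2x e = 0∉ (subst (_∈ l) (sym (+-cancelˡ x (≡.trans (identityʳ x) e))) x∈)
    pred₂ : ∀ j → 2 ≤ j → ∀ w → (w + w) + (j ℕ.∸ 2) · w ≡ j · w
    pred₂ (suc zero) (s≤s ()) w
    pred₂ (suc (suc j)) _ w = assoc w w (j · w)
    back : (x + x) + (m ℕ.∸ 2) · x ≡ 0#
    back = ≡.trans (pred₂ m (unique-length {x ∷ y ∷ []} ((x≢y ∷ []) ∷ [] ∷ [])) x) (order· x)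

  -- Two distinct elements would both have double 0 without being 0, but ν is the only such residue.
  closed-single : ∀ {l} → Unique l → 0# ∉ l → Closed l → length l ≤ 1
  closed-single {[]}    u 0∉ cl = z≤n
  closed-single {_ ∷ []} u 0∉ cl = s≤s z≤n
  closed-single {x ∷ y ∷ l} ((x≢y ∷ _) ∷ _) 0∉ cl =
    ⊥-elim (x≢y (≡.trans (is-ν x (here refl) (closed-double 0∉ cl (here refl) (there (here refl)) x≢y))
      (sym (is-ν y (there (here refl)) (closed-double 0∉ cl (there (here refl)) (here refl) (λ e → x≢y (sym e)))))))
    where
    is-ν : ∀ w → w ∈ x ∷ y ∷ l → w + w ≡ 0# → w ≡ ν
    is-ν w w∈ e with involution w e
    ... | inj₁ refl = ⊥-elim (0∉ w∈)
    ... | inj₂ w≡ν  = w≡ν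

  closed-at? : ∀ l u u′ → Dec (u ≡ u′ ⊎ u + u′ ∈ l)
  closed-at? l u u′ with u ≟ u′ | (u + u′) ∈? l
  ... | yes e | _     = yes (inj₁ e)
  ... | no _  | yes i = yes (inj₂ i)
  ... | no ¬e | no ¬i = no λ { (inj₁ e) → ¬e e ; (inj₂ i) → ¬i i }

  -- If U is one shorter than the order and has no zero-sum subsequence of length at
  -- most f + 1, its largest layer is closed under sums of distinct elements: the
  -- sums D of the other layers avoid -u and -(u + u′), and |D| + |l| ≥ m.
  closed-or-zero-sum : ∀ {f U} l Ls → All Unique (l ∷ Ls) → All (0# ∉_) (l ∷ Ls) →
    suc (length Ls) ≤ f → concat (l ∷ Ls) ↭ U → suc (length U) ≡ m →
    ZeroSum (suc f) U ⊎ Closed l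
  closed-or-zero-sum {f} {U} l Ls (ul ∷ us) (0∉l ∷ 0∉) q≤f union len with scherk-layers Ls us 0∉
  ... | inj₁ zs = inj₁ (ZeroSum-mono (ℕₚ.≤-trans (ℕₚ.n≤1+n _) (ℕₚ.≤-trans q≤f (ℕₚ.n≤1+n f)))
      (≼-respʳ union (≼-++ʳ l (concat Ls))) zs)
  ... | inj₂ (D , uD , D≥ , sums) with meet D (map -_ l)
  ... | inj₁ (d , d∈ , d∈-l) with ∈-map⁻ -_ d∈-l
  ... | u , u∈ , refl with sums d∈ | ∈⇒↭ u∈
  ... | I , s , I≤ , e | l′ , p = inj₁ (u ∷ I
      , ≼-respʳ union (≼-++⁺ (≼-respʳ (↭-sym p) (≼-++ˡ [ u ] l′)) s) , s≤s z≤n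
      , s≤s (ℕₚ.≤-trans I≤ (ℕₚ.≤-trans (ℕₚ.n≤1+n _) q≤f)) , ≡.trans (cong (u +_) e) (inverseʳ u))
  closed-or-zero-sum {f} {U} l Ls (ul ∷ us) (0∉l ∷ 0∉) q≤f union len | inj₂ (D , uD , D≥ , sums) | inj₂ disj
    with All.all? (λ u → All.all? (closed-at? l u) l) l
  ... | yes all = inj₂ λ u u′ u∈ u′∈ u≢u′ → pick u≢u′ (All.lookup (All.lookup all u∈) u′∈)
    where
    pick : ∀ {u u′} → u ≢ u′ → u ≡ u′ ⊎ u + u′ ∈ l → u + u′ ∈ l
    pick ne (inj₁ e) = ⊥-elim (ne e)
    pick ne (inj₂ i) = i
  ... | no ¬all with find (Allₚ.¬All⇒Any¬ (λ u → All.all? (closed-at? l u) l) l ¬all)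
  ... | u , u∈ , ¬all′ with find (Allₚ.¬All⇒Any¬ (closed-at? l u) l ¬all′)
  ... | u′ , u′∈ , bad with (- (u + u′)) ∈? D
  ... | yes i with sums i | ∈⇒↭ u∈
  ... | I , s , I≤ , e | l₁ , p with P.∈-resp-↭ p u′∈
  ... | here u′≡u = ⊥-elim (bad (inj₁ (sym u′≡u)))
  ... | there u′∈l₁ with ∈⇒↭ u′∈l₁
  ... | l₂ , p′ = inj₁ (u ∷ u′ ∷ I
      , ≼-respʳ union (≼-++⁺ (≼-respʳ (↭-sym (↭-trans p (prep u p′))) (≼-++ˡ (u ∷ u′ ∷ []) l₂)) s)
      , s≤s z≤n , s≤s (ℕₚ.≤-trans (s≤s I≤) q≤f)
      , ≡.trans (cong (λ w → u + (u′ + w)) e) (solve 2 (λ u v → u ⊞ (v ⊞ (⊟ (u ⊞ v))) ≗ 𝟎) refl u u′))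
  closed-or-zero-sum {f} {U} l Ls (ul ∷ us) (0∉l ∷ 0∉) q≤f union len | inj₂ (D , uD , D≥ , sums) | inj₂ disj | no ¬all
    | u , u∈ , ¬all′ | u′ , u′∈ , bad | no ∉D =
    ⊥-elim (ℕₚ.<-irrefl refl (ℕₚ.≤-trans (s≤s big) (unique-length uX)))
    where
    neg-injective : ∀ {x y} → - x ≡ - y → x ≡ y
    neg-injective {x} {y} e = ≡.trans (solve 1 (λ x → x ≗ ⊟ (⊟ x)) refl x)
      (≡.trans (cong -_ e) (solve 1 (λ y → ⊟ (⊟ y) ≗ y) refl y))
    X = D ++ map -_ l
    ∉X : - (u + u′) ∉ X
    ∉X i with ∈-++⁻ D i
    ... | inj₁ j = ∉D j
    ... | inj₂ j with ∈-map⁻ -_ j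
    ... | v , v∈ , e = bad (inj₂ (subst (_∈ l) (sym (neg-injective e)) v∈))
    uX : Unique (- (u + u′) ∷ X)
    uX = All.tabulate (λ { i refl → ∉X i }) ∷ Uniqueₚ.++⁺ uD (Uniqueₚ.map⁺ neg-injective ul) disj
    big : m ≤ length X
    big = ℕₚ.≤-trans (eq≤ (≡.trans (sym len) (cong suc (≡.trans (sym (P.↭-length union))
        (≡.trans (Lₚ.length-++ l) (ℕₚ.+-comm (length l) _))))))
      (ℕₚ.≤-trans (ℕₚ.+-monoˡ-≤ (length l) D≥)
        (eq≥ (≡.trans (Lₚ.length-++ D) (cong (length D ℕ.+_) (Lₚ.length-map -_ l)))))

  -- The first layer contains all the others, so `U` is constant as soon as this layer is a
  -- singleton.
  constant-or-zero-sum : ∀ {f U} (L : Layered U) → length (Layered.layers L) ≤ f → All (0# ∉_) (Layered.layers L) →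
    suc (length U) ≡ m → ZeroSum (suc f) U ⊎ (∃ λ g → U ≡ replicate (length U) g)
  constant-or-zero-sum {f} {U} L q≤f 0∉ len = go (Layered.layers L) (Layered.union L) (Layered.unique L)
      (Layered.nonempty L) (Layered.chain L) 0∉ q≤f
    where
    go : ∀ Ls → concat Ls ↭ U → All Unique Ls → All (λ l → 1 ≤ length l) Ls → AllPairs (λ l l′ → l′ ⊆ l) Ls →
      All (0# ∉_) Ls → length Ls ≤ f → ZeroSum (suc f) U ⊎ (∃ λ g → U ≡ replicate (length U) g)
    go [] p _ _ _ _ _ = inj₂ (0# , All-≡-replicate (P.All-resp-↭ p []))
    go (l ∷ Ls) p us@(u ∷ _) (l≥1 ∷ _) (sub ∷ _) 0∉@(0∉l ∷ _) q≤ with closed-or-zero-sum l Ls us 0∉ q≤ p len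
    ... | inj₁ zs = inj₁ zs
    ... | inj₂ cl with l | l≥1 | closed-single u 0∉l cl
    ... | g ∷ [] | _ | _ = inj₂ (g , All-≡-replicate (P.All-resp-↭ p (All.tabulate constant)))
      where
      constant : ∀ {x} → x ∈ concat ([ g ] ∷ Ls) → x ≡ g
      constant (here e)  = e
      constant (there i) with find (∈-concat⁻ Ls i)
      ... | l′ , l′∈ , x∈ with All.lookup sub l′∈ _ x∈
      ... | here e = e
    ... | _ ∷ _ ∷ _ | _ | s≤s ()

  Generator : Z → Set
  Generator d = ∀ z → ∃ λ j → z ≡ j · d

  -- Either of the two values can turn out to be the most frequent one to which the sequence was
  -- centred; hence the two orientations of the generator.
  Extremal : ℕ → List Z → Set
  Extremal M Hs = ∃₂ λ x y → Hs ↭ replicate (M ℕ.∸ 1) x ++ replicate (m ℕ.∸ 1) y × (Generator (y - x) ⊎ Generator (x - y))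

  complete : ∀ {A : List Z} → Unique A → m ≤ length A → ∀ z → z ∈ A
  complete {A} u big z with z ∈? A
  ... | yes i = i
  ... | no z∉ = ⊥-elim (ℕₚ.<-irrefl refl (ℕₚ.≤-trans (s≤s big)
      (unique-length {z ∷ A} (All.tabulate (λ { i refl → z∉ i }) ∷ u))))

  ≼-replicate : ∀ {k x} {I : List Z} → I ≼ replicate k x → I ≡ replicate (length I) x × length I ≤ k
  ≼-replicate {k} {x} s = All-≡-replicate (All.tabulate (λ i → All.lookup {P = _≡ x} (Allₚ.replicate⁺ k refl) (≼-∈ s i)))
    , ℕₚ.≤-trans (≼-length s) (eq≤ (Lₚ.length-replicate k))

  private
    arith₁ : ∀ M m f t u h → f ℕ.+ (t ℕ.+ u) ≡ h → 2 ℕ.+ h ≡ M ℕ.+ m → t ℕ.+ f < M → m ≤ suc u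
    arith₁ M m f t u h refl e t< = comb 0 (t< ⊹ eq≥ e) (lem M m f t u)
      where
      lem : ∀ M m f t u → m ℕ.+ (M ℕ.+ (2 ℕ.+ (f ℕ.+ (t ℕ.+ u)))) ℕ.+ 0 ≡ suc u ℕ.+ (suc (t ℕ.+ f) ℕ.+ (M ℕ.+ m))
      lem = solve-∀

    arith₂ : ∀ M m f t u h → f ℕ.+ (t ℕ.+ u) ≡ h → 2 ℕ.+ h ≡ M ℕ.+ m → suc u ≡ m → suc (t ℕ.+ f) ≡ M
    arith₂ M m f t u h refl e refl = ℕₚ.+-cancelʳ-≡ (suc u) (suc (t ℕ.+ f)) M (≡.trans (lem f t u) e)
      where
      lem : ∀ f t u → suc (t ℕ.+ f) ℕ.+ suc u ≡ 2 ℕ.+ (f ℕ.+ (t ℕ.+ u))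
      lem = solve-∀

  -- Counting pins down the stuck state: `U` has m - 1 terms and every residue is one of its sums,
  -- while `T` together with the zeros has M - 1 terms. As a single term is missing, zero-sums of
  -- length f + 1 in `U` win as well; excluding them makes `U` constant.
  egz-inverse : ∀ {M Hs} → M ≡ m ⊎ M ≡ 2 ℕ.* m → (∀ x → M · x ≡ 0#) → 2 ℕ.+ length Hs ≡ M ℕ.+ m →
                1 ≤ length Hs → WinH M Hs ⊎ Extremal M Hs
  egz-inverse {M} {Hs} Mm M· len ne with Gao.gao M M· C (Gao.grow M M· C)
    where C = centre Hs ne
  ... | inj₁ w = inj₁ w
  ... | inj₂ S = result
    where
    C = centre Hs ne
    open Centred C
    open Gao M M· C
    open Stuck S
    u≥ : m ≤ suc (length U)
    u≥ = arith₁ M m f (length T) (length U) _ total len T<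
    |U| : suc (length U) ≡ m
    |U| = ℕₚ.≤-antisym (ℕₚ.≤-trans (proj₁ (proj₂ (proj₂ rest))) (unique-length (proj₁ (proj₂ rest)))) u≥
    |T| : suc (length T ℕ.+ f) ≡ M
    |T| = arith₂ M m f (length T) (length U) _ total len |U|
    U≼W : U ≼ W
    U≼W = ≼-respʳ (↭-sym W↭) (≼-++ʳ T U)

    -- `T` is one term short of winning, so any longer zero-sum with at most M terms wins.
    win : ∀ X → X ≼ W → sum X ≡ 0# → length T < length X → length X ≤ M → WinH M Hs
    win X s e T<X X≤ = win-pad s e X≤ (ℕₚ.≤-trans (eq≥ |T|) (ℕₚ.+-monoˡ-≤ f T<X))

    win-U : ZeroSum (suc f) U → WinH M Hs
    win-U (V , s , V≥1 , V≤ , e) = win (T ++ V) (≼-respʳ (↭-sym W↭) (≼-++⁺ ≼-refl s))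
      (≡.trans (sum-++ T V) (≡.trans (cong₂ _+_ ΣT e) (identityˡ 0#)))
      (ℕₚ.≤-trans (ℕₚ.≤-trans (eq≤ (ℕₚ.+-comm 1 (length T))) (ℕₚ.+-monoʳ-≤ (length T) V≥1)) (eq≥ (Lₚ.length-++ T)))
      (ℕₚ.≤-trans (eq≤ (Lₚ.length-++ T)) (ℕₚ.≤-trans (ℕₚ.+-monoʳ-≤ (length T) V≤) (eq≤ (≡.trans (ℕₚ.+-suc _ f) |T|))))

    module Constant (g : Z) (U≡ : U ≡ replicate (length U) g) where
      multiple : ∀ z → ∃ λ j → z ≡ j · g × j ≤ length U
      multiple z with proj₂ (proj₂ (proj₂ rest)) (complete (proj₁ (proj₂ rest)) (ℕₚ.≤-trans u≥ (proj₁ (proj₂ (proj₂ rest)))) z)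
      ... | I , s , _ , refl with ≼-replicate (subst (I ≼_) U≡ s)
      ... | I≡ , I≤ = length I , ≡.trans (cong sum I≡) (sum-replicate (length I) g) , I≤

      u≤f : length U ≤ f
      u≤f = ℕₚ.≤-trans (replicate-≼⇒≤count (subst (replicate (length U) g ≼_) (sym U≡) ≼-refl))
        (ℕₚ.≤-trans (count-≼ g U≼W) (max g))

      -- A term x = j g of `T` with j ≥ 2 is exchanged for j copies of g from `U`: the sum is kept
      -- and the length grows.
      T≢ : ∀ x → x ∈ T → x ≢ g → WinH M Hs
      T≢ x x∈ x≢g with multiple x | ∈⇒↭ x∈
      ... | zero , refl , _ | _ = ⊥-elim (0∉W (P.∈-resp-↭ (↭-sym W↭) (∈-++⁺ˡ x∈)))
      ... | suc zero , e , _ | _ = ⊥-elim (x≢g (≡.trans e (identityʳ g)))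
      ... | j@(suc (suc i)) , e , j≤ | T₁ , p = win (replicate j g ++ T₁)
          (≼-respʳ (↭-sym (↭-trans W↭ (P.++-comm T U))) (≼-++⁺ (subst (replicate j g ≼_) (sym U≡) (replicate-≼ g j≤))
            (≼-respʳ (↭-sym p) (≼-++ʳ [ x ] T₁))))
          (≡.trans (sum-++ (replicate j g) T₁) (≡.trans (cong (_+ sum T₁) (≡.trans (sum-replicate j g) (sym e)))
            (≡.trans (sym (sum-↭ p)) ΣT)))
          (ℕₚ.≤-trans (eq≤ (cong suc (P.↭-length p))) (ℕₚ.≤-trans (s≤s (s≤s (ℕₚ.m≤n+m (length T₁) i))) (eq≥ lenX)))
          (ℕₚ.≤-trans (eq≤ lenX) (ℕₚ.≤-trans (ℕₚ.+-monoˡ-≤ (length T₁) (ℕₚ.≤-trans j≤ u≤f))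
            (ℕₚ.≤-trans (ℕₚ.≤-trans (eq≤ (ℕₚ.+-comm f _)) (ℕₚ.≤-trans (ℕₚ.n≤1+n _) (ℕₚ.n≤1+n _)))
              (eq≤ (≡.trans (cong (λ k → suc (k ℕ.+ f)) (sym (P.↭-length p))) |T|)))))
        where
        lenX : length (replicate j g ++ T₁) ≡ j ℕ.+ length T₁
        lenX = ≡.trans (Lₚ.length-++ (replicate j g)) (cong (ℕ._+ length T₁) (Lₚ.length-replicate j))

      W-shape : T ≡ replicate (length T) g → Hs ↭ replicate f t ++ replicate (length T ℕ.+ length U) (t + g)
      W-shape T≡ = ↭-trans eq (↭-trans (P.map⁺ (t +_) (P.++⁺ˡ (replicate f 0#) W↭)) (↭-reflexive (≡.trans (Lₚ.map-++ (t +_) (replicate f 0#) (T ++ U))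
        (cong₂ _++_ (≡.trans (Lₚ.map-replicate (t +_) f 0#) (cong (replicate f) (identityʳ t)))
          (≡.trans (cong (map (t +_)) (≡.trans (cong₂ _++_ T≡ U≡) (sym (replicate-+ (length T) (length U) g))))
            (Lₚ.map-replicate (t +_) (length T ℕ.+ length U) g))))))

      gen : Generator ((t + g) - t)
      gen z with multiple z
      ... | j , e , _ = j , ≡.trans e (cong (j ·_) (solve 2 (λ t g → g ≗ (t ⊞ g) ⊞ (⊟ t)) refl t g))

      -- Here M = 2m. The m copies of g in `T` and the m - 1 copies in `U` form the block of length
      -- M - 1, and the centre is left with the shorter block f = m - 1.
      finish-m : T ≡ replicate (length T) g → length T ≡ m → M ≡ m ⊎ M ≡ 2 ℕ.* m → WinH M Hs ⊎ Extremal M Hs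
      finish-m T≡ Tm (inj₁ e) = ⊥-elim (ℕₚ.<-irrefl refl (ℕₚ.≤-trans (ℕₚ.≤-trans (s≤s (ℕₚ.m≤m+n (length T) f)) (eq≤ (≡.trans |T| e))) (eq≥ Tm)))
      finish-m T≡ Tm (inj₂ e) = inj₂ (t + g , t , ↭-trans (subst₂ (λ i k → Hs ↭ replicate i t ++ replicate k (t + g)) f≡ T+U≡ (W-shape T≡))
            (P.++-comm (replicate (m ℕ.∸ 1) t) (replicate (M ℕ.∸ 1) (t + g))) , inj₂ gen)
        where
        lem : ∀ m f → suc (m ℕ.+ f) ≡ m ℕ.+ suc f
        lem = solve-∀
        lem₂ : ∀ m → 2 ℕ.* m ≡ m ℕ.+ m
        lem₂ = solve-∀
        f≡ : f ≡ m ℕ.∸ 1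
        f≡ = cong (ℕ._∸ 1) (ℕₚ.+-cancelˡ-≡ m (suc f) m (≡.trans (sym (lem m f))
          (≡.trans (cong (λ k → suc (k ℕ.+ f)) (sym Tm)) (≡.trans |T| (≡.trans e (lem₂ m))))))
        T+U≡ : length T ℕ.+ length U ≡ M ℕ.∸ 1
        T+U≡ = cong (ℕ._∸ 1) (≡.trans (sym (ℕₚ.+-suc (length T) (length U)))
          (≡.trans (cong₂ ℕ._+_ Tm |U|) (≡.trans (sym (lem₂ m)) (sym e))))

      finish : T ≡ replicate (length T) g → WinH M Hs ⊎ Extremal M Hs
      finish T≡ with length T ℕ.≟ 0 | length T ℕ.≟ m
      ... | yes T0 | _ = inj₂ (t , t + g
          , subst (λ k → Hs ↭ replicate k t ++ replicate (m ℕ.∸ 1) (t + g)) (cong (ℕ._∸ 1) (≡.trans (cong (λ k → suc (k ℕ.+ f)) (sym T0)) |T|))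
              (subst (λ k → Hs ↭ replicate f t ++ replicate k (t + g)) (≡.trans (cong (ℕ._+ length U) T0) (cong (ℕ._∸ 1) |U|)) (W-shape T≡))
          , inj₁ gen)
      -- For 0 < |T| < m the zero-sum `T`, a power of g, has a second copy inside `U`, which can be
      -- added to it.
      ... | no T≢0 | no T≢m = inj₁ (win-U (T , subst₂ _≼_ (sym T≡) (sym U≡) (replicate-≼ g T≤U) , ℕₚ.n≢0⇒n>0 T≢0
          , ℕₚ.≤-trans T≤U (ℕₚ.≤-trans u≤f (ℕₚ.n≤1+n f)) , ΣT))
        where
        T≤m : length T ≤ m
        T≤m = arith Mm
          where
          arith : M ≡ m ⊎ M ≡ 2 ℕ.* m → length T ≤ m
          arith (inj₁ e) = ℕₚ.≤-trans (ℕₚ.m≤m+n _ f) (ℕₚ.≤-trans (ℕₚ.n≤1+n _) (eq≤ (≡.trans |T| e)))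
          arith (inj₂ e) = comb 0 (eq≤ (≡.trans |T| e) ⊹ u≤f ⊹ eq≥ |U|) (lem m f (length T) (length U))
            where
            lem : ∀ m f t u → t ℕ.+ (2 ℕ.* m ℕ.+ f ℕ.+ suc u) ℕ.+ 0 ≡ m ℕ.+ (suc (t ℕ.+ f) ℕ.+ u ℕ.+ m)
            lem = solve-∀
        T≤U : length T ≤ length U
        T≤U = ℕₚ.≤-pred (ℕₚ.≤-trans (ℕₚ.≤∧≢⇒< T≤m T≢m) (eq≥ |U|))
      ... | no T≢0 | yes Tm = finish-m T≡ Tm Mm

    result : WinH M Hs ⊎ Extremal M Hs
    result with layered U U≼W
    ... | L , L≤ , 0∉ with constant-or-zero-sum L L≤ 0∉ |U|
    ... | inj₁ zs = inj₁ (win-U zs)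
    ... | inj₂ (g , U≡) with All.all? (_≟ g) T
    ... | yes all = Constant.finish g U≡ (All-≡-replicate all)
    ... | no ¬all with find (Allₚ.¬All⇒Any¬ (_≟ g) T ¬all)
    ... | x , x∈ , x≢g = inj₁ (Constant.T≢ g U≡ x x∈ x≢g)

-- Between two and n terms outside ⟨α⟩.

module FewOutside {n : ℕ} (𝔾 : EvenGroup n) where
  open EvenGroup 𝔾
  open Solver 𝔾
  open Dec≡ _≟_
  open Scherk 𝔾
  open Extraction 𝔾
  open InverseTheorem 𝔾

  -- The lengths M = 2n (n even) and M = 4n of the product-one subsequences looked for.
  record Target : Set where
    field
      M K    : ℕ
      M≡2K   : M ≡ 2 ℕ.* K
      3≤n    : 3 ≤ n
      n≤K    : n ≤ K
      K-even : ∃ λ κ → K ≡ 2 ℕ.* κ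
      kind   : (M ≡ m × ∃ λ κ → n ≡ 2 ℕ.* κ) ⊎ (M ≡ 2 ℕ.* m)

    M· : ∀ x → M · x ≡ 0#
    M· x with kind
    ... | inj₁ (e , _) = ≡.trans (cong (_· x) e) (order· x)
    ... | inj₂ e       = ≡.trans (cong (_· x) e) (≡.trans (sym (·-assoc x 2 m)) (≡.trans (cong (2 ·_) (order· x)) (·-zero 2)))

  -- Pigeonhole: `A` and its translate v + A have more than m elements together, so they meet.
  halves : ∀ {A} → Unique A → suc n ≤ length A → ∀ v → ∃₂ λ a a′ → a ∈ A × a′ ∈ A × a ≡ v + a′
  halves {A} uA big v with meet A (map (v +_) A)
  ... | inj₁ (a , a∈ , a∈′) with ∈-map⁻ (v +_) a∈′
  ... | a′ , a′∈ , e = a , a′ , a∈ , a′∈ , e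
  halves {A} uA big v | inj₂ d = ⊥-elim (ℕₚ.<-irrefl refl (ℕₚ.≤-trans (arith big)
      (ℕₚ.≤-trans (eq≥ (≡.trans (Lₚ.length-++ A) (cong (length A ℕ.+_) (Lₚ.length-map (v +_) A))))
        (unique-length (Uniqueₚ.++⁺ uA (Uniqueₚ.map⁺ (+-cancelˡ v) uA) d)))))
    where
    arith : ∀ {n a} → suc n ≤ a → suc (2 ℕ.* n) ≤ a ℕ.+ a
    arith {n} {a} le = comb 1 (le ⊹ le) (lem n a)
      where
      lem : ∀ n a → suc (2 ℕ.* n) ℕ.+ (a ℕ.+ a) ℕ.+ 1 ≡ a ℕ.+ a ℕ.+ (suc n ℕ.+ suc n)
      lem = solve-∀

  swap-sides : ∀ {p q v} → p ≡ v + q → v ≡ p - q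
  swap-sides {p} {q} {v} refl = solve 2 (λ v q → v ≗ (v ⊞ q) ⊞ (⊟ q)) refl v q

  Difference : ℕ → List Z → Z → Set
  Difference q U v = ∃₂ λ I J → I ++ J ≼ U × length I ≤ q × length J ≤ q × sum I ≡ v + sum J

  -- The two sums with difference v may use the same terms of `U`. Cancelling the common part keeps
  -- the difference and makes both sides available at once.
  difference : ∀ {q U A} → Unique A → suc n ≤ length A → (∀ {a} → a ∈ A → Sums q U a) → ∀ v → Difference q U v
  difference {q} {U} uA big sums v with halves uA big v
  ... | a , a′ , a∈ , a′∈ , e with sums a∈ | sums a′∈
  ... | I , sI , I≤ , refl | J , sJ , J≤ , refl with cancel I J sI sJ
  ... | K , I′ , J′ , pI , pJ , s = I′ , J′ , s , shorter pI I≤ , shorter pJ J≤ , +-cancelˡ (sum K) (begin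
      sum K + sum I′       ≡⟨ sum-++ K I′ ⟨
      sum (K ++ I′)        ≡⟨ sum-↭ pI ⟨
      sum I                ≡⟨ e ⟩
      v + sum J            ≡⟨ cong (v +_) (≡.trans (sum-↭ pJ) (sum-++ K J′)) ⟩
      v + (sum K + sum J′) ≡⟨ solve 3 (λ v k j → v ⊞ (k ⊞ j) ≗ k ⊞ (v ⊞ j)) refl v (sum K) (sum J′) ⟩
      sum K + (v + sum J′) ∎)
    where
    open ≡.≡-Reasoning
    shorter : ∀ {X X′} → X ↭ K ++ X′ → length X ≤ q → length X′ ≤ q
    shorter {X} {X′} p le = ℕₚ.≤-trans (ℕₚ.m≤n+m _ (length K)) (ℕₚ.≤-trans (eq≥ (≡.trans (P.↭-length p) (Lₚ.length-++ K))) le)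

  two-torsion : ∀ x → n · x + n · x ≡ 0#
  two-torsion x = ≡.trans (sym (·-homo-+ x n n)) (≡.trans (cong (_· x) (cong (n ℕ.+_) (sym (ℕₚ.+-identityʳ n)))) (order· x))

  module Small (𝕋 : Target) where
    open Target 𝕋

    1≤n : 1 ≤ n
    1≤n = ℕₚ.≤-trans (s≤s z≤n) 3≤n

    module _ {Hs : List Z} (C : Centred Hs) where
      open Centred C
      open Gao M M· C

      -- The bound q < n leaves room for a pair outside ⟨α⟩ even when K = n. A difference built from
      -- n layers may exhaust n terms on one side; the second alternative records what then remains,
      -- v = ν = n x.
      Flexible : List Z → Set
      Flexible U = n ≤ length U → ∀ v →
        (∃ λ q → suc q ≤ n × q ≤ f × Difference q U v) ⊎ (v ≡ ν × ∃ λ x → replicate n x ≼ U × n ≤ f × n · x ≡ ν)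

      concat-replicate : ∀ k (x : Z) → concat (replicate k [ x ]) ≡ replicate k x
      concat-replicate zero    x = refl
      concat-replicate (suc k) x = cong (x ∷_) (concat-replicate k x)

      -- Unless a zero-sum appears, 0, x, ..., n x are n + 1 different sums, enough for every
      -- difference. A side that uses all n copies leaves none for the other, so v = ± n x has
      -- double 0. Then v is ν or 0, and 0 is the empty difference.
      flexible-power : ∀ U x → replicate n x ≼ U → n ≤ f → x ≢ 0# → ZeroSum f U ⊎ Flexible U
      flexible-power U x s n≤f x≢0 with scherk-layers (replicate n [ x ]) (Allₚ.replicate⁺ n ([] ∷ []))
                                          (Allₚ.replicate⁺ n (λ { (here e) → x≢0 (sym e) }))
      ... | inj₁ zs = inj₁ (ZeroSum-mono (ℕₚ.≤-trans (eq≤ (Lₚ.length-replicate n)) n≤f)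
                        (subst (_≼ U) (sym (concat-replicate n x)) s) zs)
      ... | inj₂ (A , uA , A≥ , sums) = inj₂ λ _ v → pick v (difference uA
              (ℕₚ.≤-trans (eq≤ (cong suc (sym (≡.trans (cong length (concat-replicate n x)) (Lₚ.length-replicate n))))) A≥)
              (λ i → Sums-mono (eq≤ (Lₚ.length-replicate n)) (subst (_≼ replicate n x) (sym (concat-replicate n x)) ≼-refl) (sums i)) v)
        where
        pred : ∀ {k i} → 1 ≤ k → i < k → i ≤ k ℕ.∸ 1
        pred (s≤s _) (s≤s le) = le
        1+pred : ∀ {k} → 1 ≤ k → suc (k ℕ.∸ 1) ≤ k
        1+pred (s≤s _) = ℕₚ.≤-refl
        zero-or-ν : ∀ v → v + v ≡ 0# → (v ≡ ν → n · x ≡ ν) →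
          (∃ λ q → suc q ≤ n × q ≤ f × Difference q U v) ⊎ (v ≡ ν × ∃ λ x → replicate n x ≼ U × n ≤ f × n · x ≡ ν)
        zero-or-ν v e k with involution v e
        ... | inj₁ refl = inj₁ (0 , 1≤n , z≤n , [] , [] , (U , ↭-refl) , z≤n , z≤n , sym (identityˡ 0#))
        ... | inj₂ e′   = inj₂ (e′ , x , s , n≤f , k e′)
        length≡0 : ∀ (X : List Z) → length X ≡ 0 → X ≡ []
        length≡0 [] _ = refl
        pick : ∀ v → Difference n (replicate n x) v →
          (∃ λ q → suc q ≤ n × q ≤ f × Difference q U v) ⊎ (v ≡ ν × ∃ λ x → replicate n x ≼ U × n ≤ f × n · x ≡ ν)
        pick v (I , J , sIJ , I≤ , J≤ , e) with length I ℕ.<? n | length J ℕ.<? n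
        ... | yes I< | yes J< = inj₁ (n ℕ.∸ 1 , 1+pred 1≤n , ℕₚ.≤-trans (ℕₚ.m∸n≤m n 1) n≤f
              , I , J , ≼-trans sIJ s , pred 1≤n I< , pred 1≤n J< , e)
        ... | no I≮ | _ = zero-or-ν v (≡.trans (cong₂ _+_ v≡ v≡) (two-torsion x)) (λ v≡ν → ≡.trans (sym v≡) v≡ν)
          where
          I≡ : length I ≡ n
          I≡ = ℕₚ.≤-antisym I≤ (ℕₚ.≮⇒≥ I≮)
          J≡[] : J ≡ []
          J≡[] = length≡0 J (ℕₚ.n≤0⇒n≡0 (ℕₚ.+-cancelˡ-≤ n _ _ (ℕₚ.≤-trans (eq≤ (cong (ℕ._+ length J) (sym I≡)))
            (ℕₚ.≤-trans (eq≥ (Lₚ.length-++ I)) (ℕₚ.≤-trans (proj₂ (≼-replicate sIJ)) (eq≥ (ℕₚ.+-identityʳ n)))))))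
          v≡ : v ≡ n · x
          v≡ = ≡.trans (sym (identityʳ v)) (≡.trans (sym (≡.trans e (cong (λ X → v + sum X) J≡[])))
            (≡.trans (cong sum (proj₁ (≼-replicate (≼-trans (≼-++ˡ I J) sIJ)))) (≡.trans (sum-replicate (length I) x) (cong (_· x) I≡))))
        ... | yes _ | no J≮ = zero-or-ν v (≡.trans (cong₂ _+_ v≡ v≡)
                (≡.trans (solve 1 (λ y → (⊟ y) ⊞ (⊟ y) ≗ ⊟ (y ⊞ y)) refl (n · x)) (≡.trans (cong -_ (two-torsion x)) (solve 0 (⊟ 𝟎 ≗ 𝟎) refl))))
              (λ v≡ν → ≡.trans (solve 1 (λ y → y ≗ ⊟ (⊟ y)) refl (n · x)) (≡.trans (cong -_ (≡.trans (sym v≡) v≡ν)) -ν))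
          where
          -ν : - ν ≡ ν
          -ν = +-cancelˡ ν (≡.trans (inverseʳ ν) (sym ν+ν≡0))
          J≡ : length J ≡ n
          J≡ = ℕₚ.≤-antisym J≤ (ℕₚ.≮⇒≥ J≮)
          I≡[] : I ≡ []
          I≡[] = length≡0 I (ℕₚ.n≤0⇒n≡0 (ℕₚ.+-cancelʳ-≤ n _ _ (ℕₚ.≤-trans (eq≤ (cong (length I ℕ.+_) (sym J≡)))
            (ℕₚ.≤-trans (eq≥ (Lₚ.length-++ I)) (proj₂ (≼-replicate sIJ))))))
          v≡ : v ≡ - (n · x)
          v≡ = ≡.trans (swap-sides e) (≡.trans (cong₂ (λ X s → sum X - s) I≡[]
            (≡.trans (cong sum (proj₁ (≼-replicate (≼-trans (≼-++ʳ I J) sIJ)))) (≡.trans (sum-replicate (length J) x) (cong (_· x) J≡))))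
            (identityˡ _))

      -- Fewer than n layers bound both sides of a difference by less than n. With at least n
      -- layers, a value common to all of them occurs n times in `U`.
      flexible : ∀ U → U ≼ W → ZeroSum f U ⊎ Flexible U
      flexible U s with layered U s
      ... | L , L≤ , 0∉ with length (Layered.layers L) ℕ.<? n
      ... | yes q<n = narrow (scherk-layers (Layered.layers L) (Layered.unique L) 0∉)
        where
        union≼ : concat (Layered.layers L) ≼ U
        union≼ = [] , ↭-trans (↭-sym (Layered.union L)) (↭-sym (P.++-identityʳ _))
        narrow : _ ⊎ _ → ZeroSum f U ⊎ Flexible U
        narrow (inj₁ zs) = inj₁ (ZeroSum-mono L≤ union≼ zs)
        narrow (inj₂ (A , uA , A≥ , sums)) = inj₂ λ n≤U v → inj₁ (length (Layered.layers L) , q<n , L≤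
          , difference uA (ℕₚ.≤-trans (s≤s n≤U) (ℕₚ.≤-trans (eq≤ (cong suc (sym (P.↭-length (Layered.union L))))) A≥))
              (λ i → Sums-mono ℕₚ.≤-refl union≼ (sums i)) v)
      ... | no q≮n = wide (Layered.layers L) (Layered.union L) (Layered.nonempty L) (Layered.chain L) (ℕₚ.≮⇒≥ q≮n) L≤
        where
        wide : ∀ Ls → concat Ls ↭ U → All (λ l → 1 ≤ length l) Ls → AllPairs (λ l l′ → l′ ⊆ l) Ls →
          n ≤ length Ls → length Ls ≤ f → ZeroSum f U ⊎ Flexible U
        wide [] p ne ch n≤ ≤f = ⊥-elim (ℕₚ.<-irrefl refl (ℕₚ.≤-trans 1≤n n≤))
        wide (l ∷ Ls) p ne ch n≤ ≤f with common l Ls ne ch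
        ... | x , x∈ = flexible-power U x (≼-trans (replicate-≼ x n≤) (≼-respʳ p (tower x∈))) (ℕₚ.≤-trans n≤ ≤f)
            (λ { refl → 0∉W (≼-∈ s (P.∈-resp-↭ p (∈-++⁺ˡ (All.head x∈)))) })

      -- A length 2z with z < K keeps at least one of the K pairs of positions free for two outside
      -- terms.
      Block : Z → Set
      Block v = ∃₂ λ P N → ∃ λ z → P ++ N ≼ Hs × length P ℕ.+ length N ≡ 2 ℕ.* z × suc z ≤ K × sum P ≡ v + sum N

      lift : ∀ {X} → X ≼ replicate f 0# ++ W → map (t +_) X ≼ Hs
      lift s = ≼-respʳ (↭-sym eq) (map-≼ (t +_) s)

      sum-pad : ∀ o X → sum (replicate o 0# ++ X) ≡ sum X
      sum-pad o X = ≡.trans (sum-++ (replicate o 0#) X) (≡.trans (cong (_+ sum X) (≡.trans (sum-replicate o 0#) (·-zero o))) (identityˡ _))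

      length-pad : ∀ o (X : List Z) → length (replicate o 0# ++ X) ≡ o ℕ.+ length X
      length-pad o X = ≡.trans (Lₚ.length-++ (replicate o 0#)) (cong (ℕ._+ length X) (Lₚ.length-replicate o))

      -- The shorter side of a difference is padded by zeros, which makes the block balanced.
      block-of-lists : ∀ {v} P N → P ++ N ≼ replicate f 0# ++ W → length P ≡ length N → suc (length N) ≤ K →
        sum P ≡ v + sum N → Block v
      block-of-lists {v} P N s same le e = map (t +_) P , map (t +_) N , length N
        , subst (_≼ Hs) (Lₚ.map-++ (t +_) P N) (lift s)
        , ≡.trans (cong₂ ℕ._+_ (≡.trans (Lₚ.length-map (t +_) P) same) (Lₚ.length-map (t +_) N)) (lem (length N)) , le
        , (begin
            sum (map (t +_) P)              ≡⟨ sum-shift t P ⟩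
            length P · t + sum P            ≡⟨ cong₂ _+_ (cong (_· t) same) e ⟩
            -- The sides have equal length, so the translation by `t` contributes the same to both.
            length N · t + (v + sum N)      ≡⟨ solve 3 (λ k v s → k ⊞ (v ⊞ s) ≗ v ⊞ (k ⊞ s)) refl (length N · t) v (sum N) ⟩
            v + (length N · t + sum N)      ≡⟨ cong (v +_) (sum-shift t N) ⟨
            v + sum (map (t +_) N)          ∎)
        where
        open ≡.≡-Reasoning
        lem : ∀ k → k ℕ.+ k ≡ 2 ℕ.* k
        lem = solve-∀

      block-of-difference : ∀ {q U v} → U ≼ W → suc q ≤ n → q ≤ f → Difference q U v → Block v
      block-of-difference {q} {U} {v} U≼W q<n q≤f (I , J , s , I≤ , J≤ , e) with ℕₚ.≤-total (length I) (length J)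
      ... | inj₁ I≤J with ℕₚ.m≤n⇒∃[o]m+o≡n I≤J
      ... | o , I+o≡J = block-of-lists (replicate o 0# ++ I) J
            (subst (_≼ replicate f 0# ++ W) (sym (Lₚ.++-assoc (replicate o 0#) I J))
              (≼-++⁺ (replicate-≼ 0# (ℕₚ.≤-trans (ℕₚ.m≤n+m o (length I)) (ℕₚ.≤-trans (eq≤ I+o≡J) (ℕₚ.≤-trans J≤ q≤f)))) (≼-trans s U≼W)))
            (≡.trans (length-pad o I) (≡.trans (ℕₚ.+-comm o _) I+o≡J))
            (ℕₚ.≤-trans (s≤s J≤) (ℕₚ.≤-trans q<n n≤K)) (≡.trans (sum-pad o I) e)
      block-of-difference {q} {U} {v} U≼W q<n q≤f (I , J , s , I≤ , J≤ , e) | inj₂ J≤I with ℕₚ.m≤n⇒∃[o]m+o≡n J≤I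
      ... | o , J+o≡I = block-of-lists I (replicate o 0# ++ J)
            (≼-respˡ (P.shifts (replicate o 0#) I)
              (≼-++⁺ (replicate-≼ 0# (ℕₚ.≤-trans (ℕₚ.m≤n+m o (length J)) (ℕₚ.≤-trans (eq≤ J+o≡I) (ℕₚ.≤-trans I≤ q≤f)))) (≼-trans s U≼W)))
            (sym same)
            (ℕₚ.≤-trans (s≤s (ℕₚ.≤-trans (eq≤ same) I≤)) (ℕₚ.≤-trans q<n n≤K)) (≡.trans e (cong (v +_) (sym (sum-pad o J))))
        where
        same : length (replicate o 0# ++ J) ≡ length I
        same = ≡.trans (length-pad o J) (≡.trans (ℕₚ.+-comm o _) J+o≡I)

      -- For M = 2m there is room for both powers, n copies of t + x against n copies of t. For M =
      -- m one power has to do: n t is 0 or ν, and accordingly n copies of t + x or of t have sum ν;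
      -- their number is even because n is.
      block-of-power : ∀ {U x} → U ≼ W → replicate n x ≼ U → n ≤ f → n · x ≡ ν → Block ν
      block-of-power {U} {x} U≼W s n≤f nx≡ν = go kind
        where
        pow-t : replicate n t ≼ Hs
        pow-t = subst (_≼ Hs) (≡.trans (Lₚ.map-replicate (t +_) n 0#) (cong (replicate n) (identityʳ t)))
          (lift (≼-trans (replicate-≼ 0# n≤f) (≼-++ˡ _ W)))
        pow-tx : replicate n (t + x) ≼ Hs
        pow-tx = subst (_≼ Hs) (Lₚ.map-replicate (t +_) n x) (lift (≼-trans (≼-trans s U≼W) (≼-++ʳ (replicate f 0#) W)))
        single : ∀ {κ y} → n ≡ 2 ℕ.* κ → replicate n y ≼ Hs → n · y ≡ ν → Block ν
        single {κ} {y} n≡ s′ e = replicate n y , [] , κ , subst (_≼ Hs) (sym (Lₚ.++-identityʳ _)) s′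
          , ≡.trans (ℕₚ.+-identityʳ _) (≡.trans (Lₚ.length-replicate n) n≡) , arith κ n≡ , ≡.trans (sum-replicate n y) (≡.trans e (sym (identityʳ ν)))
          where
          arith : ∀ κ → n ≡ 2 ℕ.* κ → suc κ ≤ K
          arith zero    e = ⊥-elim (ℕₚ.<-irrefl refl (ℕₚ.≤-trans 1≤n (eq≤ e)))
          arith (suc κ) e = ℕₚ.≤-trans (s≤s (s≤s (ℕₚ.m≤n+m κ κ))) (ℕₚ.≤-trans (eq≤ (≡.trans (lem κ) (sym e))) n≤K)
            where
            lem : ∀ κ → suc (suc (κ ℕ.+ κ)) ≡ 2 ℕ.* suc κ
            lem = solve-∀
        n·tx : n · (t + x) ≡ n · t + ν
        n·tx = ≡.trans (·-distrib-+ t x n) (cong (n · t +_) nx≡ν)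
        go : (M ≡ m × ∃ λ κ → n ≡ 2 ℕ.* κ) ⊎ (M ≡ 2 ℕ.* m) → Block ν
        go (inj₁ (_ , κ , n≡)) with involution (n · t) (two-torsion t)
        ... | inj₁ nt≡0 = single {κ} n≡ pow-tx (≡.trans n·tx (≡.trans (cong (_+ ν) nt≡0) (identityˡ ν)))
        ... | inj₂ nt≡ν = single {κ} n≡ pow-t nt≡ν
        go (inj₂ M≡) = replicate n (t + x) , replicate n t , n
          , subst (_≼ Hs) (≡.trans (Lₚ.map-++ (t +_) (replicate n x) (replicate n 0#)) (cong₂ _++_ (Lₚ.map-replicate (t +_) n x)
              (≡.trans (Lₚ.map-replicate (t +_) n 0#) (cong (replicate n) (identityʳ t)))))
              (lift (≼-respˡ (P.++-comm (replicate n 0#) (replicate n x)) (≼-++⁺ (replicate-≼ 0# n≤f) (≼-trans s U≼W))))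
          , ≡.trans (cong₂ ℕ._+_ (Lₚ.length-replicate n) (Lₚ.length-replicate n)) (cong (n ℕ.+_) (sym (ℕₚ.+-identityʳ n)))
          , arith
          , ≡.trans (sum-replicate n (t + x)) (≡.trans n·tx (≡.trans (comm _ ν) (cong (ν +_) (sym (sum-replicate n t)))))
          where
          arith : suc n ≤ K
          arith = ℕₚ.≤-trans (ℕₚ.+-monoˡ-≤ n 1≤n) (ℕₚ.≤-trans (eq≤ (cong (n ℕ.+_) (sym (ℕₚ.+-identityʳ n))))
            (eq≥ (ℕₚ.*-cancelˡ-≡ K (2 ℕ.* n) 2 (≡.trans (sym M≡2K) M≡))))

      -- With k outside terms a stuck removal leaves at least m - k ≥ n terms in `U`, which is what
      -- `Flexible` asks for.
      block : ∀ {k} → length Hs ℕ.+ suc k ≡ M ℕ.+ m → k ≤ n → ∀ v → WinH M Hs ⊎ Block v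
      block {k} len k≤n v with gao flexible
      ... | inj₁ w = inj₁ w
      ... | inj₂ S = inj₂ (use (Stuck.rest S n≤U v))
        where
        open Stuck S using (T; U; W↭; T<; total)
        U≼W : U ≼ W
        U≼W = ≼-respʳ (↭-sym W↭) (≼-++ʳ T U)
        n≤U : n ≤ length U
        n≤U = arith f (length T) (length U) (length Hs) total len T<
          where
          arith : ∀ f t u h → f ℕ.+ (t ℕ.+ u) ≡ h → h ℕ.+ suc k ≡ M ℕ.+ m → t ℕ.+ f < M → n ≤ u
          arith f t u h refl e t< = comb 0 (t< ⊹ eq≥ e ⊹ k≤n) (lem n M f t u k)
            where
            lem : ∀ n M f t u k → n ℕ.+ (M ℕ.+ (f ℕ.+ (t ℕ.+ u) ℕ.+ suc k) ℕ.+ n) ℕ.+ 0 ≡ u ℕ.+ (suc (t ℕ.+ f) ℕ.+ (M ℕ.+ 2 ℕ.* n) ℕ.+ k)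
            lem = solve-∀
        use : _ ⊎ _ → Block v
        use (inj₁ (q , q<n , q≤f , d))              = block-of-difference U≼W q<n q≤f d
        use (inj₂ (refl , x , s , n≤f , e)) = block-of-power U≼W s n≤f e

    -- Only 0 and ν have double 0, so three distinct residues include another one.
    doubling : ∀ {X : List Z} → Unique X → 3 ≤ length X → ∃ λ r → r ∈ X × r + r ≢ 0#
    doubling {X} u le with All.all? (λ r → (r + r) ≟ 0#) X
    ... | no ¬all = find (Allₚ.¬All⇒Any¬ (λ r → (r + r) ≟ 0#) X ¬all)
    doubling {x ∷ y ∷ z ∷ X} ((x≢y ∷ x≢z ∷ _) ∷ (y≢z ∷ _) ∷ _) le | yes (px ∷ py ∷ pz ∷ _)
      with involution x px | involution y py | involution z pz
    ... | inj₁ a | inj₁ b | _      = ⊥-elim (x≢y (≡.trans a (sym b)))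
    ... | inj₂ a | inj₂ b | _      = ⊥-elim (x≢y (≡.trans a (sym b)))
    ... | inj₁ a | inj₂ b | inj₁ c = ⊥-elim (x≢z (≡.trans a (sym c)))
    ... | inj₁ a | inj₂ b | inj₂ c = ⊥-elim (y≢z (≡.trans b (sym c)))
    ... | inj₂ a | inj₁ b | inj₁ c = ⊥-elim (y≢z (≡.trans b (sym c)))
    ... | inj₂ a | inj₁ b | inj₂ c = ⊥-elim (x≢z (≡.trans a (sym c)))
    doubling {_ ∷ _ ∷ []} u (s≤s (s≤s ())) | yes _
    doubling {_ ∷ []} u (s≤s ()) | yes _

    distinct-halves : ∀ {A} → Unique A → suc n ≤ length A → ∀ v → v ≢ 0# →
      ∃₂ λ a a′ → a ∷ a′ ∷ [] ≼ A × a ≡ v + a′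
    distinct-halves {A} u big v v≢0 with halves u big v
    ... | a , a′ , a∈ , a′∈ , e with ∈⇒↭ a∈
    ... | A₁ , p with P.∈-resp-↭ p a′∈
    ... | here refl = ⊥-elim (v≢0 (sym (+-cancelˡ a (≡.trans (identityʳ a) (≡.trans e (comm v a))))))
    ... | there i with ∈⇒↭ i
    ... | A₂ , q = a , a′ , (A₂ , ↭-trans p (prep a q)) , e

    -- Many distinct values: everything but two terms x, x′ is chosen arbitrarily.
    spread : ∀ {Hs R c d} → R ≼ Hs → Unique R → suc (suc n) ≤ length R → M ℕ.+ n ≤ suc (length Hs) →
      WinT M Hs (c ∷ d ∷ [])
    spread {Hs} {R} {c} {d} R≼ uR R≥ Hs≥ with doubling (Uniqueₚ.take⁺ (2 ℕ.+ n) uR)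
        (ℕₚ.≤-trans (ℕₚ.≤-trans 3≤n (ℕₚ.≤-trans (ℕₚ.n≤1+n n) (ℕₚ.n≤1+n _))) (eq≥ (length-take≤ (2 ℕ.+ n) R R≥)))
    ... | r , r∈ , 2r≢0 with ∈⇒↭ r∈
    ... | R₁ , p = go ((b + r) ≟ 0#)
      where
      Q = take (2 ℕ.+ n) R
      |Q| : length Q ≡ 2 ℕ.+ n
      |Q| = length-take≤ (2 ℕ.+ n) R R≥
      uR₁ : Unique R₁
      uR₁ = Unique-≼ (≼-++ʳ [ r ] R₁) (Unique-resp-↭ p (Uniqueₚ.take⁺ (2 ℕ.+ n) uR))
      |R₁| : length R₁ ≡ suc n
      |R₁| = ℕₚ.suc-injective (≡.trans (sym (P.↭-length p)) |Q|)
      Q≼ : Q ≼ Hs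
      Q≼ = ≼-trans (≼-take (2 ℕ.+ n) R) R≼
      H = proj₁ Q≼
      -- The M terms are M - 5 fillers `F`, the three terms r, x, x′ and the pair c, d.
      5≤M : 5 ≤ M
      5≤M = comb 1 (3≤n ⊹ n≤K ⊹ 3≤n ⊹ n≤K ⊹ eq≥ M≡2K) (lem n K M)
        where
        lem : ∀ n K M → 5 ℕ.+ (n ℕ.+ K ℕ.+ n ℕ.+ K ℕ.+ M) ℕ.+ 1 ≡ M ℕ.+ (3 ℕ.+ n ℕ.+ 3 ℕ.+ n ℕ.+ 2 ℕ.* K)
        lem = solve-∀
      M′ = proj₁ (ℕₚ.m≤n⇒∃[o]m+o≡n 5≤M)
      M≡ : 5 ℕ.+ M′ ≡ M
      M≡ = proj₂ (ℕₚ.m≤n⇒∃[o]m+o≡n 5≤M)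
      F = take M′ H
      |F| : length F ≡ M′
      |F| = length-take≤ M′ H (arith (length H) (≡.trans (P.↭-length (proj₂ Q≼)) (≡.trans (Lₚ.length-++ Q) (cong (ℕ._+ length H) |Q|))))
        where
        arith : ∀ h → length Hs ≡ 2 ℕ.+ n ℕ.+ h → M′ ≤ h
        arith h e = comb 2 (eq≤ M≡ ⊹ Hs≥ ⊹ eq≤ e) (lem n h M′ M (length Hs))
          where
          lem : ∀ n h M′ M l → M′ ℕ.+ (M ℕ.+ suc l ℕ.+ (2 ℕ.+ n ℕ.+ h)) ℕ.+ 2 ≡ h ℕ.+ (5 ℕ.+ M′ ℕ.+ (M ℕ.+ n) ℕ.+ l)
          lem = solve-∀
      b = sum F + twist [ c , d ]
      Hs↭ : ∀ {x x′} → x ∷ x′ ∷ [] ≼ R₁ → F ++ r ∷ x ∷ x′ ∷ [] ≼ Hs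
      Hs↭ s = ≼-respˡ (P.++-comm (r ∷ _) F) (≼-respʳ (↭-sym (proj₂ Q≼)) (≼-++⁺ (≼-respʳ (↭-sym p) (≼-∷ s)) (≼-take M′ H)))
      tally : ∀ j k → j ℕ.+ k ≡ 3 → (M′ ℕ.+ j) ℕ.+ k ℕ.+ 2 ≡ M
      tally j k e = ≡.trans (cong (ℕ._+ 2) (≡.trans (ℕₚ.+-assoc M′ j k) (cong (M′ ℕ.+_) e))) (≡.trans (lem M′) M≡)
        where
        lem : ∀ M′ → M′ ℕ.+ 3 ℕ.+ 2 ≡ 5 ℕ.+ M′
        lem = solve-∀
      |F++| : ∀ X → length (F ++ X) ≡ M′ ℕ.+ length X
      |F++| X = ≡.trans (Lₚ.length-++ F) (cong (ℕ._+ length X) |F|)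
      -- The n + 1 values in `R₁` realise every nonzero difference x - x′ by two different terms.
      -- With r counted positively, -(b + r) is needed. If this vanishes, r changes its sign; the
      -- needed difference r - b is then 2r, which is nonzero by the choice of r.
      go : Dec (b + r ≡ 0#) → WinT M Hs (c ∷ d ∷ [])
      go (no b+r≢0) with distinct-halves uR₁ (eq≥ |R₁|) (- (b + r)) (λ e → b+r≢0 (≡.trans (solve 1 (λ y → y ≗ ⊟ (⊟ y)) refl (b + r)) (≡.trans (cong -_ e) (solve 0 (⊟ 𝟎 ≗ 𝟎) refl))))
      ... | x , x′ , s , e = F ++ r ∷ x ∷ [] , [ x′ ] , (c , d) , [] , subst (_≼ Hs) (sym (Lₚ.++-assoc F (r ∷ x ∷ []) [ x′ ])) (Hs↭ s) , ≼-refl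
          , ≡.trans (cong (λ k → k ℕ.+ 1 ℕ.+ 2) (|F++| (r ∷ x ∷ []))) (tally 2 1 refl)
          , (begin
              sum (F ++ r ∷ x ∷ []) + tw             ≡⟨ cong (_+ tw) (sum-++ F (r ∷ x ∷ [])) ⟩
              sum F + (r + (x + 0#)) + tw            ≡⟨ cong (λ y → sum F + (r + (y + 0#)) + tw) e ⟩
              sum F + (r + (- (sum F + tw + r) + x′ + 0#)) + tw
                ≡⟨ solve 4 (λ f r w x → (f ⊞ (r ⊞ (((⊟ ((f ⊞ w) ⊞ r)) ⊞ x) ⊞ 𝟎))) ⊞ w ≗ x ⊞ 𝟎) refl (sum F) r tw x′ ⟩
              x′ + 0#                                ∎)
        where
        tw = twist [ c , d ]
        open ≡.≡-Reasoning
      go (yes b+r≡0) with distinct-halves uR₁ (eq≥ |R₁|) (r - b) (λ e → 2r≢0 (≡.trans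
          (solve 2 (λ r b → r ⊞ r ≗ (r ⊞ (⊟ b)) ⊞ (b ⊞ r)) refl r b) (≡.trans (cong₂ _+_ e b+r≡0) (identityˡ 0#))))
      ... | x , x′ , s , e = F ++ [ x ] , r ∷ x′ ∷ [] , (c , d) , []
          , subst (_≼ Hs) (sym (Lₚ.++-assoc F [ x ] (r ∷ x′ ∷ []))) (≼-respˡ (P.++⁺ˡ F (_↭_.swap r x _↭_.refl)) (Hs↭ s)) , ≼-refl
          , ≡.trans (cong (λ k → k ℕ.+ 2 ℕ.+ 2) (|F++| [ x ])) (tally 1 2 refl)
          , (begin
              sum (F ++ [ x ]) + tw                  ≡⟨ cong (_+ tw) (sum-++ F [ x ]) ⟩
              sum F + (x + 0#) + tw                  ≡⟨ cong (λ y → sum F + (y + 0#) + tw) e ⟩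
              sum F + (r - (sum F + tw) + x′ + 0#) + tw
                ≡⟨ solve 4 (λ f r w x → (f ⊞ (((r ⊞ (⊟ (f ⊞ w))) ⊞ x) ⊞ 𝟎)) ⊞ w ≗ r ⊞ (x ⊞ 𝟎)) refl (sum F) r tw x′ ⟩
              r + (x′ + 0#)                          ∎)
        where
        tw = twist [ c , d ]
        open ≡.≡-Reasoning

    WinT-monoʳ : ∀ {Hs Ts Ts′} → Ts ≼ Ts′ → WinT M Hs Ts → WinT M Hs Ts′
    WinT-monoʳ s (P , N , e , E , sH , sT , len , eq) = P , N , e , E , sH , ≼-trans sT s , len , eq

    -- The block compensates the twist of the single pair c, d, and pairs of equal terms on opposite
    -- sides bring the length to M. Such pairs run short only if at least n + 2 distinct values
    -- remain unpaired, and then `spread` applies.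
    small : ∀ {Hs c d Ts} → length Hs ℕ.+ length (c ∷ d ∷ Ts) ℕ.+ 1 ≡ M ℕ.+ m → length (c ∷ d ∷ Ts) ≤ n →
      WinH M Hs ⊎ WinT M Hs (c ∷ d ∷ Ts)
    small {Hs} {c} {d} {Ts} len k≤n with block (centre Hs ne) (≡.trans (lem _ _) len) k≤n (- twist [ c , d ])
      where
      lem : ∀ h k → h ℕ.+ suc k ≡ h ℕ.+ k ℕ.+ 1
      lem = solve-∀
      ne : 1 ≤ length Hs
      ne = comb (1 ℕ.+ M) (3≤n ⊹ k≤n ⊹ eq≥ len) (lem′ n (length Hs) (length (c ∷ d ∷ Ts)) M)
        where
        lem′ : ∀ n h k M → 1 ℕ.+ (n ℕ.+ n ℕ.+ (h ℕ.+ k ℕ.+ 1)) ℕ.+ (1 ℕ.+ M) ≡ h ℕ.+ (3 ℕ.+ k ℕ.+ (M ℕ.+ 2 ℕ.* n))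
        lem′ = solve-∀
    ... | inj₁ w = inj₁ w
    ... | inj₂ (P , N , z , (R₀ , p) , |PN| , z<K , e) with pairUp R₀
    ... | Y , R , q , uR = inj₂ (go (suc (suc n) ℕ.≤? length R))
      where
      Hs≥ : M ℕ.+ n ≤ suc (length Hs)
      Hs≥ = comb 0 (k≤n ⊹ eq≥ len) (lem n (length Hs) (length (c ∷ d ∷ Ts)) M)
        where
        lem : ∀ n h k M → M ℕ.+ n ℕ.+ (n ℕ.+ (h ℕ.+ k ℕ.+ 1)) ℕ.+ 0 ≡ suc h ℕ.+ (k ℕ.+ (M ℕ.+ 2 ℕ.* n))
        lem = solve-∀
      y = proj₁ (ℕₚ.m≤n⇒∃[o]m+o≡n z<K)
      z+y : suc z ℕ.+ y ≡ K
      z+y = proj₂ (ℕₚ.m≤n⇒∃[o]m+o≡n z<K)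
      go : Dec (suc (suc n) ≤ length R) → WinT M Hs (c ∷ d ∷ Ts)
      go (yes R≥) = WinT-monoʳ (≼-++ˡ (c ∷ d ∷ []) Ts) (spread (≼-respʳ (↭-sym p) (≼-trans (≼-respʳ (↭-sym q)
        (≼-trans (≼-++ʳ Y R) (≼-++ʳ Y (Y ++ R)))) (≼-++ʳ (P ++ N) R₀))) uR R≥ Hs≥)
      go (no R≱) = P ++ Y′ , N ++ Y′ , (c , d) , []
        , ≼-respˡ (psolve 3 (λ p n y → (p ⊕ n) ⊕ (y ⊕ y) ⊜ (p ⊕ y) ⊕ (n ⊕ y)) ↭-refl P N Y′)
            (≼-respʳ (↭-sym p) (≼-++⁺ {X = P ++ N} ≼-refl (≼-respʳ (↭-sym q) (≼-respʳ (P.++-assoc Y Y R)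
              (≼-trans (≼-++⁺ (≼-take y Y) (≼-take y Y)) (≼-++ˡ (Y ++ Y) R))))))
        , ≼-++ˡ (c ∷ d ∷ []) Ts
        , ≡.trans (cong (ℕ._+ 2) (cong₂ ℕ._+_ (len++ P) (len++ N))) (≡.trans (lem (length P) (length N) y)
            (≡.trans (cong (λ k → k ℕ.+ 2 ℕ.* y ℕ.+ 2) |PN|) (≡.trans (lem₂ z y) (≡.trans (cong (2 ℕ.*_) z+y) (sym M≡2K)))))
        , (begin
            sum (P ++ Y′) + tw                        ≡⟨ cong (_+ tw) (sum-++ P Y′) ⟩
            sum P + sum Y′ + tw                       ≡⟨ cong (λ s → s + sum Y′ + tw) e ⟩
            - tw + sum N + sum Y′ + tw                ≡⟨ solve 3 (λ w n y → (((⊟ w) ⊞ n) ⊞ y) ⊞ w ≗ n ⊞ y) refl tw (sum N) (sum Y′) ⟩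
            sum N + sum Y′                            ≡⟨ sum-++ N Y′ ⟨
            sum (N ++ Y′)                             ∎)
        where
        open ≡.≡-Reasoning
        tw = twist [ c , d ]
        Y′ = take y Y
        lem : ∀ a b y → a ℕ.+ y ℕ.+ (b ℕ.+ y) ℕ.+ 2 ≡ (a ℕ.+ b) ℕ.+ 2 ℕ.* y ℕ.+ 2
        lem = solve-∀
        lem₂ : ∀ z y → 2 ℕ.* z ℕ.+ 2 ℕ.* y ℕ.+ 2 ≡ 2 ℕ.* (suc z ℕ.+ y)
        lem₂ = solve-∀
        y≤Y : y ≤ length Y
        y≤Y = ℕₚ.*-cancelˡ-≤ 2 (comb 0 (Hs≥ ⊹ ℕₚ.≤-pred (ℕₚ.≰⇒> R≱) ⊹ eq≤ hs≡ ⊹ eq≥ M≡2K ⊹ eq≤ (cong (2 ℕ.*_) z+y))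
            (lem₃ y (length Y) (length R) (length Hs) n M z K))
          where
          hs≡ : length Hs ≡ 2 ℕ.* z ℕ.+ (length Y ℕ.+ (length Y ℕ.+ length R))
          hs≡ = ≡.trans (P.↭-length p) (≡.trans (Lₚ.length-++ (P ++ N)) (cong₂ ℕ._+_ (≡.trans (Lₚ.length-++ P) |PN|)
            (≡.trans (P.↭-length q) (≡.trans (Lₚ.length-++ Y) (cong (length Y ℕ.+_) (Lₚ.length-++ Y))))))
          lem₃ : ∀ y Y R h n M z K → 2 ℕ.* y ℕ.+ (suc h ℕ.+ suc n ℕ.+ (2 ℕ.* z ℕ.+ (Y ℕ.+ (Y ℕ.+ R))) ℕ.+ M ℕ.+ 2 ℕ.* K) ℕ.+ 0
            ≡ 2 ℕ.* Y ℕ.+ (M ℕ.+ n ℕ.+ R ℕ.+ h ℕ.+ 2 ℕ.* K ℕ.+ 2 ℕ.* (suc z ℕ.+ y))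
          lem₃ = solve-∀
        len++ : ∀ X → length (X ++ Y′) ≡ length X ℕ.+ y
        len++ X = ≡.trans (Lₚ.length-++ X) (cong (length X ℕ.+_) (length-take≤ y Y y≤Y))

-- More than n terms outside ⟨α⟩: pairs modulo n and their parity.

module ManyOutside {n : ℕ} (𝔾 : EvenGroup n) where
  open EvenGroup 𝔾
  open Solver 𝔾
  open Dec≡ _≟_
  open Scherk 𝔾
  open Extraction 𝔾
  open InverseTheorem 𝔾
  open FewOutside 𝔾

  nu : Bool → Z
  nu true  = ν
  nu false = 0#

  nu-xor : ∀ a b → nu (a xor b) ≡ nu a + nu b
  nu-xor false b     = sym (identityˡ _)
  nu-xor true  false = sym (identityʳ ν)
  nu-xor true  true  = sym ν+ν≡0

  nu+nu : ∀ b → nu b + nu b ≡ 0#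
  nu+nu b = ≡.trans (sym (nu-xor b b)) (cong nu (𝔹.xor-same b))

  xor-swap : ∀ a b c → a xor (b xor c) ≡ b xor (a xor c)
  xor-swap a b c = ≡.trans (sym (𝔹.xor-assoc a b c)) (≡.trans (cong (_xor c) (𝔹.xor-comm a b)) (𝔹.xor-assoc b a c))

  oddᵇ : ℕ → Bool
  oddᵇ zero    = false
  oddᵇ (suc k) = not (oddᵇ k)

  oddᵇ-double : ∀ k → oddᵇ (k ℕ.+ k) ≡ false
  oddᵇ-double zero    = refl
  oddᵇ-double (suc k) = ≡.trans (cong (λ j → not (oddᵇ j)) (ℕₚ.+-suc k k)) (≡.trans (𝔹.not-involutive _) (oddᵇ-double k))

  ≢⇒≡not : ∀ {a b} → a ≢ b → a ≡ not b
  ≢⇒≡not {false} {false} ne = ⊥-elim (ne refl)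
  ≢⇒≡not {false} {true}  ne = refl
  ≢⇒≡not {true}  {false} ne = refl
  ≢⇒≡not {true}  {true}  ne = ⊥-elim (ne refl)

  xor-cancel : ∀ {a p} q → a ≡ p → a xor q ≡ p → q ≡ false
  xor-cancel {false} q refl e = e
  xor-cancel {true}  true  refl ()
  xor-cancel {true}  false refl e = refl

  module Parity {A : Set} (bit : A → Bool) where

    parity : List A → Bool
    parity []      = false
    parity (i ∷ Q) = bit i xor parity Q

    parity-↭ : ∀ {Q Q′} → Q ↭ Q′ → parity Q ≡ parity Q′
    parity-↭ _↭_.refl   = refl
    parity-↭ (prep i p) = cong (bit i xor_) (parity-↭ p)
    parity-↭ {_ ∷ _ ∷ Q} {_ ∷ _ ∷ Q′} (swap i j p) =
      ≡.trans (cong (λ q → bit i xor (bit j xor q)) (parity-↭ p)) (xor-swap (bit i) (bit j) (parity Q′))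
    parity-↭ (trans p q) = ≡.trans (parity-↭ p) (parity-↭ q)

    parity-++ : ∀ Q Q′ → parity (Q ++ Q′) ≡ parity Q xor parity Q′
    parity-++ []      Q′ = refl
    parity-++ (i ∷ Q) Q′ = ≡.trans (cong (bit i xor_) (parity-++ Q Q′)) (sym (𝔹.xor-assoc (bit i) (parity Q) (parity Q′)))

    parity-constant : ∀ {b Q} → All (λ i → bit i ≡ b) Q → parity Q ≡ (_∧_ (oddᵇ (length Q)) b)
    parity-constant []              = refl
    parity-constant {b} {i ∷ Q} (e ∷ es) = ≡.trans (cong₂ _xor_ e (parity-constant es)) (table b (oddᵇ (length Q)))
      where
      table : ∀ b o → b xor (_∧_ o b) ≡ _∧_ (not o) b
      table false false = refl
      table false true  = refl
      table true  false = refl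
      table true  true  = refl

    -- An odd number of bits that all differ from the parity would add up to the opposite of the
    -- parity. So some bit equals it, and removing that item leaves parity 0.
    drop-odd : ∀ Q → oddᵇ (length Q) ≡ true → ∃₂ λ i Q′ → Q ↭ i ∷ Q′ × parity Q′ ≡ false
    drop-odd Q o with All.all? (λ i → bit i 𝔹.≟ not (parity Q)) Q
    ... | yes all = ⊥-elim (𝔹.not-¬ refl (≡.trans (parity-constant all) (cong (λ o → _∧_ o (not (parity Q))) o)))
    ... | no ¬all with find (Allₚ.¬All⇒Any¬ (λ i → bit i 𝔹.≟ not (parity Q)) Q ¬all)
    ... | i , i∈ , ne with ∈⇒↭ i∈
    ... | Q′ , p = i , Q′ , p , xor-cancel (parity Q′) (≡.trans (≢⇒≡not ne) (𝔹.not-involutive _)) (sym (parity-↭ p))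

    -- An even number of equal bits has parity 0, so both bits occur here, and removing two
    -- different ones leaves parity 0. Among three items two bits agree, and removing these leaves
    -- parity 1.
    drop-two : ∀ Q → 3 ≤ length Q → oddᵇ (length Q) ≡ false → parity Q ≡ true →
      ∀ β → ∃₂ λ i j → ∃ λ Q′ → Q ↭ i ∷ j ∷ Q′ × parity Q′ ≡ β
    drop-two (i ∷ j ∷ k ∷ Q) le ev odd true with bit i 𝔹.≟ bit j | bit i 𝔹.≟ bit k | bit j 𝔹.≟ bit k
    ... | yes e | _ | _ = i , j , k ∷ Q , ↭-refl , same e odd
      where
      same : ∀ {a b q} → a ≡ b → a xor (b xor q) ≡ true → q ≡ true
      same {a} {q = q} refl e = ≡.trans (sym (≡.trans (sym (𝔹.xor-assoc a a q)) (cong (_xor q) (𝔹.xor-same a)))) e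
    ... | no _ | yes e | _ = i , k , j ∷ Q , prep i (swap j k ↭-refl) , same {bit i} {bit j} {bit k} {parity Q} e odd
      where
      same : ∀ {a b c q} → a ≡ c → a xor (b xor (c xor q)) ≡ true → b xor q ≡ true
      same {a} {b} {q = q} refl e = ≡.trans (sym (≡.trans (cong (a xor_) (xor-swap b a q)) (≡.trans (sym (𝔹.xor-assoc a a (b xor q))) (cong (_xor (b xor q)) (𝔹.xor-same a))))) e
    ... | no _ | no _ | yes e = j , k , i ∷ Q , ↭-trans (swap i j ↭-refl) (prep j (swap i k ↭-refl)) , same {bit i} {bit j} {bit k} {parity Q} e odd
      where
      same : ∀ {a b c q} → b ≡ c → a xor (b xor (c xor q)) ≡ true → a xor q ≡ true
      same {a} {b} {q = q} refl e = ≡.trans (cong (a xor_) (sym (≡.trans (sym (𝔹.xor-assoc b b q)) (cong (_xor q) (𝔹.xor-same b))))) e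
    ... | no a | no b | no c = ⊥-elim (c (≡.trans (≢⇒≡not (λ e → a (sym e))) (sym (≢⇒≡not (λ e → b (sym e))))))
    drop-two (i ∷ []) (s≤s ()) ev odd true
    drop-two (i ∷ j ∷ []) (s≤s (s≤s ())) ev odd true
    drop-two (i ∷ Q) le ev odd false with All.all? (λ j → bit j 𝔹.≟ bit i) Q
    ... | yes all = ⊥-elim (contra (≡.trans (sym (parity-constant {Q = i ∷ Q} (refl ∷ all))) odd))
      where
      contra : _∧_ (oddᵇ (length (i ∷ Q))) (bit i) ≢ true
      contra e with ≡.trans (sym (cong (λ o → _∧_ o (bit i)) ev)) e
      ... | ()
    ... | no ¬all with find (Allₚ.¬All⇒Any¬ (λ j → bit j 𝔹.≟ bit i) Q ¬all)
    ... | j , j∈ , ne with ∈⇒↭ j∈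
    ... | Q′ , p = i , j , Q′ , prep i p , other (≢⇒≡not ne) (≡.trans (sym (parity-↭ (prep i p))) odd)
      where
      other : ∀ {a b q} → b ≡ not a → a xor (b xor q) ≡ true → q ≡ false
      other {false} {q = false} refl e = refl
      other {false} {q = true}  refl ()
      other {true}  {q = false} refl e = refl
      other {true}  {q = true}  refl ()

  -- Terms of S congruent mod n in pairs (y , y + nu b), both in ⟨α⟩ or both outside.
  data Item : Set where
    inside outside : Z → Bool → Item

  pairs : List (Z × Bool) → List Z
  pairs []            = []
  pairs ((y , b) ∷ Y) = y ∷ (y + nu b) ∷ pairs Y

  insides outsides : List Item → List (Z × Bool)
  insides []                = []
  insides (inside y b ∷ Q)  = (y , b) ∷ insides Q
  insides (outside y b ∷ Q) = insides Q
  outsides []                = []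
  outsides (inside y b ∷ Q)  = outsides Q
  outsides (outside y b ∷ Q) = (y , b) ∷ outsides Q

  -- The contribution of an item to a signed product, as a multiple of ν.
  bit : Item → Bool
  bit (inside y b)  = b
  bit (outside y b) = not b

  open Parity bit public

  insides-↭ : ∀ {Q Q′} → Q ↭ Q′ → insides Q ↭ insides Q′
  insides-↭ _↭_.refl = ↭-refl
  insides-↭ (prep (inside y b) p)  = prep _ (insides-↭ p)
  insides-↭ (prep (outside y b) p) = insides-↭ p
  insides-↭ (swap (inside _ _) (inside _ _) p)   = swap _ _ (insides-↭ p)
  insides-↭ (swap (inside _ _) (outside _ _) p)  = prep _ (insides-↭ p)
  insides-↭ (swap (outside _ _) (inside _ _) p)  = prep _ (insides-↭ p)
  insides-↭ (swap (outside _ _) (outside _ _) p) = insides-↭ p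
  insides-↭ (trans p q) = ↭-trans (insides-↭ p) (insides-↭ q)

  outsides-↭ : ∀ {Q Q′} → Q ↭ Q′ → outsides Q ↭ outsides Q′
  outsides-↭ _↭_.refl = ↭-refl
  outsides-↭ (prep (outside y b) p) = prep _ (outsides-↭ p)
  outsides-↭ (prep (inside y b) p)  = outsides-↭ p
  outsides-↭ (swap (outside _ _) (outside _ _) p) = swap _ _ (outsides-↭ p)
  outsides-↭ (swap (outside _ _) (inside _ _) p)  = prep _ (outsides-↭ p)
  outsides-↭ (swap (inside _ _) (outside _ _) p)  = prep _ (outsides-↭ p)
  outsides-↭ (swap (inside _ _) (inside _ _) p)   = outsides-↭ p
  outsides-↭ (trans p q) = ↭-trans (outsides-↭ p) (outsides-↭ q)

  insides-++ : ∀ Q Q′ → insides (Q ++ Q′) ≡ insides Q ++ insides Q′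
  insides-++ []                Q′ = refl
  insides-++ (inside y b ∷ Q)  Q′ = cong (_ ∷_) (insides-++ Q Q′)
  insides-++ (outside y b ∷ Q) Q′ = insides-++ Q Q′

  outsides-++ : ∀ Q Q′ → outsides (Q ++ Q′) ≡ outsides Q ++ outsides Q′
  outsides-++ []                Q′ = refl
  outsides-++ (outside y b ∷ Q) Q′ = cong (_ ∷_) (outsides-++ Q Q′)
  outsides-++ (inside y b ∷ Q)  Q′ = outsides-++ Q Q′

  pairs-↭ : ∀ {Y Y′} → Y ↭ Y′ → pairs Y ↭ pairs Y′
  pairs-↭ _↭_.refl   = ↭-refl
  pairs-↭ (prep _ p) = prep _ (prep _ (pairs-↭ p))
  pairs-↭ {(y , b) ∷ (z , c) ∷ Y} {_ ∷ _ ∷ Y′} (swap _ _ p) = ↭-trans (prep _ (prep _ (prep _ (prep _ (pairs-↭ p)))))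
    (psolve 3 (λ y z r → y ⊕ (z ⊕ r) ⊜ z ⊕ (y ⊕ r)) ↭-refl (y ∷ y + nu b ∷ []) (z ∷ z + nu c ∷ []) (pairs Y′))
  pairs-↭ (trans p q) = ↭-trans (pairs-↭ p) (pairs-↭ q)

  pairs-++ : ∀ Y Y′ → pairs (Y ++ Y′) ≡ pairs Y ++ pairs Y′
  pairs-++ []      Y′ = refl
  pairs-++ (_ ∷ Y) Y′ = cong (λ X → _ ∷ _ ∷ X) (pairs-++ Y Y′)

  pairs-≼ : ∀ {Y Y′} → Y ≼ Y′ → pairs Y ≼ pairs Y′
  pairs-≼ {Y} (R , p) = pairs R , ↭-trans (pairs-↭ p) (↭-reflexive (pairs-++ Y R))

  insides-≼ : ∀ {Q Q′} → Q ≼ Q′ → insides Q ≼ insides Q′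
  insides-≼ {Q} (R , p) = insides R , ↭-trans (insides-↭ p) (↭-reflexive (insides-++ Q R))

  outsides-≼ : ∀ {Q Q′} → Q ≼ Q′ → outsides Q ≼ outsides Q′
  outsides-≼ {Q} (R , p) = outsides R , ↭-trans (outsides-↭ p) (↭-reflexive (outsides-++ Q R))

  length-insides-outsides : ∀ Q → length (insides Q) ℕ.+ length (outsides Q) ≡ length Q
  length-insides-outsides []                = refl
  length-insides-outsides (inside y b ∷ Q)  = cong suc (length-insides-outsides Q)
  length-insides-outsides (outside y b ∷ Q) = ≡.trans (ℕₚ.+-suc _ _) (cong suc (length-insides-outsides Q))

  firsts seconds : List (Z × Bool) → List Z
  firsts  = map proj₁
  seconds = map (λ (y , b) → y + nu b)

  both : List (Z × Bool) → List (Z × Z)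
  both = map (λ (y , b) → y , y + nu b)

  pairs-split : ∀ Y → pairs Y ↭ firsts Y ++ seconds Y
  pairs-split []            = ↭-refl
  pairs-split ((y , b) ∷ Y) = prep y (↭-trans (prep (y + nu b) (pairs-split Y)) (↭-sym (P.shift (y + nu b) (firsts Y) (seconds Y))))

  flat-both : ∀ Y → flat (both Y) ≡ pairs Y
  flat-both []      = refl
  flat-both (_ ∷ Y) = cong (λ X → _ ∷ _ ∷ X) (flat-both Y)

  flat-++ : ∀ E E′ → flat (E ++ E′) ≡ flat E ++ flat E′
  flat-++ []      E′ = refl
  flat-++ (_ ∷ E) E′ = cong (λ X → _ ∷ _ ∷ X) (flat-++ E E′)

  twist-++ : ∀ E E′ → twist (E ++ E′) ≡ twist E + twist E′
  twist-++ []      E′ = sym (identityˡ _)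
  twist-++ (e ∷ E) E′ = ≡.trans (cong (_ +_) (twist-++ E E′)) (sym (assoc _ (twist E) (twist E′)))

  -- A pair inside is counted with opposite signs, so only its multiple of ν survives; a pair
  -- outside contributes one more ν through `twist`.
  value : ∀ Q → sum (firsts (insides Q)) + twist (both (outsides Q)) ≡ sum (seconds (insides Q)) + nu (parity Q)
  value [] = refl
  value (inside y b ∷ Q) = begin
    (y + p) + q                        ≡⟨ assoc y p q ⟩
    y + (p + q)                        ≡⟨ cong (y +_) (value Q) ⟩
    y + (s + r)                        ≡⟨ solve 3 (λ y s r → y ⊞ (s ⊞ r) ≗ y ⊞ 𝟎 ⊞ s ⊞ r) refl y s r ⟩
    y + 0# + s + r                     ≡⟨ cong (λ z → y + z + s + r) (nu+nu b) ⟨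
    y + (nu b + nu b) + s + r          ≡⟨ solve 4 (λ y b s r → y ⊞ (b ⊞ b) ⊞ s ⊞ r ≗ ((y ⊞ b) ⊞ s) ⊞ (b ⊞ r)) refl y (nu b) s r ⟩
    ((y + nu b) + s) + (nu b + r)      ≡⟨ cong (((y + nu b) + s) +_) (nu-xor b (parity Q)) ⟨
    ((y + nu b) + s) + nu (b xor parity Q) ∎
    where
    open ≡.≡-Reasoning
    p = sum (firsts (insides Q))
    q = twist (both (outsides Q))
    s = sum (seconds (insides Q))
    r = nu (parity Q)
  value (outside y b ∷ Q) = begin
    p + ((y - (y + nu b) + ν) + q)     ≡⟨ solve 5 (λ p y b v q → p ⊞ (((y ⊞ (⊟ (y ⊞ b))) ⊞ v) ⊞ q) ≗ ((p ⊞ q) ⊞ ((⊟ b) ⊞ v))) refl p y (nu b) ν q ⟩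
    (p + q) + (- nu b + ν)             ≡⟨ cong₂ _+_ (value Q) (flip b) ⟩
    (s + r) + nu (not b)               ≡⟨ solve 3 (λ s r b → (s ⊞ r) ⊞ b ≗ s ⊞ (b ⊞ r)) refl s r (nu (not b)) ⟩
    s + (nu (not b) + r)               ≡⟨ cong (s +_) (nu-xor (not b) (parity Q)) ⟨
    s + nu (not b xor parity Q)        ∎
    where
    open ≡.≡-Reasoning
    p = sum (firsts (insides Q))
    q = twist (both (outsides Q))
    s = sum (seconds (insides Q))
    r = nu (parity Q)
    flip : ∀ b → - nu b + ν ≡ nu (not b)
    flip true  = inverseˡ ν
    flip false = ≡.trans (cong (_+ ν) (solve 0 (⊟ 𝟎 ≗ 𝟎) refl)) (identityˡ ν)

  -- Of each pair inside, the first term joins `P` and the second joins `N`; the pairs outside join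
  -- `E`. The lower bound on the number of outside pairs is what makes the signs available.
  win-items : ∀ {M Hs Ts} P N E Q → P ++ N ++ pairs (insides Q) ≼ Hs → flat E ++ pairs (outsides Q) ≼ Ts →
    1 ≤ length E ℕ.+ length (outsides Q) →
    length P ℕ.+ length N ℕ.+ 2 ℕ.* length E ℕ.+ 2 ℕ.* length Q ≡ M →
    sum P + twist E ≡ sum N + nu (parity Q) → WinT M Hs Ts
  win-items {M} {Hs} {Ts} P N E Q sH sT E≥1 len e = go (E ++ both (outsides Q)) refl
    where
    open ≡.≡-Reasoning
    i o : ℕ
    i = length (insides Q)
    o = length (outsides Q)
    P′ = P ++ firsts (insides Q)
    N′ = N ++ seconds (insides Q)
    |E| : length (E ++ both (outsides Q)) ≡ length E ℕ.+ o
    |E| = ≡.trans (Lₚ.length-++ E) (cong (length E ℕ.+_) (Lₚ.length-map _ (outsides Q)))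
    go : ∀ E′ → E′ ≡ E ++ both (outsides Q) → WinT M Hs Ts
    go [] eq = ⊥-elim (ℕₚ.<-irrefl refl (ℕₚ.≤-trans E≥1 (eq≤ (≡.trans (sym |E|) (cong length (sym eq))))))
    go (e₀ ∷ E′) eq = P′ , N′ , e₀ , E′
      , ≼-respˡ (↭-trans (P.++⁺ˡ P (P.++⁺ˡ N (pairs-split (insides Q))))
          (psolve 4 (λ p n f s → p ⊕ (n ⊕ (f ⊕ s)) ⊜ (p ⊕ f) ⊕ (n ⊕ s)) ↭-refl P N (firsts (insides Q)) (seconds (insides Q)))) sH
      , subst (_≼ Ts) (sym (≡.trans (cong flat eq) (≡.trans (flat-++ E _) (cong (flat E ++_) (flat-both (outsides Q)))))) sT
      , (begin
          length P′ ℕ.+ length N′ ℕ.+ 2 ℕ.* length (e₀ ∷ E′)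
            ≡⟨ cong₂ ℕ._+_ (cong₂ ℕ._+_ (≡.trans (Lₚ.length-++ P) (cong (length P ℕ.+_) (Lₚ.length-map _ (insides Q))))
                 (≡.trans (Lₚ.length-++ N) (cong (length N ℕ.+_) (Lₚ.length-map _ (insides Q)))))
               (cong (2 ℕ.*_) (≡.trans (cong length eq) |E|)) ⟩
          (length P ℕ.+ i) ℕ.+ (length N ℕ.+ i) ℕ.+ 2 ℕ.* (length E ℕ.+ o)
            ≡⟨ lem (length P) (length N) (length E) i o ⟩
          length P ℕ.+ length N ℕ.+ 2 ℕ.* length E ℕ.+ 2 ℕ.* (i ℕ.+ o)
            ≡⟨ cong (λ q → length P ℕ.+ length N ℕ.+ 2 ℕ.* length E ℕ.+ 2 ℕ.* q) (length-insides-outsides Q) ⟩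
          length P ℕ.+ length N ℕ.+ 2 ℕ.* length E ℕ.+ 2 ℕ.* length Q ≡⟨ len ⟩
          M ∎)
      , (begin
          sum P′ + twist (e₀ ∷ E′)       ≡⟨ cong₂ _+_ (sum-++ P _) (≡.trans (cong twist eq) (twist-++ E _)) ⟩
          (sum P + f) + (twist E + t)    ≡⟨ medial (sum P) f (twist E) t ⟩
          (sum P + twist E) + (f + t)    ≡⟨ cong₂ _+_ e (value Q) ⟩
          (sum N + r) + (s + r)          ≡⟨ solve 3 (λ n r s → (n ⊞ r) ⊞ (s ⊞ r) ≗ (n ⊞ s) ⊞ (r ⊞ r)) refl (sum N) r s ⟩
          (sum N + s) + (r + r)          ≡⟨ cong₂ _+_ (sym (sum-++ N _)) (nu+nu (parity Q)) ⟩
          sum N′ + 0#                    ≡⟨ identityʳ _ ⟩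
          sum N′                         ∎)
      where
      f = sum (firsts (insides Q))
      t = twist (both (outsides Q))
      s = sum (seconds (insides Q))
      r = nu (parity Q)
      lem : ∀ p n e i o → (p ℕ.+ i) ℕ.+ (n ℕ.+ i) ℕ.+ 2 ℕ.* (e ℕ.+ o) ≡ p ℕ.+ n ℕ.+ 2 ℕ.* e ℕ.+ 2 ℕ.* (i ℕ.+ o)
      lem = solve-∀

  -- Distinctness modulo n: adding n is adding ν, so `R` and ν + R have to be disjoint sets.
  Incongruent : List Z → Set
  Incongruent R = Unique (R ++ map (ν +_) R)

  incongruent-≼ : ∀ {R R′} → R ≼ R′ → Incongruent R′ → Incongruent R
  incongruent-≼ s u = Unique-≼ (≼-++⁺ s (map-≼ (ν +_) s)) u

  incongruent-length : ∀ {R} → Incongruent R → length R ≤ n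
  incongruent-length {R} u = ℕₚ.*-cancelˡ-≤ 2 (ℕₚ.≤-trans (eq≤ (≡.trans (cong (length R ℕ.+_) (ℕₚ.+-identityʳ _))
    (sym (≡.trans (Lₚ.length-++ R) (cong (length R ℕ.+_) (Lₚ.length-map (ν +_) R)))))) (unique-length u))

  ν-involutive : ∀ x → ν + (ν + x) ≡ x
  ν-involutive x = ≡.trans (sym (assoc ν ν x)) (≡.trans (cong (_+ x) ν+ν≡0) (identityˡ x))

  pair-mod : ∀ X → ∃₂ λ Y R → X ↭ pairs Y ++ R × Incongruent R
  pair-mod []      = [] , [] , ↭-refl , []
  pair-mod (x ∷ X) with pair-mod X
  ... | Y , R , p , u with x ∈? R | (x + ν) ∈? R
  ... | yes x∈ | _ with ∈⇒↭ x∈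
  ... | R′ , q = (x , false) ∷ Y , R′
      , prep x (↭-trans (↭-trans p (P.++⁺ˡ (pairs Y) (↭-trans q (↭-reflexive (cong (_∷ R′) (sym (identityʳ x))))))) (P.shift (x + 0#) (pairs Y) R′))
      , incongruent-≼ (≼-respʳ (↭-sym q) (≼-++ʳ [ x ] R′)) u
  pair-mod (x ∷ X) | Y , R , p , u | no _ | yes xν∈ with ∈⇒↭ xν∈
  ... | R′ , q = (x , true) ∷ Y , R′
      , prep x (↭-trans (↭-trans p (P.++⁺ˡ (pairs Y) q)) (P.shift (x + ν) (pairs Y) R′))
      , incongruent-≼ (≼-respʳ (↭-sym q) (≼-++ʳ [ x + ν ] R′)) u
  pair-mod (x ∷ X) | Y , R , p , u | no x∉ | no xν∉ = Y , x ∷ R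
      , ↭-trans (prep x p) (↭-sym (P.shift x (pairs Y) R))
      , Unique-resp-↭ (prep x (↭-sym (P.shift (ν + x) R (map (ν +_) R))))
          (All.tabulate (λ { (here e) refl → ν≢0 (+-cancelˡ x (≡.trans (comm x ν) (≡.trans (sym e) (sym (identityʳ x)))))
                           ; (there i) refl → x∉′ i })
           ∷ All.tabulate (λ { i refl → νx∉ i }) ∷ u)
    where
    x∉′ : x ∉ R ++ map (ν +_) R
    x∉′ i with ∈-++⁻ R i
    ... | inj₁ j = x∉ j
    ... | inj₂ j with ∈-map⁻ (ν +_) j
    ... | r , r∈ , e = xν∉ (subst (_∈ R) (≡.trans (sym (ν-involutive r)) (≡.trans (cong (ν +_) (sym e)) (comm ν x))) r∈)
    νx∉ : ν + x ∉ R ++ map (ν +_) R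
    νx∉ i with ∈-++⁻ R i
    ... | inj₁ j = xν∉ (subst (_∈ R) (comm ν x) j)
    ... | inj₂ j with ∈-map⁻ (ν +_) j
    ... | r , r∈ , e = x∉ (subst (_∈ R) (+-cancelˡ ν (sym e)) r∈)

  -- `R` and ν + R have at least 2(n - 1) elements, more than half of the 2n residues since n ≥ 3,
  -- so their union meets its translate by x₁ - x₂. The case c = c′ would make x₁ and x₂ congruent
  -- modulo n.
  collision : ∀ {R x₁ x₂} → 3 ≤ n → Incongruent R → n ≤ suc (length R) → x₁ ≢ x₂ → x₁ ≢ ν + x₂ →
    ∃₂ λ c c′ → ∃ λ b → c ∷ c′ ∷ [] ≼ R × c - c′ ≡ (x₁ - x₂) + nu b
  collision {R} {x₁} {x₂} 3≤n u big ne neν with meet (R ++ map (ν +_) R) (map ((x₁ - x₂) +_) (R ++ map (ν +_) R))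
  ... | inj₂ disj = ⊥-elim (ℕₚ.<-irrefl refl (ℕₚ.≤-trans (arith (length R) big) (ℕₚ.≤-trans (eq≥ len)
      (unique-length (Uniqueₚ.++⁺ u (Uniqueₚ.map⁺ (+-cancelˡ (x₁ - x₂)) u) disj)))))
    where
    len₁ : length (R ++ map (ν +_) R) ≡ length R ℕ.+ length R
    len₁ = ≡.trans (Lₚ.length-++ R) (cong (length R ℕ.+_) (Lₚ.length-map (ν +_) R))
    len : length ((R ++ map (ν +_) R) ++ map ((x₁ - x₂) +_) (R ++ map (ν +_) R)) ≡ (length R ℕ.+ length R) ℕ.+ (length R ℕ.+ length R)
    len = ≡.trans (Lₚ.length-++ (R ++ map (ν +_) R)) (cong₂ ℕ._+_ len₁ (≡.trans (Lₚ.length-map _ (R ++ map (ν +_) R)) len₁))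
    arith : ∀ r → n ≤ suc r → suc m ≤ (r ℕ.+ r) ℕ.+ (r ℕ.+ r)
    arith r le = comb 1 (le ⊹ le ⊹ le ⊹ le ⊹ 3≤n ⊹ 3≤n) (lem n r)
      where
      lem : ∀ n r → suc (2 ℕ.* n) ℕ.+ (suc r ℕ.+ suc r ℕ.+ suc r ℕ.+ suc r ℕ.+ n ℕ.+ n) ℕ.+ 1 ≡ (r ℕ.+ r) ℕ.+ (r ℕ.+ r) ℕ.+ (n ℕ.+ n ℕ.+ n ℕ.+ n ℕ.+ 3 ℕ.+ 3)
      lem = solve-∀
  ... | inj₁ (ρ , ρ∈ , ρ∈′) with ∈-map⁻ ((x₁ - x₂) +_) ρ∈′
  ... | ρ′ , ρ′∈ , e with origin ρ∈ | origin ρ′∈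
    where
    origin : ∀ {ρ} → ρ ∈ R ++ map (ν +_) R → ∃₂ λ c b → c ∈ R × ρ ≡ nu b + c
    origin {ρ} i with ∈-++⁻ R i
    ... | inj₁ j = ρ , false , j , sym (identityˡ ρ)
    ... | inj₂ j with ∈-map⁻ (ν +_) j
    ... | c , c∈ , e = c , true , c∈ , e
  ... | c , b , c∈ , refl | c′ , b′ , c′∈ , refl with ∈⇒↭ c∈
  ... | R₁ , p with P.∈-resp-↭ p c′∈
  ... | there i with ∈⇒↭ i
  ... | R₂ , q = c , c′ , b xor b′ , (R₂ , ↭-trans p (prep c q)) , (begin
      c - c′                                        ≡⟨ solve 3 (λ b c d → c ⊞ (⊟ d) ≗ ((b ⊞ c) ⊞ (⊟ d)) ⊞ (⊟ b)) refl (nu b) c c′ ⟩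
      nu b + c - c′ - nu b                          ≡⟨ cong (λ z → z - c′ - nu b) e ⟩
      (x₁ - x₂) + (nu b′ + c′) - c′ - nu b          ≡⟨ solve 4 (λ x b c d → (((x ⊞ (b ⊞ c)) ⊞ (⊟ c)) ⊞ (⊟ d)) ≗ x ⊞ ((⊟ d) ⊞ b)) refl (x₁ - x₂) (nu b′) c′ (nu b) ⟩
      (x₁ - x₂) + (- nu b + nu b′)                  ≡⟨ cong (λ z → (x₁ - x₂) + (z + nu b′)) (neg-nu b) ⟩
      (x₁ - x₂) + (nu b + nu b′)                    ≡⟨ cong ((x₁ - x₂) +_) (nu-xor b b′) ⟨
      (x₁ - x₂) + nu (b xor b′)                     ∎)
    where
    open ≡.≡-Reasoning
    neg-nu : ∀ b → - nu b ≡ nu b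
    neg-nu b = +-cancelˡ (nu b) (≡.trans (inverseʳ (nu b)) (sym (nu+nu b)))
  collision {R} {x₁} {x₂} 3≤n u big ne neν | inj₁ (ρ , ρ∈ , ρ∈′) | ρ′ , ρ′∈ , e
    | c , b , c∈ , refl | c′ , b′ , c′∈ , refl | R₁ , p | here refl = ⊥-elim (contra (b xor b′) (begin
      x₁                                             ≡⟨ solve 4 (λ x y b c → x ≗ ((x ⊞ (⊟ y)) ⊞ (b ⊞ c)) ⊞ (y ⊞ (⊟ (b ⊞ c)))) refl x₁ x₂ (nu b′) c ⟩
      ((x₁ - x₂) + (nu b′ + c)) + (x₂ - (nu b′ + c)) ≡⟨ cong (_+ (x₂ - (nu b′ + c))) e ⟨
      (nu b + c) + (x₂ - (nu b′ + c))                ≡⟨ solve 4 (λ x b d c → (b ⊞ c) ⊞ (x ⊞ (⊟ (d ⊞ c))) ≗ (b ⊞ (⊟ d)) ⊞ x) refl x₂ (nu b) (nu b′) c ⟩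
      (nu b - nu b′) + x₂                            ≡⟨ cong (λ z → (nu b + z) + x₂) (+-cancelˡ (nu b′) (≡.trans (inverseʳ (nu b′)) (sym (nu+nu b′)))) ⟩
      (nu b + nu b′) + x₂                            ≡⟨ cong (_+ x₂) (nu-xor b b′) ⟨
      nu (b xor b′) + x₂                             ∎))
    where
    open ≡.≡-Reasoning
    contra : ∀ β → x₁ ≢ nu β + x₂
    contra false e = ne (≡.trans e (identityˡ x₂))
    contra true  e = neν e

  -- x₁ - x₂ = ± (c - c′) mod n, together with further items of the right parity.
  win-collision : ∀ {M Hs Ts x₁ x₂ c c′ b} Q → c - c′ ≡ (x₁ - x₂) + nu b →
    x₂ ∷ x₁ ∷ pairs (insides Q) ≼ Hs → c ∷ c′ ∷ pairs (outsides Q) ≼ Ts →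
    4 ℕ.+ 2 ℕ.* length Q ≡ M → parity Q ≡ not b → WinT M Hs Ts
  win-collision {x₁ = x₁} {x₂} {c} {c′} {b} Q e sH sT len pq = win-items [ x₂ ] [ x₁ ] [ c , c′ ] Q sH sT (s≤s z≤n) len (begin
      (x₂ + 0#) + ((c - c′ + ν) + 0#)             ≡⟨ cong (λ z → (x₂ + 0#) + ((z + ν) + 0#)) e ⟩
      (x₂ + 0#) + (((x₁ - x₂) + nu b + ν) + 0#)   ≡⟨ solve 4 (λ x y b v → (y ⊞ 𝟎) ⊞ ((((x ⊞ (⊟ y)) ⊞ b) ⊞ v) ⊞ 𝟎) ≗ (x ⊞ 𝟎) ⊞ (v ⊞ b)) refl x₁ x₂ (nu b) ν ⟩
      (x₁ + 0#) + (ν + nu b)                      ≡⟨ cong ((x₁ + 0#) +_) (≡.trans (sym (nu-xor true b)) (cong nu (sym pq))) ⟩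
      (x₁ + 0#) + nu (parity Q)                   ∎)
    where open ≡.≡-Reasoning

  tags : (Z → Bool → Item) → List (Z × Bool) → List Item
  tags k = map (λ (y , b) → k y b)

  insides-tags : ∀ Y → insides (tags inside Y) ≡ Y
  insides-tags []      = refl
  insides-tags (_ ∷ Y) = cong (_ ∷_) (insides-tags Y)

  outsides-tags : ∀ Y → outsides (tags outside Y) ≡ Y
  outsides-tags []      = refl
  outsides-tags (_ ∷ Y) = cong (_ ∷_) (outsides-tags Y)

  insides-tags′ : ∀ Y → insides (tags outside Y) ≡ []
  insides-tags′ []      = refl
  insides-tags′ (_ ∷ Y) = insides-tags′ Y

  outsides-tags′ : ∀ Y → outsides (tags inside Y) ≡ []
  outsides-tags′ []      = refl
  outsides-tags′ (_ ∷ Y) = outsides-tags′ Y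

  length-pairs : ∀ Y → length (pairs Y) ≡ 2 ℕ.* length Y
  length-pairs []      = refl
  length-pairs (_ ∷ Y) = ≡.trans (cong (λ k → suc (suc k)) (length-pairs Y)) (double-suc (length Y))

  even-· : ∀ κ b → (2 ℕ.* κ) · nu b ≡ 0#
  even-· κ b = ≡.trans (cong (_· nu b) (ℕₚ.*-comm 2 κ)) (≡.trans (sym (·-assoc (nu b) κ 2)) (≡.trans (cong (κ ·_)
    (≡.trans (cong (nu b +_) (identityʳ _)) (nu+nu b))) (·-zero κ)))

  congruent? : ∀ y → (y′ : Z × Bool) → Dec (proj₁ y′ ≡ y ⊎ proj₁ y′ ≡ ν + y)
  congruent? y (y′ , _) with y′ ≟ y | y′ ≟ (ν + y)
  ... | yes e | _     = yes (inj₁ e)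
  ... | no _  | yes e = yes (inj₂ e)
  ... | no a  | no b  = no λ { (inj₁ e) → a e ; (inj₂ e) → b e }

  module Big (𝕋 : Target) {Hs Ts : List Z} {Y₀ R₀ Y₁ R₁}
    (pH : Hs ↭ pairs Y₀ ++ R₀) (uH : Incongruent R₀) (pT : Ts ↭ pairs Y₁ ++ R₁) (uT : Incongruent R₁) where
    open Target 𝕋

    κ : ℕ
    κ = proj₁ K-even
    oddᵇ-K : oddᵇ K ≡ false
    oddᵇ-K = ≡.trans (cong oddᵇ (≡.trans (proj₂ K-even) (cong (κ ℕ.+_) (ℕₚ.+-identityʳ κ)))) (oddᵇ-double κ)

    3≤K : 3 ≤ K
    3≤K = ℕₚ.≤-trans 3≤n n≤K

    -- The outside items stand in front, so that taking an initial segment keeps an outside pair.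
    Q : List Item
    Q = tags outside Y₁ ++ tags inside Y₀

    insidesQ : insides Q ≡ Y₀
    insidesQ = ≡.trans (insides-++ (tags outside Y₁) _) (cong₂ _++_ (insides-tags′ Y₁) (insides-tags Y₀))

    outsidesQ : outsides Q ≡ Y₁
    outsidesQ = ≡.trans (outsides-++ (tags outside Y₁) _) (≡.trans (cong₂ _++_ (outsides-tags Y₁) (outsides-tags′ Y₀)) (Lₚ.++-identityʳ Y₁))

    lengthQ : length Q ≡ length Y₁ ℕ.+ length Y₀
    lengthQ = ≡.trans (Lₚ.length-++ (tags outside Y₁)) (cong₂ ℕ._+_ (Lₚ.length-map _ Y₁) (Lₚ.length-map _ Y₀))

    H≼ : ∀ {Q′} → Q′ ≼ Q → pairs (insides Q′) ++ R₀ ≼ Hs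
    H≼ {Q′} s = ≼-respʳ (↭-sym pH) (≼-++⁺ (pairs-≼ (subst (insides Q′ ≼_) insidesQ (insides-≼ s))) ≼-refl)

    T≼ : ∀ {Q′} → Q′ ≼ Q → pairs (outsides Q′) ++ R₁ ≼ Ts
    T≼ {Q′} s = ≼-respʳ (↭-sym pT) (≼-++⁺ (pairs-≼ (subst (outsides Q′ ≼_) outsidesQ (outsides-≼ s))) ≼-refl)

    win-even : ∀ Q′ → Q′ ≼ Q → length Q′ ≡ K → 1 ≤ length (outsides Q′) → parity Q′ ≡ false → WinT M Hs Ts
    win-even Q′ s len o≥1 pq = win-items [] [] [] Q′ (≼-trans (≼-++ˡ _ R₀) (H≼ s)) (≼-trans (≼-++ˡ _ R₁) (T≼ s)) o≥1
      (≡.trans (cong (2 ℕ.*_) len) (sym M≡2K)) (cong (λ b → 0# + nu b) (sym pq))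

    two-outside : 2 ≤ length Y₁ → suc K ≤ length Q → WinT M Hs Ts
    two-outside Y₁≥2 Q≥ = go Y₁ refl Y₁≥2
      where
      go : ∀ Y → Y₁ ≡ Y → 2 ≤ length Y → WinT M Hs Ts
      go (_ ∷ []) eq (s≤s ())
      go (y ∷ y′ ∷ Y) eq _ = finish (drop-odd Q′ (≡.trans (cong oddᵇ |Q′|) (cong not oddᵇ-K)))
        where
        Q₂ = tags outside Y ++ tags inside Y₀
        Q≡ : Q ≡ outside (proj₁ y) (proj₂ y) ∷ outside (proj₁ y′) (proj₂ y′) ∷ Q₂
        Q≡ = cong (λ Y → tags outside Y ++ tags inside Y₀) eq
        Q′ = take (suc K) Q
        |Q′| : length Q′ ≡ suc K
        |Q′| = length-take≤ (suc K) Q Q≥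
        two : ∀ k → 1 ≤ k → 2 ≤ length (outsides (take (suc k) Q))
        two (suc k) _ = subst (λ Q → 2 ≤ length (outsides (take (suc (suc k)) Q))) (sym Q≡) (s≤s (s≤s z≤n))
        finish : (∃₂ λ i Q″ → Q′ ↭ i ∷ Q″ × parity Q″ ≡ false) → WinT M Hs Ts
        finish (i , Q″ , p , e) = win-even Q″ (≼-trans (≼-respʳ (↭-sym p) (≼-++ʳ [ i ] Q″)) (≼-take (suc K) Q))
          (ℕₚ.suc-injective (≡.trans (sym (P.↭-length p)) |Q′|)) (rest i p) e
          where
          rest : ∀ i → Q′ ↭ i ∷ Q″ → 1 ≤ length (outsides Q″)
          rest (inside _ _)  p = ℕₚ.≤-trans (s≤s z≤n) (ℕₚ.≤-trans (two K (ℕₚ.≤-trans (s≤s z≤n) 3≤K)) (eq≤ (P.↭-length (outsides-↭ p))))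
          rest (outside _ _) p = ℕₚ.≤-pred (ℕₚ.≤-trans (two K (ℕₚ.≤-trans (s≤s z≤n) 3≤K)) (eq≤ (P.↭-length (outsides-↭ p))))

    -- If the first K items have parity 1, two of them make way for x₁, x₂ from `R₀` and c, c′ from
    -- `R₁`. The free choice of parity in `drop-two` absorbs the ν by which the two differences may
    -- disagree.
    leftovers : 1 ≤ length Y₁ → K ≤ length Q → 2 ≤ length R₀ → n ≤ suc (length R₁) → WinT M Hs Ts
    leftovers Y₁≥1 Q≥ R₀≥2 R₁≥ = go (parity Q′) refl R₀ refl R₀≥2
      where
      Q′ = take K Q
      |Q′| : length Q′ ≡ K
      |Q′| = length-take≤ K Q Q≥
      one : ∀ k Y → 1 ≤ k → 1 ≤ length Y → 1 ≤ length (outsides (take k (tags outside Y ++ tags inside Y₀)))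
      one (suc k) (y ∷ Y) _ _ = s≤s z≤n
      go : ∀ π → parity Q′ ≡ π → ∀ R → R₀ ≡ R → 2 ≤ length R → WinT M Hs Ts
      go false e _ _ _ = win-even Q′ (≼-take K Q) |Q′| (one K Y₁ (ℕₚ.≤-trans (s≤s z≤n) 3≤K) Y₁≥1) e
      go true e (_ ∷ []) eq (s≤s ())
      go true e (x₁ ∷ x₂ ∷ R) eq _ = collide (collision 3≤n uT R₁≥ x₁≢x₂ x₁≢νx₂)
        where
        uR : Incongruent (x₁ ∷ x₂ ∷ R)
        uR = subst Incongruent eq uH
        x₁∉ : x₁ ∉ x₂ ∷ R ++ map (ν +_) (x₁ ∷ x₂ ∷ R)
        x₁∉ = Uniqueₚ.Unique[x∷xs]⇒x∉xs uR
        x₁≢x₂ : x₁ ≢ x₂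
        x₁≢x₂ e = x₁∉ (here e)
        x₁≢νx₂ : x₁ ≢ ν + x₂
        x₁≢νx₂ e = x₁∉ (there (∈-++⁺ʳ R (there (here e))))
        collide : (∃₂ λ c c′ → ∃ λ b → c ∷ c′ ∷ [] ≼ R₁ × c - c′ ≡ (x₁ - x₂) + nu b) → WinT M Hs Ts
        collide (c , c′ , b , s , e′) = finish (drop-two Q′ (ℕₚ.≤-trans 3≤K (eq≥ |Q′|)) (≡.trans (cong oddᵇ |Q′|) oddᵇ-K) e (not b))
          where
          finish : (∃₂ λ i j → ∃ λ Q″ → Q′ ↭ i ∷ j ∷ Q″ × parity Q″ ≡ not b) → WinT M Hs Ts
          finish (i , j , Q″ , p , pq) = win-collision Q″ e′
            (≼-respˡ (P.++-comm (pairs (insides Q″)) (x₂ ∷ x₁ ∷ [])) (≼-trans (≼-++⁺ ≼-refl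
              (≼-respˡ (swap x₁ x₂ ↭-refl) (subst (x₁ ∷ x₂ ∷ [] ≼_) (sym eq) (≼-++ˡ (x₁ ∷ x₂ ∷ []) R)))) (H≼ Q″≼)))
            (≼-respˡ (P.++-comm (pairs (outsides Q″)) (c ∷ c′ ∷ [])) (≼-trans (≼-++⁺ ≼-refl s) (T≼ Q″≼)))
            (≡.trans (lem (length Q″)) (≡.trans (cong (2 ℕ.*_) (≡.trans (sym (P.↭-length p)) |Q′|)) (sym M≡2K))) pq
            where
            Q″≼ : Q″ ≼ Q
            Q″≼ = ≼-trans (≼-respʳ (↭-sym p) (≼-++ʳ (i ∷ j ∷ []) Q″)) (≼-take K Q)
            lem : ∀ q → 4 ℕ.+ 2 ℕ.* q ≡ 2 ℕ.* suc (suc q)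
            lem = solve-∀

    same-residue : ∀ y b Y → All (λ (y′ , b′) → (y′ ≡ y ⊎ y′ ≡ ν + y) × b′ ≡ b) Y →
      sum (pairs Y) ≡ (2 ℕ.* length Y) · y + length Y · nu b
    same-residue y b [] [] = sym (identityˡ 0#)
    same-residue y b ((y′ , b′) ∷ Y) ((r , refl) ∷ rs) = begin
      y′ + ((y′ + nu b) + sum (pairs Y))
        ≡⟨ solve 3 (λ y b s → y ⊞ ((y ⊞ b) ⊞ s) ≗ (y ⊞ y) ⊞ b ⊞ s) refl y′ (nu b) (sum (pairs Y)) ⟩
      (y′ + y′) + nu b + sum (pairs Y)
        ≡⟨ cong₂ (λ d s → d + nu b + s) (double r) (same-residue y b Y rs) ⟩
      (y + y) + nu b + ((2 ℕ.* length Y) · y + length Y · nu b)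
        ≡⟨ solve 4 (λ y b p q → (y ⊞ y) ⊞ b ⊞ (p ⊞ q) ≗ (y ⊞ (y ⊞ p)) ⊞ (b ⊞ q)) refl y (nu b) ((2 ℕ.* length Y) · y) (length Y · nu b) ⟩
      suc (suc (2 ℕ.* length Y)) · y + suc (length Y) · nu b
        ≡⟨ cong (λ k → k · y + suc (length Y) · nu b) (double-suc (length Y)) ⟩
      (2 ℕ.* suc (length Y)) · y + suc (length Y) · nu b ∎
      where
      open ≡.≡-Reasoning
      double : y′ ≡ y ⊎ y′ ≡ ν + y → y′ + y′ ≡ y + y
      double (inj₁ refl) = refl
      double (inj₂ refl) = ≡.trans (solve 2 (λ v y → (v ⊞ y) ⊞ (v ⊞ y) ≗ (v ⊞ v) ⊞ (y ⊞ y)) refl ν y)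
        (≡.trans (cong (_+ (y + y)) ν+ν≡0) (identityˡ _))

    -- K inside pairs and the outside pair are one item too many, and an inside pair with bit π may
    -- be dropped. If there is none, all inside bits are `not π`, and the residues modulo n decide.
    one-outside : ∀ {y₁} → Y₁ ≡ [ y₁ ] → K ≤ length Y₀ → n ≤ suc (length R₁) → WinH M Hs ⊎ WinT M Hs Ts
    one-outside {t , bt} Y₁≡ Y₀≥ R₁≥ = search
      where
      Y = take K Y₀
      |Y| : length Y ≡ K
      |Y| = length-take≤ K Y₀ Y₀≥
      |tagsY| : length (tags inside Y) ≡ K
      |tagsY| = ≡.trans (Lₚ.length-map _ Y) |Y|
      Q≡ : Q ≡ outside t bt ∷ tags inside Y₀
      Q≡ = cong (λ Y → tags outside Y ++ tags inside Y₀) Y₁≡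
      tags≼ : ∀ {Y′} → Y′ ≼ Y → tags inside Y′ ≼ tags inside Y₀
      tags≼ {Y′} s with ≼-trans s (≼-take K Y₀)
      ... | R , p = tags inside R , ↭-trans (P.map⁺ _ p) (↭-reflexive (Lₚ.map-++ _ Y′ R))
      Q′ = outside t bt ∷ tags inside Y
      π = parity Q′
      item : Z × Bool → Item
      item (y , b) = inside y b
      search : WinH M Hs ⊎ WinT M Hs Ts
      search with All.all? (λ y → proj₂ y 𝔹.≟ not π) Y
      search | no ¬all with find (Allₚ.¬All⇒Any¬ (λ y → proj₂ y 𝔹.≟ not π) Y ¬all)
      ... | (y , b) , y∈ , ne with ∈⇒↭ y∈
      ... | Y′ , p = inj₂ (win-even (outside t bt ∷ tags inside Y′) Q″≼
          (≡.trans (sym (≡.trans (P.↭-length (P.map⁺ item p)) refl)) |tagsY|) (s≤s z≤n)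
          (xor-cancel (not bt xor parity (tags inside Y′)) (≡.trans (≢⇒≡not ne) (𝔹.not-involutive π))
            (≡.trans (xor-swap b (not bt) (parity (tags inside Y′))) (cong (not bt xor_) (sym (parity-↭ (P.map⁺ item p)))))))
        where
        Q″≼ : outside t bt ∷ tags inside Y′ ≼ Q
        Q″≼ = subst (outside t bt ∷ tags inside Y′ ≼_) (sym Q≡) (≼-∷ (tags≼ (≼-respʳ (↭-sym p) (≼-++ʳ [ y , b ] Y′))))
      search | yes all = by-residue Y refl all
        where
        constant : ∀ {Y′} → Y′ ≼ Y → parity (tags inside Y′) ≡ _∧_ (oddᵇ (length Y′)) (not π)
        constant {Y′} s = ≡.trans (parity-constant (Allₚ.map⁺ (All.tabulate (λ i → All.lookup all (≼-∈ s i)))))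
          (cong (λ k → _∧_ (oddᵇ k) (not π)) (Lₚ.length-map _ Y′))
        -- the single outside item has the parity π, opposite to all the others
        bt≡π : not bt ≡ π
        bt≡π = sym (≡.trans (cong (not bt xor_) (≡.trans (constant ≼-refl) (cong (λ o → _∧_ o (not π)) (≡.trans (cong oddᵇ |Y|) oddᵇ-K))))
          (𝔹.xor-identityʳ (not bt)))
        by-residue : ∀ Y′ → Y ≡ Y′ → All (λ y → proj₂ y ≡ not π) Y′ → WinH M Hs ⊎ WinT M Hs Ts
        by-residue [] eq _ = ⊥-elim (ℕₚ.<-irrefl refl (ℕₚ.≤-trans (s≤s z≤n) (ℕₚ.≤-trans 3≤K (eq≤ (≡.trans (sym |Y|) (cong length eq))))))
        by-residue ((y , b) ∷ Y′) eq (b≡ ∷ bs) with All.all? (congruent? y) Y′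
        -- All these terms are congruent to y modulo n. Their plain sum is M y plus an even multiple
        -- of ν or 0, so no outside term is needed.
        ... | yes same = inj₁ (pairs Y , ≼-respʳ (↭-sym pH) (≼-trans (pairs-≼ (≼-take K Y₀)) (≼-++ˡ _ R₀))
            , ≡.trans (length-pairs Y) (≡.trans (cong (2 ℕ.*_) |Y|) (sym M≡2K))
            , (begin
                sum (pairs Y)                                        ≡⟨ same-residue y (not π) Y (subst (All _) (sym eq) ((inj₁ refl , b≡) ∷ All.zip (same , bs))) ⟩
                (2 ℕ.* length Y) · y + length Y · nu (not π)         ≡⟨ cong₂ (λ k l → k · y + l · nu (not π)) (≡.trans (cong (2 ℕ.*_) |Y|) (sym M≡2K)) (≡.trans |Y| (proj₂ K-even)) ⟩
                M · y + (2 ℕ.* κ) · nu (not π)                       ≡⟨ cong₂ _+_ (M· y) (even-· κ (not π)) ⟩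
                0# + 0#                                              ≡⟨ identityˡ 0# ⟩
                0#                                                   ∎))
          where open ≡.≡-Reasoning
        ... | no ¬same with find (Allₚ.¬All⇒Any¬ (congruent? y) Y′ ¬same)
        ... | (y′ , b′) , y′∈ , ne with ∈⇒↭ y′∈
        ... | Y″ , p = inj₂ (collide (collision 3≤n uT R₁≥ (λ e → ne (inj₁ e)) (λ e → ne (inj₂ e))))
          where
          Y↭ : Y ↭ (y , b) ∷ (y′ , b′) ∷ Y″
          Y↭ = ↭-trans (↭-reflexive eq) (prep (y , b) p)
          |Y″| : suc (suc (length Y″)) ≡ K
          |Y″| = ≡.trans (sym (P.↭-length Y↭)) |Y|
          odd″ : oddᵇ (length Y″) ≡ false
          odd″ = ≡.trans (sym (𝔹.not-involutive _)) (≡.trans (cong oddᵇ |Y″|) oddᵇ-K)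
          H : y ∷ y′ ∷ pairs Y″ ≼ Hs
          H = ≼-respʳ (↭-sym pH) (≼-trans (≼-trans (≼-respʳ (pairs-↭ (↭-sym Y↭)) ((y + nu b ∷ y′ + nu b′ ∷ [])
              , psolve 5 (λ a b c d r → a ⊕ (b ⊕ (c ⊕ (d ⊕ r))) ⊜ (a ⊕ (c ⊕ r)) ⊕ (b ⊕ d)) ↭-refl [ y ] [ y + nu b ] [ y′ ] [ y′ + nu b′ ] (pairs Y″)))
              (pairs-≼ (≼-take K Y₀))) (≼-++ˡ (pairs Y₀) R₀))
          collide : (∃₂ λ c c′ → ∃ λ β → c ∷ c′ ∷ [] ≼ R₁ × c - c′ ≡ (y′ - y) + nu β) → WinT M Hs Ts
          -- Parity 0 is required: the remaining K - 2 inside pairs have equal bits and are even in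
          -- number.
          collide (c , c′ , true , s , e) = win-collision (tags inside Y″) e
            (subst (λ Y → y ∷ y′ ∷ pairs Y ≼ Hs) (sym (insides-tags Y″)) H)
            (subst (λ Y → c ∷ c′ ∷ pairs Y ≼ Ts) (sym (outsides-tags′ Y″)) (≼-trans s (≼-respʳ (↭-sym pT) (≼-++ʳ (pairs Y₁) R₁))))
            (≡.trans (cong (λ q → 4 ℕ.+ 2 ℕ.* q) (Lₚ.length-map _ Y″)) (≡.trans (lem (length Y″)) (≡.trans (cong (2 ℕ.*_) |Y″|) (sym M≡2K))))
            (≡.trans (constant (≼-respʳ (↭-sym Y↭) (≼-++ʳ ((y , b) ∷ (y′ , b′) ∷ []) Y″))) (cong (λ o → _∧_ o (not π)) odd″))
            where
            lem : ∀ q → 4 ℕ.+ 2 ℕ.* q ≡ 2 ℕ.* suc (suc q)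
            lem = solve-∀
          -- Parity 1 is required: the outside pair has bit π, and K - 3 inside pairs, an odd
          -- number, add `not π`.
          collide (c , c′ , false , s , e) = last Y″ refl
            where
            last : ∀ Y₃ → Y″ ≡ Y₃ → WinT M Hs Ts
            last [] eq′ = ⊥-elim (ℕₚ.<-irrefl refl (ℕₚ.≤-trans 3≤K (eq≤ (≡.trans (sym |Y″|) (cong (λ Y → suc (suc (length Y))) eq′)))))
            last (z ∷ Y₃) eq′ = win-collision (outside t bt ∷ tags inside Y₃) e
              (subst (λ Y → y ∷ y′ ∷ pairs Y ≼ Hs) (sym (insides-tags Y₃)) (≼-trans (≼-∷ (≼-∷ (pairs-≼ (subst (Y₃ ≼_) (sym eq′) (≼-++ʳ [ z ] Y₃))))) H))
              (subst (λ Y → c ∷ c′ ∷ t ∷ t + nu bt ∷ pairs Y ≼ Ts) (sym (outsides-tags′ Y₃))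
                (≼-respʳ (↭-sym (↭-trans pT (↭-trans (P.++⁺ʳ R₁ (↭-reflexive (cong pairs Y₁≡))) (P.++-comm (t ∷ t + nu bt ∷ []) R₁)))) (≼-++⁺ s ≼-refl)))
              (≡.trans (cong (λ q → 4 ℕ.+ 2 ℕ.* suc q) (Lₚ.length-map _ Y₃)) (≡.trans (lem (length Y₃))
                (≡.trans (cong (2 ℕ.*_) (≡.trans (cong (λ Y → suc (suc (length Y))) (sym eq′)) |Y″|)) (sym M≡2K))))
              (≡.trans (cong₂ _xor_ bt≡π (≡.trans (constant (≼-respʳ (↭-sym Y↭) (≼-trans (subst (Y₃ ≼_) (sym eq′) (≼-++ʳ [ z ] Y₃)) (≼-++ʳ ((y , b) ∷ (y′ , b′) ∷ []) Y″))))
                  (cong (λ o → _∧_ o (not π)) odd₃))) (table π))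
              where
              lem : ∀ q → 4 ℕ.+ 2 ℕ.* suc q ≡ 2 ℕ.* suc (suc (suc q))
              lem = solve-∀
              odd₃ : oddᵇ (length Y₃) ≡ true
              odd₃ = ≡.trans (sym (𝔹.not-involutive _)) (cong not (≡.trans (sym (cong (λ Y → oddᵇ (length Y)) eq′)) odd″))
              table : ∀ π → π xor (_∧_ true (not π)) ≡ true
              table false = refl
              table true  = refl

-- The cases by the number of outside terms put together.

module Structure {n : ℕ} (𝔾 : EvenGroup n) where
  open EvenGroup 𝔾
  open Solver 𝔾
  open Dec≡ _≟_
  open Scherk 𝔾
  open Extraction 𝔾
  open InverseTheorem 𝔾
  open FewOutside 𝔾
  open ManyOutside 𝔾

  singleton : ∀ {A : Set} (X : List A) → length X ≡ 1 → ∃ λ x → X ≡ [ x ]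
  singleton (x ∷ []) _ = x , refl

  module Core (𝕋 : Target) where
    open Target 𝕋

    -- The leftovers `R₀` and `R₁` have at most n terms each, so there are at least K pairs, and if
    -- there are exactly K, both leftovers have at least n - 1 terms. As there are more than n
    -- outside terms, some pair lies outside; if only one does, again `R₁` has at least n - 1 terms.
    big : ∀ {Hs Ts} → length Hs ℕ.+ length Ts ℕ.+ 1 ≡ M ℕ.+ m → n < length Ts → WinH M Hs ⊎ WinT M Hs Ts
    big {Hs} {Ts} len k> with pair-mod Hs | pair-mod Ts
    ... | Y₀ , R₀ , pH , uH | Y₁ , R₁ , pT , uT = cases (length Y₁) refl (suc K ℕ.≤? length Q)
      where
      open Big 𝕋 {Y₀ = Y₀} {R₀} {Y₁} {R₁} pH uH pT uT
      y₀ = length Y₀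
      r₀ = length R₀
      r₁ = length R₁
      r₀≤ : r₀ ≤ n
      r₀≤ = incongruent-length {R₀} uH
      r₁≤ : r₁ ≤ n
      r₁≤ = incongruent-length {R₁} uT
      |Hs| : length Hs ≡ 2 ℕ.* y₀ ℕ.+ r₀
      |Hs| = ≡.trans (P.↭-length pH) (≡.trans (Lₚ.length-++ (pairs Y₀)) (cong (ℕ._+ r₀) (length-pairs Y₀)))
      |Ts| : length Ts ≡ 2 ℕ.* length Y₁ ℕ.+ r₁
      |Ts| = ≡.trans (P.↭-length pT) (≡.trans (Lₚ.length-++ (pairs Y₁)) (cong (ℕ._+ r₁) (length-pairs Y₁)))
      total : 2 ℕ.* length Q ℕ.+ (r₀ ℕ.+ r₁ ℕ.+ 1) ≡ 2 ℕ.* K ℕ.+ 2 ℕ.* n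
      total = ≡.trans (≡.trans (cong (λ q → 2 ℕ.* q ℕ.+ (r₀ ℕ.+ r₁ ℕ.+ 1)) lengthQ) (lem (length Y₁) y₀ r₀ r₁))
        (≡.trans (cong₂ (λ h k → h ℕ.+ k ℕ.+ 1) (sym |Hs|) (sym |Ts|)) (≡.trans len (cong (ℕ._+ m) M≡2K)))
        where
        lem : ∀ y₁ y₀ r₀ r₁ → 2 ℕ.* (y₁ ℕ.+ y₀) ℕ.+ (r₀ ℕ.+ r₁ ℕ.+ 1) ≡ (2 ℕ.* y₀ ℕ.+ r₀) ℕ.+ (2 ℕ.* y₁ ℕ.+ r₁) ℕ.+ 1
        lem = solve-∀
      K≤Q : K ≤ length Q
      K≤Q = halve (comb 0 (r₀≤ ⊹ r₁≤ ⊹ eq≥ total) (lem (length Q) r₀ r₁ K n))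
        where
        lem : ∀ q r₀ r₁ K n → 2 ℕ.* K ℕ.+ (n ℕ.+ n ℕ.+ (2 ℕ.* q ℕ.+ (r₀ ℕ.+ r₁ ℕ.+ 1))) ℕ.+ 0 ≡ suc (2 ℕ.* q) ℕ.+ (r₀ ℕ.+ r₁ ℕ.+ (2 ℕ.* K ℕ.+ 2 ℕ.* n))
        lem = solve-∀
      cases : ∀ y₁ → length Y₁ ≡ y₁ → Dec (suc K ≤ length Q) → WinH M Hs ⊎ WinT M Hs Ts
      cases zero e _ = ⊥-elim (ℕₚ.<-irrefl refl (ℕₚ.≤-trans k> (ℕₚ.≤-trans (eq≤ (≡.trans |Ts| (cong (λ y → 2 ℕ.* y ℕ.+ r₁) e))) r₁≤)))
      cases (suc (suc _)) e (yes Q>) = inj₂ (two-outside (ℕₚ.≤-trans (s≤s (s≤s z≤n)) (eq≥ e)) Q>)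
      cases (suc zero) e (yes Q>) = one-outside (proj₂ (singleton Y₁ e))
        (ℕₚ.≤-pred (ℕₚ.≤-trans Q> (eq≤ (≡.trans lengthQ (cong (ℕ._+ y₀) e)))))
        (ℕₚ.≤-pred (ℕₚ.≤-trans k> (eq≤ (≡.trans |Ts| (cong (λ y → 2 ℕ.* y ℕ.+ r₁) e)))))
      cases (suc y₁) e (no Q≯) = inj₂ (leftovers (ℕₚ.≤-trans (s≤s z≤n) (eq≥ e)) K≤Q
          (ℕₚ.≤-pred (ℕₚ.≤-trans 3≤n (comb 0 (r₁≤ ⊹ Q≤ ⊹ Q≤ ⊹ eq≥ total) (lem (length Q) r₀ r₁ K n))))
          (comb 0 (r₀≤ ⊹ Q≤ ⊹ Q≤ ⊹ eq≥ total) (lem′ (length Q) r₀ r₁ K n)))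
        where
        Q≤ : length Q ≤ K
        Q≤ = ℕₚ.≤-pred (ℕₚ.≰⇒> Q≯)
        lem : ∀ q r₀ r₁ K n → n ℕ.+ (n ℕ.+ K ℕ.+ K ℕ.+ (2 ℕ.* q ℕ.+ (r₀ ℕ.+ r₁ ℕ.+ 1))) ℕ.+ 0 ≡ suc r₀ ℕ.+ (r₁ ℕ.+ q ℕ.+ q ℕ.+ (2 ℕ.* K ℕ.+ 2 ℕ.* n))
        lem = solve-∀
        lem′ : ∀ q r₀ r₁ K n → n ℕ.+ (n ℕ.+ K ℕ.+ K ℕ.+ (2 ℕ.* q ℕ.+ (r₀ ℕ.+ r₁ ℕ.+ 1))) ℕ.+ 0 ≡ suc r₁ ℕ.+ (r₀ ℕ.+ q ℕ.+ q ℕ.+ (2 ℕ.* K ℕ.+ 2 ℕ.* n))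
        lem′ = solve-∀

    3≤M : 3 ≤ M
    3≤M = ℕₚ.≤-trans 3≤n (ℕₚ.≤-trans n≤K (ℕₚ.≤-trans (ℕₚ.m≤m+n K _) (eq≥ M≡2K)))

    kind′ : M ≡ m ⊎ M ≡ 2 ℕ.* m
    kind′ with kind
    ... | inj₁ (e , _) = inj₁ e
    ... | inj₂ e       = inj₂ e

    nonempty : ∀ {h} k → k ≤ 2 → k ℕ.+ h ≡ M ℕ.+ m → 1 ≤ h
    nonempty {h} k k≤2 e = comb m (k≤2 ⊹ eq≥ e ⊹ 3≤M) (lem k h M m)
      where
      lem : ∀ k h M m → 1 ℕ.+ (2 ℕ.+ (k ℕ.+ h) ℕ.+ M) ℕ.+ m ≡ h ℕ.+ (k ℕ.+ (M ℕ.+ m) ℕ.+ 3)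
      lem = solve-∀

    -- A single outside term finds no partner, so only the terms in ⟨α⟩ are searched, and they are
    -- one short of the length that `egz` needs. This is the only source of extremal sequences.
    core : ∀ Hs Ts → length Hs ℕ.+ length Ts ℕ.+ 1 ≡ M ℕ.+ m →
      (WinH M Hs ⊎ WinT M Hs Ts) ⊎ (∃ λ c → Ts ≡ [ c ] × Extremal M Hs)
    core Hs [] len = inj₁ (inj₁ (egz M· len′ (nonempty 1 (s≤s z≤n) len′)))
      where
      len′ : suc (length Hs) ≡ M ℕ.+ m
      len′ = ≡.trans (≡.trans (ℕₚ.+-comm 1 _) (cong (ℕ._+ 1) (sym (ℕₚ.+-identityʳ _)))) len
    core Hs (c ∷ []) len with egz-inverse kind′ M· len′ (nonempty 2 (s≤s (s≤s z≤n)) len′)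
      where
      len′ : 2 ℕ.+ length Hs ≡ M ℕ.+ m
      len′ = ≡.trans (≡.trans (ℕₚ.+-comm 2 _) (sym (ℕₚ.+-assoc _ 1 1))) len
    ... | inj₁ w = inj₁ (inj₁ w)
    ... | inj₂ E = inj₂ (c , refl , E)
    core Hs (c ∷ d ∷ Ts) len with length (c ∷ d ∷ Ts) ℕ.≤? n
    ... | yes k≤n = inj₁ (Small.small 𝕋 len k≤n)
    ... | no  k≰n = inj₁ (big len (ℕₚ.≰⇒> k≰n))

-- Coordinates on the dicyclic group.

module Model (G : FinGroup) (n : ℕ) .{{_ : NonZero n}} (order≡ : FinGroup.order G ≡ 4 ℕ.* n)
  (α τ : FinGroup.Carrier G) (presentation : DicPresentation G n α τ) where
  open FinGroup G
  𝔾 : EvenGroup n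
  𝔾 = residues n
  open EvenGroup 𝔾 hiding (abelianGroup; isAbelianGroup)
  open Solver 𝔾 hiding (assoc; identityˡ; identityʳ; inverseˡ; inverseʳ; comm; correct)
  module A = Solver 𝔾
  open Dec≡ _≟_
  open Scherk 𝔾
  open Extraction 𝔾
  open InverseTheorem 𝔾
  open FewOutside 𝔾 using (Target)
  open ManyOutside 𝔾 using (oddᵇ)
  open Structure 𝔾

  private instance
    m≢0 : NonZero m
    m≢0 = ℕₚ.m*n≢0 2 n

  module R = Mod m
  open R public using (⟨_⟩)

  Gr : Group _ _
  Gr = record { isGroup = isGroup }
  open Group Gr using (assoc; identityˡ; identityʳ; inverseˡ; inverseʳ)
  open import Algebra.Properties.Group Gr using (inverseˡ-unique)
  open ≡.≡-Reasoning

  pow-+ : ∀ g i j → pow G g (i ℕ.+ j) ≡ pow G g i ∙ pow G g j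
  pow-+ g zero    j = sym (identityˡ _)
  pow-+ g (suc i) j = ≡.trans (cong (g ∙_) (pow-+ g i j)) (sym (assoc _ _ _))

  pow-ε : ∀ k → pow G ε k ≡ ε
  pow-ε zero    = refl
  pow-ε (suc k) = ≡.trans (identityˡ _) (pow-ε k)

  pow-* : ∀ g i j → pow G g (i ℕ.* j) ≡ pow G (pow G g j) i
  pow-* g zero    j = refl
  pow-* g (suc i) j = ≡.trans (pow-+ g j (i ℕ.* j)) (cong (pow G g j ∙_) (pow-* g i j))

  α^m : pow G α m ≡ ε
  α^m = proj₁ presentation
  ττ : τ ∙ τ ≡ pow G α n
  ττ = proj₁ (proj₂ presentation)
  τα : τ ∙ α ≡ (α ⁻¹) ∙ τ
  τα = proj₁ (proj₂ (proj₂ presentation))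

  pow-% : ∀ k → pow G α (k % m) ≡ pow G α k
  pow-% k = sym (begin
    pow G α k                                     ≡⟨ cong (pow G α) (m≡m%n+[m/n]*n k m) ⟩
    pow G α (k % m ℕ.+ (k / m) ℕ.* m)             ≡⟨ pow-+ α (k % m) ((k / m) ℕ.* m) ⟩
    pow G α (k % m) ∙ pow G α ((k / m) ℕ.* m)     ≡⟨ cong (pow G α (k % m) ∙_) (≡.trans (pow-* α (k / m) m) (≡.trans (cong (λ g → pow G g (k / m)) α^m) (pow-ε (k / m)))) ⟩
    pow G α (k % m) ∙ ε                           ≡⟨ identityʳ _ ⟩
    pow G α (k % m)                               ∎)

  φ ψ : Z → Carrier
  φ x = pow G α (toℕ x)
  ψ c = φ c ∙ τ

  φ-⟨⟩ : ∀ k → φ ⟨ k ⟩ ≡ pow G α k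
  φ-⟨⟩ k = ≡.trans (cong (pow G α) (R.toℕ-⟨⟩ k)) (pow-% k)

  φ-+ : ∀ x y → φ (x + y) ≡ φ x ∙ φ y
  φ-+ x y = ≡.trans (φ-⟨⟩ (toℕ x ℕ.+ toℕ y)) (pow-+ α (toℕ x) (toℕ y))

  φ-0 : φ 0# ≡ ε
  φ-0 = φ-⟨⟩ 0

  φ-ν : φ ν ≡ τ ∙ τ
  φ-ν = ≡.trans (φ-⟨⟩ n) (sym ττ)

  φ-neg : ∀ x → φ (- x) ≡ φ x ⁻¹
  φ-neg x = inverseˡ-unique (φ (- x)) (φ x) (≡.trans (sym (φ-+ (- x) x)) (≡.trans (cong φ (A.inverseˡ x)) φ-0))

  φ-· : ∀ k x → φ (k · x) ≡ pow G (φ x) k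
  φ-· zero    x = φ-0
  φ-· (suc k) x = ≡.trans (φ-+ x (k · x)) (cong (φ x ∙_) (φ-· k x))

  ·-neg : ∀ k x → k · (- x) ≡ - (k · x)
  ·-neg k x = ≡.trans (solve 2 (λ a b → a ≗ (a ⊞ b) ⊞ (⊟ b)) refl (k · (- x)) (k · x))
    (≡.trans (cong (_- (k · x)) (≡.trans (sym (·-distrib-+ (- x) x k)) (≡.trans (cong (k ·_) (A.inverseˡ x)) (·-zero k)))) (A.identityˡ _))

  ·-⟨1⟩ : ∀ k → k · ⟨ 1 ⟩ ≡ ⟨ k ⟩
  ·-⟨1⟩ zero    = refl
  ·-⟨1⟩ (suc k) = ≡.trans (cong (⟨ 1 ⟩ +_) (·-⟨1⟩ k)) (R.⟨⟩-+ 1 k)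

  φ-1 : φ ⟨ 1 ⟩ ≡ α
  φ-1 = ≡.trans (φ-⟨⟩ 1) (identityʳ α)

  τ-pow : ∀ k → τ ∙ pow G α k ≡ pow G (α ⁻¹) k ∙ τ
  τ-pow zero    = ≡.trans (identityʳ τ) (sym (identityˡ τ))
  τ-pow (suc k) = begin
    τ ∙ (α ∙ pow G α k)              ≡⟨ assoc _ _ _ ⟨
    (τ ∙ α) ∙ pow G α k              ≡⟨ cong (_∙ pow G α k) τα ⟩
    ((α ⁻¹) ∙ τ) ∙ pow G α k         ≡⟨ assoc _ _ _ ⟩
    (α ⁻¹) ∙ (τ ∙ pow G α k)         ≡⟨ cong ((α ⁻¹) ∙_) (τ-pow k) ⟩
    (α ⁻¹) ∙ (pow G (α ⁻¹) k ∙ τ)    ≡⟨ assoc _ _ _ ⟨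
    ((α ⁻¹) ∙ pow G (α ⁻¹) k) ∙ τ    ∎

  τ-φ : ∀ x → τ ∙ φ x ≡ φ (- x) ∙ τ
  τ-φ x = ≡.trans (τ-pow (toℕ x)) (cong (_∙ τ) (begin
    pow G (α ⁻¹) (toℕ x)        ≡⟨ cong (λ g → pow G g (toℕ x)) (≡.trans (cong _⁻¹ (sym φ-1)) (sym (φ-neg ⟨ 1 ⟩))) ⟩
    pow G (φ (- ⟨ 1 ⟩)) (toℕ x) ≡⟨ φ-· (toℕ x) (- ⟨ 1 ⟩) ⟨
    φ (toℕ x · (- ⟨ 1 ⟩))       ≡⟨ cong φ (≡.trans (·-neg (toℕ x) ⟨ 1 ⟩) (cong -_ (≡.trans (·-⟨1⟩ (toℕ x)) (R.⟨⟩-toℕ x)))) ⟩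
    φ (- x)                     ∎))

  Code : Set
  Code = Z ⊎ Z

  ev : Code → Carrier
  ev (inj₁ x) = φ x
  ev (inj₂ c) = ψ c

  infixl 7 _⊗_
  _⊗_ : Code → Code → Code
  inj₁ x ⊗ inj₁ y = inj₁ (x + y)
  inj₁ x ⊗ inj₂ c = inj₂ (x + c)
  inj₂ c ⊗ inj₁ x = inj₂ (c - x)
  inj₂ c ⊗ inj₂ d = inj₁ (c - d + ν)

  ψ-φ : ∀ c x → ψ c ∙ φ x ≡ ψ (c - x)
  ψ-φ c x = begin
    (φ c ∙ τ) ∙ φ x        ≡⟨ assoc _ _ _ ⟩
    φ c ∙ (τ ∙ φ x)        ≡⟨ cong (φ c ∙_) (τ-φ x) ⟩
    φ c ∙ (φ (- x) ∙ τ)    ≡⟨ assoc _ _ _ ⟨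
    (φ c ∙ φ (- x)) ∙ τ    ≡⟨ cong (_∙ τ) (φ-+ c (- x)) ⟨
    ψ (c - x)              ∎

  ev-⊗ : ∀ g h → ev (g ⊗ h) ≡ ev g ∙ ev h
  ev-⊗ (inj₁ x) (inj₁ y) = φ-+ x y
  ev-⊗ (inj₁ x) (inj₂ c) = ≡.trans (cong (_∙ τ) (φ-+ x c)) (assoc _ _ _)
  ev-⊗ (inj₂ c) (inj₁ x) = sym (ψ-φ c x)
  ev-⊗ (inj₂ c) (inj₂ d) = begin
    φ (c - d + ν)            ≡⟨ φ-+ (c - d) ν ⟩
    φ (c - d) ∙ φ ν          ≡⟨ cong (φ (c - d) ∙_) φ-ν ⟩
    φ (c - d) ∙ (τ ∙ τ)      ≡⟨ assoc _ _ _ ⟨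
    ψ (c - d) ∙ τ            ≡⟨ cong (_∙ τ) (ψ-φ c d) ⟨
    (ψ c ∙ φ d) ∙ τ          ≡⟨ assoc _ _ _ ⟩
    ψ c ∙ ψ d                ∎

  τ≡ψ0 : ψ 0# ≡ τ
  τ≡ψ0 = ≡.trans (cong (_∙ τ) φ-0) (identityˡ τ)

  ev-ν : ev (inj₂ ν) ≡ τ ⁻¹
  ev-ν = inverseˡ-unique (ψ ν) τ (begin
    (φ ν ∙ τ) ∙ τ   ≡⟨ assoc _ _ _ ⟩
    φ ν ∙ (τ ∙ τ)   ≡⟨ cong (φ ν ∙_) φ-ν ⟨
    φ ν ∙ φ ν       ≡⟨ φ-+ ν ν ⟨
    φ (ν + ν)       ≡⟨ cong φ ν+ν≡0 ⟩
    φ 0#            ≡⟨ φ-0 ⟩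
    ε               ∎)

  -- The codes are closed under left multiplication by the four letters; as α and τ generate, every
  -- group element gets a code.
  word : ∀ w → ∃ λ g → ev g ≡ evalWord G α τ w
  word [] = inj₁ 0# , φ-0
  word (l ∷ w) with word w
  ... | g , e = step l
    where
    step : ∀ l → ∃ λ h → ev h ≡ evalWord G α τ (l ∷ w)
    step Defs.a  = inj₁ ⟨ 1 ⟩ ⊗ g , ≡.trans (ev-⊗ (inj₁ ⟨ 1 ⟩) g) (cong₂ _∙_ φ-1 e)
    step Defs.a⁻ = inj₁ (- ⟨ 1 ⟩) ⊗ g , ≡.trans (ev-⊗ (inj₁ (- ⟨ 1 ⟩)) g) (cong₂ _∙_ (≡.trans (φ-neg ⟨ 1 ⟩) (cong _⁻¹ φ-1)) e)
    step Defs.t  = inj₂ 0# ⊗ g , ≡.trans (ev-⊗ (inj₂ 0#) g) (cong₂ _∙_ τ≡ψ0 e)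
    step Defs.t⁻ = inj₂ ν ⊗ g , ≡.trans (ev-⊗ (inj₂ ν) g) (cong₂ _∙_ ev-ν e)

  code : Carrier → Code
  code g = proj₁ (word (proj₁ (proj₂ (proj₂ (proj₂ presentation)) g)))

  ev-code : ∀ g → ev (code g) ≡ g
  ev-code g = ≡.trans (proj₂ (word w)) (proj₂ (proj₂ (proj₂ (proj₂ presentation)) g))
    where w = proj₁ (proj₂ (proj₂ (proj₂ presentation)) g)

  code-injective : ∀ {g h} → code g ≡ code h → g ≡ h
  code-injective {g} {h} e = ≡.trans (sym (ev-code g)) (≡.trans (cong ev e) (ev-code h))

  -- Otherwise the section code would embed G into fewer than 4n codes.
  code-ev : ∀ c → code (ev c) ≡ c
  code-ev c with Finₚ.any? (λ i → join m m (code (Inverse.from enum i)) Finₚ.≟ join m m c)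
  ... | yes (i , e) = ≡.trans (cong (λ g → code (ev g)) (sym c≡)) (≡.trans (cong code (ev-code g)) c≡)
    where
    g = Inverse.from enum i
    c≡ : code g ≡ c
    c≡ = ≡.trans (sym (Finₚ.splitAt-join m m (code g))) (≡.trans (cong (Data.Fin.splitAt m) e) (Finₚ.splitAt-join m m c))
  ... | no missed = ⊥-elim (contra (m ℕ.+ m) refl (join m m c) (λ i → join m m (code (Inverse.from enum i)))
      (λ i e → missed (i , e)) inj)
    where
    inj : ∀ {i j} → join m m (code (Inverse.from enum i)) ≡ join m m (code (Inverse.from enum j)) → i ≡ j
    inj {i} {j} e = ≡.trans (sym (Inverse.strictlyInverseˡ enum i)) (≡.trans (cong (Inverse.to enum)
      (code-injective (≡.trans (sym (Finₚ.splitAt-join m m _)) (≡.trans (cong (Data.Fin.splitAt m) e) (Finₚ.splitAt-join m m _)))))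
      (Inverse.strictlyInverseˡ enum j))
    contra : ∀ k → m ℕ.+ m ≡ k → (x : Fin k) (f : Fin order → Fin k) → (∀ i → f i ≢ x) → (∀ {i j} → f i ≡ f j → i ≡ j) → ⊥
    contra (suc k) mm x f f≢x f-inj = ℕₚ.<-irrefl refl (ℕₚ.≤-trans (s≤s (Finₚ.injective⇒≤ {f = λ i → punchOut {i = x} (λ e → f≢x i (sym e))}
      (λ {i} {j} e → f-inj (Finₚ.punchOut-injective {i = x} (λ e → f≢x i (sym e)) (λ e → f≢x j (sym e)) e)))) (eq≤ (≡.trans (sym mm) (≡.trans (lem n) (sym order≡)))))
      where
      lem : ∀ n → 2 ℕ.* n ℕ.+ 2 ℕ.* n ≡ 4 ℕ.* n
      lem = solve-∀

  φ-injective : ∀ {x y} → φ x ≡ φ y → x ≡ y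
  φ-injective {x} {y} e with ≡.trans (sym (code-ev (inj₁ x))) (≡.trans (cong code e) (code-ev (inj₁ y)))
  ... | refl = refl

  ψ≢φ : ∀ {c x} → ψ c ≢ φ x
  ψ≢φ {c} {x} e with ≡.trans (sym (code-ev (inj₂ c))) (≡.trans (cong code e) (code-ev (inj₁ x)))
  ... | ()

  rotation reflection : Code → Maybe Z
  rotation (inj₁ x) = just x
  rotation (inj₂ c) = nothing
  reflection (inj₁ x) = nothing
  reflection (inj₂ c) = just c

  hs ts : List Carrier → List Z
  hs = mapMaybe (λ g → rotation (code g))
  ts = mapMaybe (λ g → reflection (code g))

  hs-++ : ∀ S T → hs (S ++ T) ≡ hs S ++ hs T
  hs-++ = Lₚ.mapMaybe-++ (λ g → rotation (code g))
  ts-++ : ∀ S T → ts (S ++ T) ≡ ts S ++ ts T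
  ts-++ = Lₚ.mapMaybe-++ (λ g → reflection (code g))

  hs-↭ : ∀ {S T} → S ↭ T → hs S ↭ hs T
  hs-↭ = P.mapMaybe-↭ (λ g → rotation (code g))
  ts-↭ : ∀ {S T} → S ↭ T → ts S ↭ ts T
  ts-↭ = P.mapMaybe-↭ (λ g → reflection (code g))

  hs-≼ : ∀ {S T} → S ≼ T → hs S ≼ hs T
  hs-≼ {S} (R , p) = hs R , ↭-trans (hs-↭ p) (↭-reflexive (hs-++ S R))
  ts-≼ : ∀ {S T} → S ≼ T → ts S ≼ ts T
  ts-≼ {S} (R , p) = ts R , ↭-trans (ts-↭ p) (↭-reflexive (ts-++ S R))

  decompose : ∀ S → S ↭ map φ (hs S) ++ map ψ (ts S)
  decompose [] = ↭-refl
  decompose (g ∷ S) with code g | ev-code g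
  ... | inj₁ x | refl = prep (φ x) (decompose S)
  ... | inj₂ c | refl = ↭-trans (prep (ψ c) (decompose S)) (↭-sym (P.shift (ψ c) (map φ (hs S)) (map ψ (ts S))))

  hs-φ : ∀ X → hs (map φ X) ≡ X
  hs-φ []      = refl
  hs-φ (x ∷ X) rewrite code-ev (inj₁ x) = cong (x ∷_) (hs-φ X)
  ts-φ : ∀ X → ts (map φ X) ≡ []
  ts-φ []      = refl
  ts-φ (x ∷ X) rewrite code-ev (inj₁ x) = ts-φ X
  hs-ψ : ∀ X → hs (map ψ X) ≡ []
  hs-ψ []      = refl
  hs-ψ (x ∷ X) rewrite code-ev (inj₂ x) = hs-ψ X
  ts-ψ : ∀ X → ts (map ψ X) ≡ X
  ts-ψ []      = refl
  ts-ψ (x ∷ X) rewrite code-ev (inj₂ x) = cong (x ∷_) (ts-ψ X)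

  length-split : ∀ S → length (hs S) ℕ.+ length (ts S) ≡ length S
  length-split S = sym (≡.trans (P.↭-length (decompose S)) (≡.trans (Lₚ.length-++ (map φ (hs S)))
    (cong₂ ℕ._+_ (Lₚ.length-map φ (hs S)) (Lₚ.length-map ψ (ts S)))))

  prod-++ : ∀ S T → prod G (S ++ T) ≡ prod G S ∙ prod G T
  prod-++ []      T = sym (identityˡ _)
  prod-++ (g ∷ S) T = ≡.trans (cong (g ∙_) (prod-++ S T)) (sym (assoc _ _ _))

  prod-φ : ∀ X → prod G (map φ X) ≡ φ (sum X)
  prod-φ []      = sym φ-0
  prod-φ (x ∷ X) = ≡.trans (cong (φ x ∙_) (prod-φ X)) (sym (φ-+ x (sum X)))

  prod-flat : ∀ E → prod G (map ψ (flat E)) ≡ φ (twist E)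
  prod-flat []            = sym φ-0
  prod-flat ((c , d) ∷ E) = begin
    ψ c ∙ (ψ d ∙ prod G (map ψ (flat E)))     ≡⟨ assoc _ _ _ ⟨
    (ψ c ∙ ψ d) ∙ prod G (map ψ (flat E))     ≡⟨ cong₂ _∙_ (sym (ev-⊗ (inj₂ c) (inj₂ d))) (prod-flat E) ⟩
    φ (c - d + ν) ∙ φ (twist E)               ≡⟨ φ-+ (c - d + ν) (twist E) ⟨
    φ (twist ((c , d) ∷ E))                   ∎

  fits : ∀ {S X C} → X ≼ hs S → C ≼ ts S → map φ X ++ map ψ C ≼ S
  fits {S} sX sC = ≼-respʳ (↭-sym (decompose S)) (≼-++⁺ (lift φ sX) (lift ψ sC))
    where
    lift : ∀ (g : Z → Carrier) {X Y} → X ≼ Y → map g X ≼ map g Y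
    lift g {X} (R , p) = map g R , ↭-trans (P.map⁺ g p) (↭-reflexive (Lₚ.map-++ g X R))

  win⇒PO : ∀ {M S} → WinH M (hs S) ⊎ WinT M (hs S) (ts S) → HasPOSub G M S
  win⇒PO {M} {S} (inj₁ (X , s , len , e)) = map φ X
    , subst (_≼ S) (Lₚ.++-identityʳ (map φ X)) (fits s (ts S , ↭-refl))
    , ≡.trans (Lₚ.length-map φ X) len , map φ X , ↭-refl , ≡.trans (prod-φ X) (≡.trans (cong φ e) φ-0)
  win⇒PO {M} {S} (inj₂ (P , N , (c , d) , E , sH , sT , len , e)) = map φ (P ++ N) ++ map ψ (c ∷ d ∷ flat E)
    , fits sH sT
    , ≡.trans (Lₚ.length-++ (map φ (P ++ N))) (≡.trans (cong₂ ℕ._+_ (≡.trans (Lₚ.length-map φ (P ++ N)) (Lₚ.length-++ P))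
        (≡.trans (Lₚ.length-map ψ (c ∷ d ∷ flat E)) (cong (λ k → suc (suc k)) (length-flat E)))) (≡.trans (lem (length P) (length N) (length E)) len))
    , map φ P ++ ψ c ∷ map φ N ++ ψ d ∷ map ψ (flat E)
    , ↭-trans (↭-reflexive (cong (_++ map ψ (c ∷ d ∷ flat E)) (Lₚ.map-++ φ P N)))
        (psolve 5 (λ p n c d e → (p ⊕ n) ⊕ (c ⊕ (d ⊕ e)) ⊜ p ⊕ (c ⊕ (n ⊕ (d ⊕ e)))) ↭-refl (map φ P) (map φ N) [ ψ c ] [ ψ d ] (map ψ (flat E)))
    , (begin
        prod G (map φ P ++ ψ c ∷ map φ N ++ ψ d ∷ map ψ (flat E))
          ≡⟨ ≡.trans (prod-++ (map φ P) _) (cong₂ _∙_ (prod-φ P) (cong (ψ c ∙_) (≡.trans (prod-++ (map φ N) _)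
               (cong₂ _∙_ (prod-φ N) (cong (ψ d ∙_) (prod-flat E)))))) ⟩
        φ (sum P) ∙ (ψ c ∙ (φ (sum N) ∙ (ψ d ∙ φ (twist E))))
          ≡⟨ cong (λ g → φ (sum P) ∙ (ψ c ∙ (φ (sum N) ∙ g))) (ev-⊗ (inj₂ d) (inj₁ (twist E))) ⟨
        φ (sum P) ∙ (ψ c ∙ (φ (sum N) ∙ ψ (d - twist E)))
          ≡⟨ cong (λ g → φ (sum P) ∙ (ψ c ∙ g)) (ev-⊗ (inj₁ (sum N)) (inj₂ (d - twist E))) ⟨
        φ (sum P) ∙ (ψ c ∙ ψ (sum N + (d - twist E)))
          ≡⟨ cong (φ (sum P) ∙_) (ev-⊗ (inj₂ c) (inj₂ (sum N + (d - twist E)))) ⟨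
        φ (sum P) ∙ φ (c - (sum N + (d - twist E)) + ν)
          ≡⟨ φ-+ (sum P) (c - (sum N + (d - twist E)) + ν) ⟨
        φ (sum P + (c - (sum N + (d - twist E)) + ν))
          ≡⟨ cong φ (solve 6 (λ p n c d w v → p ⊞ ((c ⊞ (⊟ (n ⊞ (d ⊞ (⊟ w))))) ⊞ v) ≗ (p ⊞ (((c ⊞ (⊟ d)) ⊞ v) ⊞ w)) ⊞ (⊟ n)) refl (sum P) (sum N) c d (twist E) ν) ⟩
        φ (sum P + twist ((c , d) ∷ E) - sum N)
          ≡⟨ cong φ (≡.trans (cong (_- sum N) e) (A.inverseʳ (sum N))) ⟩
        φ 0#  ≡⟨ φ-0 ⟩
        ε     ∎)
    where
    length-flat : ∀ E → length (flat E) ≡ 2 ℕ.* length E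
    length-flat []      = refl
    length-flat (_ ∷ E) = ≡.trans (cong (λ k → suc (suc k)) (length-flat E)) (double-suc (length E))
    lem : ∀ p n e → p ℕ.+ n ℕ.+ suc (suc (2 ℕ.* e)) ≡ p ℕ.+ n ℕ.+ 2 ℕ.* suc e
    lem = solve-∀

  prod-class : ∀ T → (oddᵇ (length (ts T)) ≡ false × ∃ λ x → prod G T ≡ φ x) ⊎ (oddᵇ (length (ts T)) ≡ true × ∃ λ c → prod G T ≡ ψ c)
  prod-class [] = inj₁ (refl , 0# , sym φ-0)
  prod-class (g ∷ T) with code g | ev-code g | prod-class T
  ... | inj₁ x | refl | inj₁ (o , y , e) = inj₁ (o , x + y , ≡.trans (cong (φ x ∙_) e) (sym (ev-⊗ (inj₁ x) (inj₁ y))))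
  ... | inj₁ x | refl | inj₂ (o , d , e) = inj₂ (o , x + d , ≡.trans (cong (φ x ∙_) e) (sym (ev-⊗ (inj₁ x) (inj₂ d))))
  ... | inj₂ c | refl | inj₁ (o , y , e) = inj₂ (cong not o , c - y , ≡.trans (cong (ψ c ∙_) e) (sym (ev-⊗ (inj₂ c) (inj₁ y))))
  ... | inj₂ c | refl | inj₂ (o , d , e) = inj₁ (cong not o , c - d + ν , ≡.trans (cong (ψ c ∙_) e) (sym (ev-⊗ (inj₂ c) (inj₂ d))))

  prod-inside : ∀ T → ts T ≡ [] → prod G T ≡ φ (sum (hs T))
  prod-inside [] _ = sym φ-0
  prod-inside (g ∷ T) e with code g | ev-code g
  ... | inj₁ x | refl = ≡.trans (cong (φ x ∙_) (prod-inside T e)) (sym (φ-+ x (sum (hs T))))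

  -- A product equal to 1 involves an even number of outside terms. If at most one is available,
  -- none is used, and the product is a plain sum of exponents.
  PO⇒win : ∀ {M S} → length (ts S) ≤ 1 → HasPOSub G M S → WinH M (hs S)
  PO⇒win {M} {S} ≤1 (T , s , len , T′ , p , e) with ts T in eqT | ≼-length (ts-≼ s)
  ... | [] | _ = hs T , hs-≼ s , ≡.trans (sym (≡.trans (cong (λ C → length (hs T) ℕ.+ length C) eqT) (ℕₚ.+-identityʳ _))) (≡.trans (length-split T) len)
      , φ-injective (≡.trans (sym (≡.trans (prod-inside T′ (P.↭-empty-inv (↭-trans (↭-sym (ts-↭ p)) (↭-reflexive eqT))))
          (cong φ (sum-↭ (↭-sym (hs-↭ p)))))) (≡.trans e (sym φ-0)))
  ... | _ ∷ _ ∷ _ | le = ⊥-elim (ℕₚ.<-irrefl refl (ℕₚ.≤-trans (s≤s (s≤s z≤n)) (ℕₚ.≤-trans le ≤1)))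
  ... | c ∷ [] | _ with prod-class T′
  ... | inj₂ (_ , d , e′) = ⊥-elim (ψ≢φ {d} {0#} (≡.trans (sym e′) (≡.trans e (sym φ-0))))
  ... | inj₁ (o , _) with ≡.trans (sym o) (cong oddᵇ (≡.trans (P.↭-length (ts-↭ (↭-sym p))) (cong length eqT)))
  ... | ()

-- From residues to sequences over the group.

module Sequences (G : FinGroup) (n : ℕ) .{{_ : NonZero n}} (order≡ : FinGroup.order G ≡ 4 ℕ.* n)
  (α τ : FinGroup.Carrier G) (presentation : DicPresentation G n α τ) where
  open FinGroup G
  open Model G n order≡ α τ presentation
  open EvenGroup 𝔾 hiding (abelianGroup; isAbelianGroup)
  open Solver 𝔾
  open Dec≡ _≟_
  open Scherk 𝔾
  open Extraction 𝔾
  open InverseTheorem 𝔾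
  open FewOutside 𝔾 using (Target; two-torsion)
  open ManyOutside 𝔾 using (oddᵇ; even-·)
  open Structure 𝔾

  private instance
    m≢0 : NonZero m
    m≢0 = ℕₚ.m*n≢0 2 n

  toℕ-sum : ∀ x y → ∃ λ q → toℕ x ℕ.+ toℕ y ≡ toℕ (x + y) ℕ.+ q ℕ.* m
  toℕ-sum x y = (toℕ x ℕ.+ toℕ y) / m , ≡.trans (m≡m%n+[m/n]*n (toℕ x ℕ.+ toℕ y) m)
    (cong (ℕ._+ ((toℕ x ℕ.+ toℕ y) / m) ℕ.* m) (sym (R.toℕ-⟨⟩ (toℕ x ℕ.+ toℕ y))))

  -- The theorem measures r₁ - r₂ by an absolute difference of representatives, the proof by a
  -- residue. Up to sign they agree modulo m, so they share the divisors of m.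
  ∣-difference : ∀ {d} x y → d ∣ m → (d ∣ ∣ toℕ x - toℕ y ∣ → d ∣ toℕ (y - x)) × (d ∣ toℕ (y - x) → d ∣ ∣ toℕ x - toℕ y ∣)
  ∣-difference {d} x y d∣m with toℕ-sum x (y - x) | ℕₚ.≤-total (toℕ x) (toℕ y)
  ... | q , e | inj₁ x≤y with ℕₚ.m≤n⇒∃[o]m+o≡n x≤y
  ... | o , x+o = subst (λ k → (d ∣ k → d ∣ δ) × (d ∣ δ → d ∣ k)) (sym |x-y|) (to , from)
    where
    δ = toℕ (y - x)
    |x-y| : ∣ toℕ x - toℕ y ∣ ≡ o
    |x-y| = ≡.trans (cong (∣ toℕ x -_∣) (sym x+o)) (ℕₚ.∣m-m+n∣≡n (toℕ x) o)
    δ≡ : δ ≡ o ℕ.+ q ℕ.* m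
    δ≡ = ℕₚ.+-cancelˡ-≡ (toℕ x) _ _ (≡.trans e (≡.trans (cong (λ z → toℕ z ℕ.+ q ℕ.* m)
      (solve 2 (λ x y → x ⊞ (y ⊞ (⊟ x)) ≗ y) refl x y)) (≡.trans (cong (ℕ._+ q ℕ.* m) (sym x+o)) (ℕₚ.+-assoc (toℕ x) o _))))
    to : d ∣ o → d ∣ δ
    to d∣o = subst (d ∣_) (sym δ≡) (∣m∣n⇒∣m+n d∣o (∣n⇒∣m*n q d∣m))
    from : d ∣ δ → d ∣ o
    from d∣δ = ∣m+n∣m⇒∣n (subst (d ∣_) (≡.trans δ≡ (ℕₚ.+-comm o _)) d∣δ) (∣n⇒∣m*n q d∣m)
  ∣-difference {d} x y d∣m | q , e | inj₂ y≤x with ℕₚ.m≤n⇒∃[o]m+o≡n y≤x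
  ... | o , y+o = subst (λ k → (d ∣ k → d ∣ δ) × (d ∣ δ → d ∣ k)) (sym |x-y|) (to , from)
    where
    δ = toℕ (y - x)
    |x-y| : ∣ toℕ x - toℕ y ∣ ≡ o
    |x-y| = ≡.trans (ℕₚ.∣-∣-comm (toℕ x) (toℕ y)) (≡.trans (cong (∣ toℕ y -_∣) (sym y+o)) (ℕₚ.∣m-m+n∣≡n (toℕ y) o))
    o+δ : o ℕ.+ δ ≡ q ℕ.* m
    o+δ = ℕₚ.+-cancelˡ-≡ (toℕ y) _ _ (≡.trans (sym (ℕₚ.+-assoc (toℕ y) o δ)) (≡.trans (cong (ℕ._+ δ) y+o) (≡.trans e
      (cong (λ z → toℕ z ℕ.+ q ℕ.* m) (solve 2 (λ x y → x ⊞ (y ⊞ (⊟ x)) ≗ y) refl x y)))))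
    to : d ∣ o → d ∣ δ
    to d∣o = ∣m+n∣m⇒∣n (subst (d ∣_) (sym o+δ) (∣n⇒∣m*n q d∣m)) d∣o
    from : d ∣ δ → d ∣ o
    from d∣δ = ∣m+n∣m⇒∣n (subst (d ∣_) (≡.trans (sym o+δ) (ℕₚ.+-comm o δ)) (∣n⇒∣m*n q d∣m)) d∣δ

  1<m : 1 < m
  1<m = ℕₚ.≤-trans (s≤s (ℕ.>-nonZero⁻¹ n)) (n<2n n)

  generator-coprime : ∀ {d δ} → Generator δ → d ∣ m → d ∣ toℕ δ → d ∣ 1
  generator-coprime {d} {δ} gen d∣m d∣δ with gen ⟨ 1 ⟩
  ... | j , e = subst (d ∣_) (≡.trans (sym (R.toℕ-⟨⟩ (j ℕ.* toℕ δ))) (≡.trans (cong toℕ (≡.trans (sym (R.·ₘ-⟨⟩ j δ)) (sym e)))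
      (≡.trans (R.toℕ-⟨⟩ 1) (m<n⇒m%n≡m 1<m)))) (%-presˡ-∣ (∣n⇒∣m*n j d∣δ) d∣m)

  generates⇒gcd : ∀ x y → Generator (y - x) ⊎ Generator (x - y) → gcd ∣ toℕ x - toℕ y ∣ m ≡ 1
  generates⇒gcd x y gen = ∣1⇒≡1 (coprime gen)
    where
    d = gcd ∣ toℕ x - toℕ y ∣ m
    d∣m : d ∣ m
    d∣m = gcd[m,n]∣n ∣ toℕ x - toℕ y ∣ m
    d∣δ : d ∣ ∣ toℕ x - toℕ y ∣
    d∣δ = gcd[m,n]∣m ∣ toℕ x - toℕ y ∣ m
    coprime : Generator (y - x) ⊎ Generator (x - y) → d ∣ 1
    coprime (inj₁ g) = generator-coprime g d∣m (proj₁ (∣-difference x y d∣m) d∣δ)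
    coprime (inj₂ g) = generator-coprime g d∣m (proj₁ (∣-difference y x d∣m) (subst (d ∣_) (ℕₚ.∣-∣-comm (toℕ x) (toℕ y)) d∣δ))

  gcd⇒nonvanishing : ∀ x y → gcd ∣ toℕ x - toℕ y ∣ m ≡ 1 → ∀ j → 1 ≤ j → j < m → j · (y - x) ≢ 0#
  gcd⇒nonvanishing x y g j 1≤j j<m e = ℕₚ.<-irrefl refl (ℕₚ.≤-trans j<m (∣⇒≤ {{ℕ.>-nonZero 1≤j}} m∣j))
    where
    coprime : Coprime m (toℕ (y - x))
    coprime {d} (d∣m , d∣δ) = ∣1⇒≡1 (subst (d ∣_) g (gcd-greatest (proj₂ (∣-difference x y d∣m) d∣δ) d∣m))
    m∣j : m ∣ j
    m∣j = coprime-divisor coprime (subst (m ∣_) (ℕₚ.*-comm j _) (R.⟨⟩≡0⇒∣ (≡.trans (sym (R.·ₘ-⟨⟩ j (y - x))) e)))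

  two-values : ∀ x y X → x ≢ y → All (λ z → z ≡ x ⊎ z ≡ y) X → length X ≡ count x X ℕ.+ count y X × sum X ≡ length X · x + count y X · (y - x)
  two-values x y [] ne [] = refl , sym (identityˡ 0#)
  two-values x y (z ∷ X) ne (z≡ ∷ rest) with two-values x y X ne rest
  ... | len , e with x ≟ z | y ≟ z
  ... | yes refl | yes y≡z = ⊥-elim (ne (sym y≡z))
  ... | yes refl | no _    = cong suc len , ≡.trans (cong (x +_) e) (sym (assoc x _ _))
  ... | no _ | yes refl    = ≡.trans (cong suc len) (sym (ℕₚ.+-suc _ _))
      , ≡.trans (cong (y +_) e) (solve 4 (λ x y p q → y ⊞ (p ⊞ q) ≗ (x ⊞ p) ⊞ ((y ⊞ (⊟ x)) ⊞ q)) refl x y (length X · x) (count y X · (y - x)))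
  two-values x y (z ∷ X) ne (inj₁ e₁ ∷ rest) | len , e | no ¬a | no ¬b = ⊥-elim (¬a (sym e₁))
  two-values x y (z ∷ X) ne (inj₂ e₂ ∷ rest) | len , e | no ¬a | no ¬b = ⊥-elim (¬b (sym e₂))

  -- M terms with j copies of y have sum M x + j (y - x) = j (y - x). As x is available only M - 1
  -- times and y only m - 1 times, 1 ≤ j < m, and these multiples do not vanish.
  extremal-no-win : ∀ {M Hs} x y → (∀ z → M · z ≡ 0#) → 1 ≤ M → Hs ↭ replicate (M ℕ.∸ 1) x ++ replicate (m ℕ.∸ 1) y →
    (∀ j → 1 ≤ j → j < m → j · (y - x) ≢ 0#) → ¬ WinH M Hs
  extremal-no-win {M} {Hs} x y M· 1≤M p nv (X , s , len , e) with two-values x y X x≢y (All.tabulate member)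
    where
    x≢y : x ≢ y
    x≢y refl = nv 1 ℕₚ.≤-refl 1<m (≡.trans (identityʳ _) (inverseʳ x))
    member : ∀ {z} → z ∈ X → z ≡ x ⊎ z ≡ y
    member i with ∈-++⁻ (replicate (M ℕ.∸ 1) x) (P.∈-resp-↭ p (≼-∈ s i))
    ... | inj₁ j = inj₁ (All.lookup (Allₚ.replicate⁺ {P = _≡ x} (M ℕ.∸ 1) refl) j)
    ... | inj₂ j = inj₂ (All.lookup (Allₚ.replicate⁺ {P = _≡ y} (m ℕ.∸ 1) refl) j)
  ... | len′ , e′ = nv (count y X) (y≥1 (count y X) refl) y<m (≡.trans (sym (≡.trans (cong (_+ count y X · (y - x)) (≡.trans (cong (_· x) len) (M· x))) (identityˡ _))) (≡.trans (sym e′) e))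
    where
    x≢y : x ≢ y
    x≢y refl = nv 1 ℕₚ.≤-refl 1<m (≡.trans (identityʳ _) (inverseʳ x))
    total : ∀ z → count z Hs ≡ count z (replicate (M ℕ.∸ 1) x) ℕ.+ count z (replicate (m ℕ.∸ 1) y)
    total z = ≡.trans (count-↭ z p) (count-++ z (replicate (M ℕ.∸ 1) x) _)
    pred< : ∀ {k} → 1 ≤ k → suc (k ℕ.∸ 1) ≤ k
    pred< (s≤s _) = ℕₚ.≤-refl
    x<M : count x X < M
    x<M = ℕₚ.≤-trans (s≤s (ℕₚ.≤-trans (count-≼ x s) (eq≤ (≡.trans (total x) (≡.trans (cong₂ ℕ._+_ (count-replicate x (M ℕ.∸ 1)) (count-replicate-≢ (m ℕ.∸ 1) x≢y)) (ℕₚ.+-identityʳ _)))))) (pred< 1≤M)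
    y<m : count y X < m
    y<m = ℕₚ.≤-trans (s≤s (ℕₚ.≤-trans (count-≼ y s) (eq≤ (≡.trans (total y) (cong₂ ℕ._+_ (count-replicate-≢ (M ℕ.∸ 1) (λ e → x≢y (sym e))) (count-replicate y (m ℕ.∸ 1))))))) (pred< 1≤m)
    y≥1 : ∀ k → count y X ≡ k → 1 ≤ k
    y≥1 zero e = ⊥-elim (ℕₚ.<-irrefl (≡.trans (≡.trans (sym (ℕₚ.+-identityʳ _)) (cong (count x X ℕ.+_) (sym e))) (≡.trans (sym len′) len)) x<M)
    y≥1 (suc k) _ = s≤s z≤n

  -- The sequences of the theorem for n ≥ 3.
  General : ℕ → Seq G → Set
  General M S = ∃ λ r₁ → ∃ λ r₂ → ∃ λ r₃ → r₁ < m × r₂ < m × r₃ < m × gcd ∣ r₁ - r₂ ∣ m ≡ 1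
    × S ↭ (replicate (M ℕ.∸ 1) (pow G α r₁) ++ replicate (m ℕ.∸ 1) (pow G α r₂) ++ [ pow G α r₃ ∙ τ ])

  general-length : ∀ {M S} → 1 ≤ M → General M S → suc (length S) ≡ M ℕ.+ m
  general-length {M} {S} 1≤M (r₁ , r₂ , r₃ , _ , _ , _ , _ , p) = ≡.trans (cong suc (≡.trans (P.↭-length p)
    (≡.trans (Lₚ.length-++ (replicate (M ℕ.∸ 1) (pow G α r₁))) (cong₂ ℕ._+_ (Lₚ.length-replicate (M ℕ.∸ 1))
      (≡.trans (Lₚ.length-++ (replicate (m ℕ.∸ 1) (pow G α r₂))) (cong (ℕ._+ 1) (Lₚ.length-replicate (m ℕ.∸ 1)))))))) (arith 1≤M 1≤m)
    where
    arith : ∀ {M m} → 1 ≤ M → 1 ≤ m → suc ((M ℕ.∸ 1) ℕ.+ ((m ℕ.∸ 1) ℕ.+ 1)) ≡ M ℕ.+ m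
    arith {suc M} {suc m} _ _ = cong (λ k → suc (M ℕ.+ k)) (ℕₚ.+-comm m 1)

  general-no-PO : ∀ {M S} → (∀ z → M · z ≡ 0#) → 1 ≤ M → General M S → ¬ HasPOSub G M S
  general-no-PO {M} {S} M· 1≤M (r₁ , r₂ , r₃ , r₁< , r₂< , r₃< , g , p) po =
    extremal-no-win x y M· 1≤M (↭-trans (hs-↭ p′) (↭-reflexive (≡.trans (hs-++ (map φ X) _) (≡.trans (cong₂ _++_ (hs-φ X) (hs-ψ [ c ])) (Lₚ.++-identityʳ X)))))
      (gcd⇒nonvanishing x y (subst₂ (λ a b → gcd ∣ a - b ∣ m ≡ 1) (sym (Finₚ.toℕ-fromℕ< r₁<)) (sym (Finₚ.toℕ-fromℕ< r₂<)) g))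
      (PO⇒win (eq≤ (≡.trans (P.↭-length (ts-↭ p′)) (cong length (≡.trans (ts-++ (map φ X) _) (cong₂ _++_ (ts-φ X) (ts-ψ [ c ])))))) po)
    where
    x y c : Z
    x = fromℕ< r₁<
    y = fromℕ< r₂<
    c = fromℕ< r₃<
    X = replicate (M ℕ.∸ 1) x ++ replicate (m ℕ.∸ 1) y
    pow≡ : ∀ {r} (r< : r < m) → pow G α r ≡ φ (fromℕ< r<)
    pow≡ r< = cong (pow G α) (sym (Finₚ.toℕ-fromℕ< r<))
    p′ : S ↭ map φ X ++ map ψ [ c ]
    p′ = ↭-trans p (↭-reflexive (≡.trans (cong₂ (λ A B → A ++ B) (cong (replicate (M ℕ.∸ 1)) (pow≡ r₁<))
        (cong₂ (λ A B → A ++ [ B ∙ τ ]) (cong (replicate (m ℕ.∸ 1)) (pow≡ r₂<)) (pow≡ r₃<)))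
      (≡.trans (sym (Lₚ.++-assoc (replicate (M ℕ.∸ 1) (φ x)) _ _)) (cong (_++ [ ψ c ]) (sym (≡.trans (Lₚ.map-++ φ (replicate (M ℕ.∸ 1) x) _)
        (cong₂ _++_ (Lₚ.map-replicate φ (M ℕ.∸ 1) x) (Lₚ.map-replicate φ (m ℕ.∸ 1) y))))))))

  module Classification (𝕋 : Target) where
    open Target 𝕋
    open Core 𝕋

    1≤M : 1 ≤ M
    1≤M = ℕₚ.≤-trans (s≤s z≤n) 3≤M

    counts : ∀ S → suc (length S) ≡ M ℕ.+ m → length (hs S) ℕ.+ length (ts S) ℕ.+ 1 ≡ M ℕ.+ m
    counts S e = ≡.trans (cong (ℕ._+ 1) (length-split S)) (≡.trans (ℕₚ.+-comm _ 1) e)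

    classify : ∀ S → suc (length S) ≡ M ℕ.+ m → HasPOSub G M S ⊎ General M S
    classify S len with core (hs S) (ts S) (counts S len)
    ... | inj₁ w = inj₁ (win⇒PO w)
    ... | inj₂ (c , ts≡ , x , y , p , gen) = inj₂ (toℕ x , toℕ y , toℕ c , Finₚ.toℕ<n x , Finₚ.toℕ<n y , Finₚ.toℕ<n c
        , generates⇒gcd x y gen
        , ↭-trans (decompose S) (↭-trans (P.++⁺ (P.map⁺ φ p) (↭-reflexive (cong (map ψ) ts≡)))
            (↭-trans (↭-reflexive (cong (_++ [ ψ c ]) (≡.trans (Lₚ.map-++ φ (replicate (M ℕ.∸ 1) x) _) (cong₂ _++_ (Lₚ.map-replicate φ (M ℕ.∸ 1) x) (Lₚ.map-replicate φ (m ℕ.∸ 1) y)))))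
              (P.++-assoc (replicate (M ℕ.∸ 1) (φ x)) _ _))))

    -- A sequence of length M + m with no such subsequence would keep exactly one
    -- term outside ⟨α⟩ after the removal of any of its terms.
    forced : Forces G M (M ℕ.+ m)
    forced S len with remove (hs S₁) (ts S₁) (decompose S₁)
      where
      S₁ = take (M ℕ.+ m) S
      |S₁| : length S₁ ≡ M ℕ.+ m
      |S₁| = length-take≤ (M ℕ.+ m) S len
      count-ts : ∀ H T → length (ts (map φ H ++ map ψ T)) ≡ length T
      count-ts H T = cong length (≡.trans (ts-++ (map φ H) _) (cong₂ _++_ (ts-φ H) (ts-ψ T)))
      Result : Set
      Result = ∃ λ S′ → S′ ≼ S₁ × suc (length S′) ≡ M ℕ.+ m × length (ts S′) ≢ 1
      by : ∀ g S′ k → S₁ ↭ g ∷ S′ → length (ts S′) ≡ k → k ≢ 1 → Result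
      by g S′ k p e k≢1 = S′ , ≼-respʳ (↭-sym p) (≼-++ʳ [ g ] S′) , ≡.trans (sym (P.↭-length p)) |S₁| , λ e′ → k≢1 (≡.trans (sym e) e′)
      -- A term of ⟨α⟩ is removed, except when there is exactly one outside term or when all terms
      -- are outside. Two outside terms alone are impossible because M + m > 2.
      remove : ∀ H T → S₁ ↭ map φ H ++ map ψ T → Result
      remove [] [] p = ⊥-elim (ℕₚ.<-irrefl (≡.trans (sym (P.↭-length p)) |S₁|) (ℕₚ.≤-trans 1≤M (ℕₚ.m≤m+n M m)))
      remove (x ∷ H) [] p = by (φ x) (map φ H ++ []) 0 p (count-ts H []) (λ ())
      remove H (c ∷ []) p = by (ψ c) (map φ H ++ []) 0 (↭-trans p (P.shift (ψ c) (map φ H) [])) (count-ts H []) (λ ())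
      remove (x ∷ H) (c ∷ d ∷ T) p = by (φ x) (map φ H ++ map ψ (c ∷ d ∷ T)) (suc (suc (length T))) p (count-ts H (c ∷ d ∷ T)) (λ ())
      remove [] (c ∷ d ∷ []) p = ⊥-elim (ℕₚ.<-irrefl (≡.trans (sym (P.↭-length p)) |S₁|) (ℕₚ.≤-trans 3≤M (ℕₚ.m≤m+n M m)))
      remove [] (c ∷ d ∷ e ∷ T) p = by (ψ c) (map ψ (d ∷ e ∷ T)) (suc (suc (length T))) p (count-ts [] (d ∷ e ∷ T)) (λ ())
    ... | S′ , s , len′ , ≢1 with core (hs S′) (ts S′) (counts S′ len′)
    ... | inj₁ w = lift (win⇒PO w)
      where
      lift : HasPOSub G M S′ → HasPOSub G M S
      lift (T , s′ , rest) = T , ≼-trans s′ (≼-trans s (≼-take (M ℕ.+ m) S)) , rest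
    ... | inj₂ (c , ts≡ , _) = ⊥-elim (≢1 (cong length ts≡))

    example : ∃ (General M)
    example = replicate (M ℕ.∸ 1) (pow G α 0) ++ replicate (m ℕ.∸ 1) (pow G α 1) ++ [ pow G α 0 ∙ τ ]
      , 0 , 1 , 0 , 1≤m , 1<m , 1≤m , ∣1⇒≡1 (gcd[m,n]∣m 1 m) , ↭-refl

  order-α : IsOrd G α m
  order-α = 1≤m , α^m , λ j 1≤j e → ∣⇒≤ {{ℕ.>-nonZero 1≤j}} (R.⟨⟩≡0⇒∣ (φ-injective (≡.trans (φ-⟨⟩ j) (≡.trans e (sym φ-0)))))

  -- The square of α^c τ is α^n, of order 2, so α^c τ has order 4, which divides 2n only for even n.
  pow-m : 2 ∣ n → ∀ g → pow G g m ≡ ε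
  pow-m (divides q n≡) g with code g | ev-code g
  ... | inj₁ x | refl = ≡.trans (sym (φ-· m x)) (≡.trans (cong φ (order· x)) φ-0)
  ... | inj₂ c | refl = begin
    pow G (ψ c) (2 ℕ.* n)         ≡⟨ cong (pow G (ψ c)) (ℕₚ.*-comm 2 n) ⟩
    pow G (ψ c) (n ℕ.* 2)         ≡⟨ pow-* (ψ c) n 2 ⟩
    pow G (ψ c ∙ (ψ c ∙ ε)) n     ≡⟨ cong (λ h → pow G h n) (≡.trans (cong (ψ c ∙_) (Group.identityʳ Gr (ψ c))) (sym (ev-⊗ (inj₂ c) (inj₂ c)))) ⟩
    pow G (φ (c - c + ν)) n       ≡⟨ cong (λ y → pow G (φ y) n) (≡.trans (cong (_+ ν) (inverseʳ c)) (identityˡ ν)) ⟩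
    pow G (φ ν) n                 ≡⟨ φ-· n ν ⟨
    φ (n · ν)                     ≡⟨ cong φ (≡.trans (cong (_· ν) (≡.trans n≡ (ℕₚ.*-comm q 2))) (even-· q true)) ⟩
    φ 0#                          ≡⟨ φ-0 ⟩
    ε                             ∎
    where open ≡.≡-Reasoning

  order-divides : ∀ {g k e} → IsOrd G g k → pow G g e ≡ ε → k ∣ e
  order-divides {g} {k} {e} (1≤k , gk , least) ge = m%n≡0⇒n∣m e k (zero-remainder (e % k) refl)
    where
    instance
      k≢0 : NonZero k
      k≢0 = ℕ.>-nonZero 1≤k
    remainder : pow G g (e % k) ≡ ε
    remainder = begin
      pow G g (e % k)                                    ≡⟨ Group.identityʳ Gr _ ⟨
      pow G g (e % k) ∙ ε                                ≡⟨ cong (pow G g (e % k) ∙_) (pow-ε (e / k)) ⟨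
      pow G g (e % k) ∙ pow G ε (e / k)                  ≡⟨ cong (λ h → pow G g (e % k) ∙ pow G h (e / k)) gk ⟨
      pow G g (e % k) ∙ pow G (pow G g k) (e / k)        ≡⟨ cong (pow G g (e % k) ∙_) (pow-* g (e / k) k) ⟨
      pow G g (e % k) ∙ pow G g ((e / k) ℕ.* k)          ≡⟨ pow-+ g (e % k) ((e / k) ℕ.* k) ⟨
      pow G g (e % k ℕ.+ (e / k) ℕ.* k)                  ≡⟨ cong (pow G g) (m≡m%n+[m/n]*n e k) ⟨
      pow G g e                                          ≡⟨ ge ⟩
      ε                                                  ∎
      where open ≡.≡-Reasoning
    zero-remainder : ∀ r → e % k ≡ r → e % k ≡ 0
    zero-remainder zero    eq = eq
    zero-remainder (suc r) eq = ⊥-elim (ℕₚ.<-irrefl refl (ℕₚ.≤-trans (m%n<n e k)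
      (least (e % k) (ℕₚ.≤-trans (s≤s z≤n) (eq≥ eq)) remainder)))

  exponent : 2 ∣ n → ∀ {e} → IsExp G e → e ≡ m
  exponent 2∣n (divisible , least) = ∣-antisym (least m (λ g k o → order-divides o (pow-m 2∣n g))) (divisible α m order-α)

-- The quaternion group: classes modulo the centre.

module Quaternion (G : FinGroup) (order≡ : FinGroup.order G ≡ 4 ℕ.* 2)
  (α τ : FinGroup.Carrier G) (presentation : DicPresentation G 2 α τ) where
  open FinGroup G
  open Model G 2 order≡ α τ presentation
  open EvenGroup 𝔾 using (Z; _≟_; ν; 0#)
  open ManyOutside 𝔾 using (oddᵇ; nu; nu-xor; xor-cancel; module Parity)

  _≟ᶜ_ : DecidableEquality Code
  _≟ᶜ_ = Sumₚ.≡-dec _≟_ _≟_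

  -- The classes of G modulo its centre {1, z}.
  Class : Set
  Class = Bool × Bool

  _≟ᵏ_ : DecidableEquality Class
  _≟ᵏ_ = ≡-dec 𝔹._≟_ 𝔹._≟_

  0ᵏ : Class
  0ᵏ = false , false

  infixl 6 _+ᵏ_
  _+ᵏ_ : Class → Class → Class
  (a , b) +ᵏ (c , d) = a xor c , b xor d

  cl : Code → Class
  cl (inj₁ x) = false , oddᵇ (toℕ x)
  cl (inj₂ c) = true , oddᵇ (toℕ c)

  cen : Bool → Code
  cen b = inj₁ (nu b)

  all? : ∀ {P : Code → Set} → Decidable P → Dec (∀ g → P g)
  all? P? = map′ (λ { (p , q) (inj₁ x) → p x ; (p , q) (inj₂ x) → q x }) (λ f → (λ x → f (inj₁ x)) , (λ x → f (inj₂ x)))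
    (Finₚ.all? (λ x → P? (inj₁ x)) ×-dec Finₚ.all? (λ x → P? (inj₂ x)))

  allᵇ? : ∀ {P : Bool → Set} → Decidable P → Dec (∀ b → P b)
  allᵇ? P? = map′ (λ { (p , q) false → p ; (p , q) true → q }) (λ f → f false , f true) (P? false ×-dec P? true)

  allᵏ? : ∀ {P : Class → Set} → Decidable P → Dec (∀ k → P k)
  allᵏ? P? = map′ (λ f (a , b) → f a b) (λ f a b → f (a , b)) (allᵇ? λ a → allᵇ? λ b → P? (a , b))

  -- Two terms of the same class have a central product; the bit tells whether it is z. It plays the
  -- role that the multiple of ν has for pairs modulo n.
  bitp : Code × Code → Bool
  bitp (g , h) = does ((g ⊗ h) ≟ᶜ cen true)

  -- With eight codes and four classes, this and several of the following identities are finite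
  -- checks, settled by evaluating a decision procedure.
  cl-⊗ : ∀ g h → cl (g ⊗ h) ≡ cl g +ᵏ cl h
  cl-⊗ = from-yes (all? λ g → all? λ h → cl (g ⊗ h) ≟ᵏ (cl g +ᵏ cl h))

  central : ∀ g → cl g ≡ 0ᵏ → g ≢ cen false → g ≡ cen true
  central = from-yes (all? λ g → (cl g ≟ᵏ 0ᵏ) →-dec ((¬? (g ≟ᶜ cen false)) →-dec (g ≟ᶜ cen true)))

  pair-product : ∀ g h → cl g ≡ cl h → g ⊗ h ≡ cen (bitp (g , h))
  pair-product = from-yes (all? λ g → all? λ h → (cl g ≟ᵏ cl h) →-dec ((g ⊗ h) ≟ᶜ cen (bitp (g , h))))

  anticommute : ∀ g h → cl g ≢ 0ᵏ → cl h ≢ 0ᵏ → cl g ≢ cl h → h ⊗ g ≡ cen true ⊗ (g ⊗ h)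
  anticommute = from-yes (all? λ g → all? λ h → (¬? (cl g ≟ᵏ 0ᵏ)) →-dec ((¬? (cl h ≟ᵏ 0ᵏ)) →-dec ((¬? (cl g ≟ᵏ cl h)) →-dec
    ((h ⊗ g) ≟ᶜ (cen true ⊗ (g ⊗ h))))))

  -- The only other element in the class of g is g z, so the product changes by z.
  bitp-swapˡ : ∀ g r → cl g ≡ cl r → g ≢ r → ∀ h → cl g ≡ cl h → bitp (r , h) ≡ not (bitp (g , h))
  bitp-swapˡ = from-yes (all? λ g → all? λ r → (cl g ≟ᵏ cl r) →-dec ((¬? (g ≟ᶜ r)) →-dec (all? λ h → (cl g ≟ᵏ cl h) →-dec
    (bitp (r , h) 𝔹.≟ not (bitp (g , h))))))

  bitp-swapʳ : ∀ g r → cl g ≡ cl r → g ≢ r → ∀ h → cl g ≡ cl h → bitp (h , r) ≡ not (bitp (h , g))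
  bitp-swapʳ = from-yes (all? λ g → all? λ r → (cl g ≟ᵏ cl r) →-dec ((¬? (g ≟ᶜ r)) →-dec (all? λ h → (cl g ≟ᵏ cl h) →-dec
    (bitp (h , r) 𝔹.≟ not (bitp (h , g))))))

  bitp-central : ∀ g → cl g ≡ 0ᵏ → bitp (g , g) ≡ false
  bitp-central = from-yes (all? λ g → (cl g ≟ᵏ 0ᵏ) →-dec (bitp (g , g) 𝔹.≟ false))

  bitp-noncentral : ∀ g → cl g ≢ 0ᵏ → bitp (g , g) ≡ true
  bitp-noncentral = from-yes (all? λ g → (¬? (cl g ≟ᵏ 0ᵏ)) →-dec (bitp (g , g) 𝔹.≟ true))

  central-commutes : ∀ g → cl g ≡ 0ᵏ → ∀ h → g ⊗ h ≡ h ⊗ g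
  central-commutes = from-yes (all? λ g → (cl g ≟ᵏ 0ᵏ) →-dec (all? λ h → (g ⊗ h) ≟ᶜ (h ⊗ g)))

  -- The four elements of the Klein group add up to 0.
  four-classes : ∀ a b c d → a ≢ b → a ≢ c → a ≢ d → b ≢ c → b ≢ d → c ≢ d → a +ᵏ (b +ᵏ (c +ᵏ (d +ᵏ 0ᵏ))) ≡ 0ᵏ
  four-classes = from-yes (allᵏ? λ a → allᵏ? λ b → allᵏ? λ c → allᵏ? λ d → (¬? (a ≟ᵏ b)) →-dec ((¬? (a ≟ᵏ c)) →-dec ((¬? (a ≟ᵏ d)) →-dec
    ((¬? (b ≟ᵏ c)) →-dec ((¬? (b ≟ᵏ d)) →-dec ((¬? (c ≟ᵏ d)) →-dec ((a +ᵏ (b +ᵏ (c +ᵏ (d +ᵏ 0ᵏ)))) ≟ᵏ 0ᵏ)))))))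

  +ᵏ-assoc : ∀ a b c → (a +ᵏ b) +ᵏ c ≡ a +ᵏ (b +ᵏ c)
  +ᵏ-assoc (a , b) (c , d) (e , f) = cong₂ _,_ (𝔹.xor-assoc a c e) (𝔹.xor-assoc b d f)

  +ᵏ-comm : ∀ a b → a +ᵏ b ≡ b +ᵏ a
  +ᵏ-comm (a , b) (c , d) = cong₂ _,_ (𝔹.xor-comm a c) (𝔹.xor-comm b d)

  +ᵏ-self : ∀ a → a +ᵏ a ≡ 0ᵏ
  +ᵏ-self (a , b) = cong₂ _,_ (𝔹.xor-same a) (𝔹.xor-same b)

  ev-injective : ∀ {g h} → ev g ≡ ev h → g ≡ h
  ev-injective {g} {h} e = ≡.trans (sym (code-ev g)) (≡.trans (cong code e) (code-ev h))

  ⊗-assoc : ∀ g h k → (g ⊗ h) ⊗ k ≡ g ⊗ (h ⊗ k)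
  ⊗-assoc g h k = ev-injective (≡.trans (≡.trans (ev-⊗ (g ⊗ h) k) (cong (_∙ ev k) (ev-⊗ g h)))
    (≡.trans (IsGroup.assoc isGroup _ _ _) (sym (≡.trans (ev-⊗ g (h ⊗ k)) (cong (ev g ∙_) (ev-⊗ h k))))))

  cen-xor : ∀ a b → cen a ⊗ cen b ≡ cen (a xor b)
  cen-xor a b = cong inj₁ (sym (nu-xor a b))

  cen-false : ∀ g → cen false ⊗ g ≡ g
  cen-false = from-yes (all? λ g → (cen false ⊗ g) ≟ᶜ g)

  prodC : List Code → Code
  prodC []      = cen false
  prodC (g ∷ L) = g ⊗ prodC L

  clsum : List Code → Class
  clsum []      = 0ᵏ
  clsum (g ∷ L) = cl g +ᵏ clsum L

  cl-prodC : ∀ L → cl (prodC L) ≡ clsum L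
  cl-prodC []      = refl
  cl-prodC (g ∷ L) = ≡.trans (cl-⊗ g (prodC L)) (cong (cl g +ᵏ_) (cl-prodC L))

  +ᵏ-swap : ∀ a b c → a +ᵏ (b +ᵏ c) ≡ b +ᵏ (a +ᵏ c)
  +ᵏ-swap a b c = ≡.trans (sym (+ᵏ-assoc a b c)) (≡.trans (cong (_+ᵏ c) (+ᵏ-comm a b)) (+ᵏ-assoc b a c))

  clsum-↭ : ∀ {L L′} → L ↭ L′ → clsum L ≡ clsum L′
  clsum-↭ _↭_.refl   = refl
  clsum-↭ (prep g p) = cong (cl g +ᵏ_) (clsum-↭ p)
  clsum-↭ {_ ∷ _ ∷ L} {_ ∷ _ ∷ L′} (swap g h p) =
    ≡.trans (cong (λ k → cl g +ᵏ (cl h +ᵏ k)) (clsum-↭ p)) (+ᵏ-swap (cl g) (cl h) (clsum L′))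
  clsum-↭ (trans p q) = ≡.trans (clsum-↭ p) (clsum-↭ q)

  flatC : List (Code × Code) → List Code
  flatC []            = []
  flatC ((g , h) ∷ P) = g ∷ h ∷ flatC P

  flatC-↭ : ∀ {P P′} → P ↭ P′ → flatC P ↭ flatC P′
  flatC-↭ _↭_.refl   = ↭-refl
  flatC-↭ (prep _ p) = prep _ (prep _ (flatC-↭ p))
  flatC-↭ {(a , b) ∷ (c , d) ∷ P} {_ ∷ _ ∷ P′} (swap _ _ p) = ↭-trans (prep _ (prep _ (prep _ (prep _ (flatC-↭ p)))))
    (P.shifts (a ∷ b ∷ []) (c ∷ d ∷ []))
  flatC-↭ (trans p q) = ↭-trans (flatC-↭ p) (flatC-↭ q)

  flatC-++ : ∀ P P′ → flatC (P ++ P′) ≡ flatC P ++ flatC P′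
  flatC-++ []      P′ = refl
  flatC-++ (_ ∷ P) P′ = cong (λ X → _ ∷ _ ∷ X) (flatC-++ P P′)

  flatC-≼ : ∀ {P P′} → P ≼ P′ → flatC P ≼ flatC P′
  flatC-≼ {P} (R , p) = flatC R , ↭-trans (flatC-↭ p) (↭-reflexive (flatC-++ P R))

  length-flatC : ∀ P → length (flatC P) ≡ 2 ℕ.* length P
  length-flatC []      = refl
  length-flatC (_ ∷ P) = ≡.trans (cong (λ k → suc (suc k)) (length-flatC P)) (double-suc (length P))

  flatC-replicate : ∀ k u → flatC (replicate k (u , u)) ≡ replicate (2 ℕ.* k) u
  flatC-replicate zero    u = refl
  flatC-replicate (suc k) u = ≡.trans (cong (λ X → u ∷ u ∷ X) (flatC-replicate k u)) (cong (λ k → replicate k u) (double-suc k))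

  Same : Code × Code → Set
  Same (g , h) = cl g ≡ cl h

  open Parity bitp

  clsum-flatC : ∀ {P} → All Same P → clsum (flatC P) ≡ 0ᵏ
  clsum-flatC [] = refl
  clsum-flatC {(g , h) ∷ P} (e ∷ es) = ≡.trans (sym (+ᵏ-assoc (cl g) (cl h) _))
    (≡.trans (cong₂ _+ᵏ_ (≡.trans (cong (_+ᵏ cl h) e) (+ᵏ-self (cl h))) (clsum-flatC es)) refl)

  prodC-flatC : ∀ {P} → All Same P → prodC (flatC P) ≡ cen (parity P)
  prodC-flatC [] = refl
  prodC-flatC {(g , h) ∷ P} (e ∷ es) = ≡.trans (sym (⊗-assoc g h _))
    (≡.trans (cong₂ _⊗_ (pair-product g h e) (prodC-flatC es)) (cen-xor (bitp (g , h)) (parity P)))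

  POC : ℕ → List Code → Set
  POC M L = ∃ λ T → T ≼ L × length T ≡ M × ∃ λ T′ → T ↭ T′ × prodC T′ ≡ cen false

  -- Exchanging two neighbouring terms that do not commute changes the sign of a central product.
  win-swap : ∀ {M L T} g h T″ → T ≼ L → length T ≡ M → clsum T ≡ 0ᵏ → T ↭ g ∷ h ∷ T″ →
    cl g ≢ 0ᵏ → cl h ≢ 0ᵏ → cl g ≢ cl h → POC M L
  win-swap {M} {L} {T} g h T″ s len e p g≢0 h≢0 g≢h with prodC (g ∷ h ∷ T″) ≟ᶜ cen false
  ... | yes one = T , s , len , g ∷ h ∷ T″ , p , one
  ... | no ¬one = T , s , len , h ∷ g ∷ T″ , ↭-trans p (swap g h ↭-refl) , (begin
      h ⊗ (g ⊗ prodC T″)                    ≡⟨ ⊗-assoc h g _ ⟨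
      (h ⊗ g) ⊗ prodC T″                    ≡⟨ cong (_⊗ prodC T″) (anticommute g h g≢0 h≢0 g≢h) ⟩
      (cen true ⊗ (g ⊗ h)) ⊗ prodC T″       ≡⟨ ⊗-assoc (cen true) (g ⊗ h) _ ⟩
      cen true ⊗ ((g ⊗ h) ⊗ prodC T″)       ≡⟨ cong (cen true ⊗_) (⊗-assoc g h _) ⟩
      cen true ⊗ prodC (g ∷ h ∷ T″)         ≡⟨ cong (cen true ⊗_) (central _ (≡.trans (cl-prodC (g ∷ h ∷ T″)) (≡.trans (sym (clsum-↭ p)) e)) ¬one) ⟩
      cen true ⊗ cen true                   ≡⟨ cen-xor true true ⟩
      cen false                             ∎)
    where open ≡.≡-Reasoning

  two-out : ∀ {A : Set} {g h : A} {T : List A} → g ∈ T → h ∈ T → g ≢ h → ∃ λ T″ → T ↭ g ∷ h ∷ T″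
  two-out g∈ h∈ g≢h with ∈⇒↭ g∈
  ... | T₁ , p with P.∈-resp-↭ p h∈
  ... | here e = ⊥-elim (g≢h (sym e))
  ... | there i with ∈⇒↭ i
  ... | T″ , q = T″ , ↭-trans p (prep _ q)

  win-noncommuting : ∀ {M L T} g h → T ≼ L → length T ≡ M → clsum T ≡ 0ᵏ → g ∈ T → h ∈ T →
    cl g ≢ 0ᵏ → cl h ≢ 0ᵏ → cl g ≢ cl h → POC M L
  win-noncommuting g h s len e g∈ h∈ g≢0 h≢0 g≢h with two-out g∈ h∈ (λ { refl → g≢h refl })
  ... | T″ , p = win-swap g h T″ s len e p g≢0 h≢0 g≢h

  Distinct : List Code → Set
  Distinct = AllPairs (λ g h → cl g ≢ cl h)

  -- The classes of the four terms cancel, so the whole product is central; two of the first three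
  -- terms lie in different noncentral classes and do not commute.
  win-four : ∀ {K L} f₁ f₂ f₃ f₄ P → Distinct (f₁ ∷ f₂ ∷ f₃ ∷ f₄ ∷ []) → All Same P → 2 ℕ.+ length P ≡ K →
    f₁ ∷ f₂ ∷ f₃ ∷ f₄ ∷ flatC P ≼ L → POC (2 ℕ.* K) L
  win-four {K} {L} f₁ f₂ f₃ f₄ P ((d₁₂ ∷ d₁₃ ∷ d₁₄ ∷ []) ∷ (d₂₃ ∷ d₂₄ ∷ []) ∷ (d₃₄ ∷ []) ∷ _) same len s =
    choose (cl f₁ ≟ᵏ 0ᵏ) (cl f₂ ≟ᵏ 0ᵏ)
    where
    lem : ∀ p → 4 ℕ.+ 2 ℕ.* p ≡ 2 ℕ.* (2 ℕ.+ p)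
    lem = solve-∀
    len′ : 4 ℕ.+ length (flatC P) ≡ 2 ℕ.* K
    len′ = ≡.trans (cong (4 ℕ.+_) (length-flatC P)) (≡.trans (lem (length P)) (cong (2 ℕ.*_) len))
    sum0 : clsum (f₁ ∷ f₂ ∷ f₃ ∷ f₄ ∷ flatC P) ≡ 0ᵏ
    sum0 = ≡.trans (cong (λ k → cl f₁ +ᵏ (cl f₂ +ᵏ (cl f₃ +ᵏ (cl f₄ +ᵏ k)))) (clsum-flatC same)) (four-classes _ _ _ _ d₁₂ d₁₃ d₁₄ d₂₃ d₂₄ d₃₄)
    choose : Dec (cl f₁ ≡ 0ᵏ) → Dec (cl f₂ ≡ 0ᵏ) → POC (2 ℕ.* K) L
    choose (yes e) _ = win-noncommuting f₂ f₃ s len′ sum0 (there (here refl)) (there (there (here refl)))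
      (λ e′ → d₁₂ (≡.trans e (sym e′))) (λ e′ → d₁₃ (≡.trans e (sym e′))) d₂₃
    choose (no n₁) (yes e) = win-noncommuting f₁ f₃ s len′ sum0 (here refl) (there (there (here refl))) n₁ (λ e′ → d₂₃ (≡.trans e (sym e′))) d₁₃
    choose (no n₁) (no n₂) = win-noncommuting f₁ f₂ s len′ sum0 (here refl) (there (here refl)) n₁ n₂ d₁₂

  pair-classes : ∀ L → ∃₂ λ P R → L ↭ flatC P ++ R × All Same P × Distinct R
  pair-classes []      = [] , [] , ↭-refl , [] , []
  pair-classes (g ∷ L) with pair-classes L
  ... | P , R , p , same , d with All.all? (λ r → ¬? (cl g ≟ᵏ cl r)) R
  ... | yes all = P , g ∷ R , ↭-trans (prep g p) (↭-sym (P.shift g (flatC P) R)) , same , all ∷ d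
  ... | no ¬all with find (Allₚ.¬All⇒Any¬ (λ r → ¬? (cl g ≟ᵏ cl r)) R ¬all)
  ... | r , r∈ , ¬¬e with ∈⇒↭ r∈ | cl g ≟ᵏ cl r
  ... | R′ , q | no ne = ⊥-elim (¬¬e ne)
  ... | R′ , q | yes e = (g , r) ∷ P , R′ , prep g (↭-trans p (↭-trans (P.++⁺ˡ (flatC P) q) (P.shift r (flatC P) R′)))
      , e ∷ same , tail (distinct-↭ q d)
    where
    tail : ∀ {x X} → Distinct (x ∷ X) → Distinct X
    tail (_ ∷ d) = d
    distinct-↭ : ∀ {X Y} → X ↭ Y → Distinct X → Distinct Y
    distinct-↭ _↭_.refl d = d
    distinct-↭ (prep x p) (a ∷ d) = P.All-resp-↭ p a ∷ distinct-↭ p d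
    distinct-↭ (swap x y p) ((n ∷ a) ∷ b ∷ d) = ((λ e → n (sym e)) ∷ P.All-resp-↭ p b) ∷ P.All-resp-↭ p a ∷ distinct-↭ p d
    distinct-↭ (trans p q) d = distinct-↭ q (distinct-↭ p d)

  distinct-length : ∀ {R} → Distinct R → length R ≤ 4
  distinct-length {[]} _ = z≤n
  distinct-length {_ ∷ []} _ = s≤s z≤n
  distinct-length {_ ∷ _ ∷ []} _ = s≤s (s≤s z≤n)
  distinct-length {_ ∷ _ ∷ _ ∷ []} _ = s≤s (s≤s (s≤s z≤n))
  distinct-length {_ ∷ _ ∷ _ ∷ _ ∷ []} _ = s≤s (s≤s (s≤s (s≤s z≤n)))
  distinct-length {a ∷ b ∷ c ∷ d ∷ e ∷ _} ((ab ∷ ac ∷ ad ∷ ae ∷ _) ∷ (bc ∷ bd ∷ be ∷ _) ∷ (cd ∷ ce ∷ _) ∷ (de ∷ _) ∷ _) =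
    ⊥-elim (de (cancel-sum (cl a) (cl b) (cl c) (cl d) (cl e) (≡.trans (four-classes _ _ _ _ ab ac ad bc bd cd) (sym (four-classes _ _ _ _ ab ac ae bc be ce)))))
    where
    cancelˡ : ∀ a {b c} → a +ᵏ b ≡ a +ᵏ c → b ≡ c
    cancelˡ a {b} {c} e = ≡.trans (sym (≡.trans (sym (+ᵏ-assoc a a b)) (cong (_+ᵏ b) (+ᵏ-self a))))
      (≡.trans (cong (a +ᵏ_) e) (≡.trans (sym (+ᵏ-assoc a a c)) (cong (_+ᵏ c) (+ᵏ-self a))))
    cancel-sum : ∀ a b c d e → a +ᵏ (b +ᵏ (c +ᵏ (d +ᵏ 0ᵏ))) ≡ a +ᵏ (b +ᵏ (c +ᵏ (e +ᵏ 0ᵏ))) → d ≡ e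
    cancel-sum a b c d e eq = ≡.trans (sym (≡.trans (+ᵏ-comm d 0ᵏ) refl)) (≡.trans (cancelˡ c (cancelˡ b (cancelˡ a eq))) (≡.trans (+ᵏ-comm e 0ᵏ) refl))

  module _ (K : ℕ) (2≤K : 2 ≤ K) (even : oddᵇ K ≡ false) where

    win-even : ∀ {L P} → flatC P ≼ L → All Same P → length P ≡ K → parity P ≡ false → POC (2 ℕ.* K) L
    win-even {L} {P} s same len e = flatC P , s , ≡.trans (length-flatC P) (cong (2 ℕ.*_) len) , flatC P , ↭-refl
      , ≡.trans (prodC-flatC same) (cong cen e)

    all-≼ : ∀ {P P′} → P ≼ P′ → All Same P′ → All Same P
    all-≼ s same = All.tabulate (λ i → All.lookup same (≼-∈ s i))

    win-many : ∀ {L P} → flatC P ≼ L → All Same P → suc K ≤ length P → POC (2 ℕ.* K) L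
    win-many {L} {P} s same K< with drop-odd (take (suc K) P) (≡.trans (cong oddᵇ (length-take≤ (suc K) P K<)) (cong not even))
    ... | i , P′ , p , e = win-even (≼-trans (flatC-≼ P′≼) s) (all-≼ P′≼ same)
        (ℕₚ.suc-injective (≡.trans (sym (P.↭-length p)) (length-take≤ (suc K) P K<))) e
      where
      P′≼ : P′ ≼ P
      P′≼ = ≼-trans (≼-respʳ (↭-sym p) (≼-++ʳ [ i ] P′)) (≼-take (suc K) P)

    rest-take : ∀ {P : List (Code × Code)} → K ≤ suc (suc (length P)) → 2 ℕ.+ length (take (K ℕ.∸ 2) P) ≡ K
    rest-take {P} le = ≡.trans (cong (2 ℕ.+_) (length-take≤ (K ℕ.∸ 2) P (ℕₚ.∸-monoˡ-≤ 2 le))) (ℕₚ.m+[n∸m]≡n 2≤K)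

    -- At most four terms stay unpaired. So there are more than K pairs, or exactly K together with
    -- one unpaired term of every class; these four terms then replace two pairs.
    forced₂ : ∀ L → length L ≡ 2 ℕ.* K ℕ.+ 4 → POC (2 ℕ.* K) L
    forced₂ L len with pair-classes L
    ... | P , R , p , same , d with suc K ℕ.≤? length P
    ... | yes K< = win-many (≼-respʳ (↭-sym p) (≼-++ˡ (flatC P) R)) same K<
    ... | no K≮ = go R d p (≡.trans (sym (≡.trans (P.↭-length p) (≡.trans (Lₚ.length-++ (flatC P)) (cong (ℕ._+ length R) (length-flatC P))))) len)
      where
      P≤ : length P ≤ K
      P≤ = ℕₚ.≤-pred (ℕₚ.≰⇒> K≮)
      R≥4 : ∀ r → 2 ℕ.* length P ℕ.+ r ≡ 2 ℕ.* K ℕ.+ 4 → 4 ≤ r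
      R≥4 r e = comb 0 (P≤ ⊹ P≤ ⊹ eq≥ e) (lem (length P) r K)
        where
        lem : ∀ p r K → 4 ℕ.+ (K ℕ.+ K ℕ.+ (2 ℕ.* p ℕ.+ r)) ℕ.+ 0 ≡ r ℕ.+ (p ℕ.+ p ℕ.+ (2 ℕ.* K ℕ.+ 4))
        lem = solve-∀
      short : ∀ {r} → r < 4 → 2 ℕ.* length P ℕ.+ r ≡ 2 ℕ.* K ℕ.+ 4 → ⊥
      short r< e = ℕₚ.<-irrefl refl (ℕₚ.≤-trans r< (R≥4 _ e))
      go : ∀ R → Distinct R → L ↭ flatC P ++ R → 2 ℕ.* length P ℕ.+ length R ≡ 2 ℕ.* K ℕ.+ 4 → POC (2 ℕ.* K) L
      go [] d p e = ⊥-elim (short (s≤s z≤n) e)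
      go (_ ∷ []) d p e = ⊥-elim (short (s≤s (s≤s z≤n)) e)
      go (_ ∷ _ ∷ []) d p e = ⊥-elim (short (s≤s (s≤s (s≤s z≤n))) e)
      go (_ ∷ _ ∷ _ ∷ []) d p e = ⊥-elim (short (s≤s (s≤s (s≤s (s≤s z≤n)))) e)
      go (_ ∷ _ ∷ _ ∷ _ ∷ _ ∷ _) d p e = ⊥-elim (ℕₚ.<-irrefl refl (ℕₚ.≤-trans (s≤s (s≤s (s≤s (s≤s (s≤s z≤n))))) (distinct-length d)))
      go (a ∷ b ∷ c ∷ e ∷ []) d p eq = win-four a b c e (take (K ℕ.∸ 2) P) d (all-≼ (≼-take _ P) same)
        (rest-take {P} (ℕₚ.≤-trans (eq≤ (sym P≡K)) (ℕₚ.≤-trans (ℕₚ.n≤1+n _) (ℕₚ.n≤1+n _))))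
        (≼-respʳ (↭-sym (↭-trans p (P.++-comm (flatC P) _))) (≼-++⁺ {X = a ∷ b ∷ c ∷ e ∷ []} ≼-refl (flatC-≼ (≼-take (K ℕ.∸ 2) P))))
        where
        P≡K : length P ≡ K
        P≡K = ℕₚ.*-cancelˡ-≡ _ _ 2 (ℕₚ.+-cancelʳ-≡ 4 _ _ eq)

    -- x is central with x² = 1, and c² = z. The condition that j is odd says that the K pairs
    -- multiply to z^j = z.
    Shape₂ : List Code → Set
    Shape₂ L = ∃ λ x → ∃₂ λ c d → ∃₂ λ i j → cl x ≡ 0ᵏ × cl c ≢ 0ᵏ × cl d ≢ 0ᵏ × cl c ≢ cl d × i ℕ.+ j ≡ K × oddᵇ j ≡ true ×
      L ↭ replicate (suc (2 ℕ.* i)) x ++ replicate (suc (2 ℕ.* j)) c ++ [ d ]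

    sort₃ : ∀ {u v w : Code} P → All (λ q → q ≡ (u , u) ⊎ q ≡ (v , v) ⊎ q ≡ (w , w)) P →
      ∃ λ i → ∃₂ λ j k → P ↭ replicate i (u , u) ++ replicate j (v , v) ++ replicate k (w , w)
    sort₃ [] [] = 0 , 0 , 0 , ↭-refl
    sort₃ {u} {v} {w} (q ∷ P) (e ∷ es) with sort₃ P es
    ... | i , j , k , p = place e
      where
      U = replicate i (u , u)
      V = replicate j (v , v)
      place : q ≡ (u , u) ⊎ q ≡ (v , v) ⊎ q ≡ (w , w) → _
      place (inj₁ refl)        = suc i , j , k , prep _ p
      place (inj₂ (inj₁ refl)) = i , suc j , k , ↭-trans (prep _ p) (↭-sym (P.shift _ U (V ++ replicate k (w , w))))
      place (inj₂ (inj₂ refl)) = i , j , suc k , ↭-trans (prep _ p) (↭-trans (↭-sym (P.shift _ U (V ++ replicate k (w , w)))) (P.++⁺ˡ U (↭-sym (P.shift _ V (replicate k (w , w))))))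

    module Three (L : List Code) (P : List (Code × Code)) (same : All Same P) (|P| : length P ≡ K) where

      win-P : ∀ {R g h} → L ↭ flatC P ++ R → g ∈ flatC P → h ∈ flatC P → cl g ≢ 0ᵏ → cl h ≢ 0ᵏ → cl g ≢ cl h → POC (2 ℕ.* K) L
      win-P {R} {g} {h} p = win-noncommuting g h (≼-respʳ (↭-sym p) (≼-++ˡ (flatC P) R)) (≡.trans (length-flatC P) (cong (2 ℕ.*_) |P|)) (clsum-flatC same)

      Result : Set
      Result = POC (2 ℕ.* K) L ⊎ Shape₂ L

      count-parity : ∀ x c i j → cl x ≡ 0ᵏ → cl c ≢ 0ᵏ → parity (replicate i (x , x) ++ replicate j (c , c)) ≡ oddᵇ j
      count-parity x c i j x0 c≢0 = ≡.trans (parity-++ (replicate i (x , x)) _) (≡.trans (cong₂ _xor_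
          (≡.trans (parity-constant {b = false} {Q = replicate i (x , x)} (Allₚ.replicate⁺ i (bitp-central x x0))) (𝔹.∧-zeroʳ _))
          (parity-constant {b = true} {Q = replicate j (c , c)} (Allₚ.replicate⁺ j (bitp-noncentral c c≢0))))
        (≡.trans (𝔹.∧-identityʳ _) (cong oddᵇ (Lₚ.length-replicate j))))

      shape : ∀ x c d i j → cl x ≡ 0ᵏ → cl c ≢ 0ᵏ → cl d ≢ 0ᵏ → cl c ≢ cl d → parity P ≡ true →
        P ↭ replicate i (x , x) ++ replicate j (c , c) → L ↭ flatC P ++ x ∷ c ∷ d ∷ [] → Shape₂ L
      shape x c d i j x0 c≢0 d≢0 c≢d odd q p = x , c , d , i , j , x0 , c≢0 , d≢0 , c≢d
        , ≡.trans (sym (≡.trans (P.↭-length q) (≡.trans (Lₚ.length-++ (replicate i (x , x))) (cong₂ ℕ._+_ (Lₚ.length-replicate i) (Lₚ.length-replicate j))))) |P|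
        , ≡.trans (sym (count-parity x c i j x0 c≢0)) (≡.trans (sym (parity-↭ q)) odd)
        , ↭-trans p (↭-trans (P.++⁺ʳ (x ∷ c ∷ d ∷ []) (↭-trans (flatC-↭ q) (↭-reflexive (≡.trans (flatC-++ (replicate i (x , x)) _)
            (cong₂ _++_ (flatC-replicate i x) (flatC-replicate j c))))))
          (psolve 5 (λ a b x c d → (a ⊕ b) ⊕ (x ⊕ (c ⊕ d)) ⊜ (x ⊕ a) ⊕ ((c ⊕ b) ⊕ d)) ↭-refl (replicate (2 ℕ.* i) x) (replicate (2 ℕ.* j) c) [ x ] [ c ] [ d ]))

      ∈-flat : ∀ {g : Code} {Q} → (g , g) ∈ Q → g ∈ flatC Q
      ∈-flat (here refl) = here refl
      ∈-flat (there i)   = there (there (∈-flat i))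

      -- K pairs (g, g) with g noncentral multiply to z^K, which is 1 because K is even.
      one-class : parity P ≡ true → ∀ k g → cl g ≢ 0ᵏ → P ↭ replicate k (g , g) → ⊥
      one-class odd k g g≢0 q with ≡.trans (sym odd) (≡.trans (parity-↭ q) (≡.trans (parity-constant {b = true} {Q = replicate k (g , g)} (Allₚ.replicate⁺ k (bitp-noncentral g g≢0)))
        (≡.trans (𝔹.∧-identityʳ _) (≡.trans (cong oddᵇ (≡.trans (sym (P.↭-length q)) |P|)) even))))
      ... | ()

      -- Pairs from two noncentral classes win by exchanging neighbours. Otherwise only one
      -- noncentral class occurs among the pairs, next to the central one: this is the shape if u is
      -- central and contradicts `one-class` if not.
      sorted : ∀ u v w i j k → P ↭ replicate i (u , u) ++ replicate j (v , v) ++ replicate k (w , w) → parity P ≡ true →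
        L ↭ flatC P ++ u ∷ v ∷ w ∷ [] → Distinct (u ∷ v ∷ w ∷ []) → cl v ≢ 0ᵏ → cl w ≢ 0ᵏ → Result
      sorted u v w i (suc j) (suc k) q odd p ((_ ∷ _) ∷ (vw ∷ []) ∷ _) v≢0 w≢0 = inj₁ (win-P p
        (∈-flat (P.∈-resp-↭ (↭-sym q) (∈-++⁺ʳ (replicate i (u , u)) (here refl))))
        (∈-flat (P.∈-resp-↭ (↭-sym q) (∈-++⁺ʳ (replicate i (u , u)) (∈-++⁺ʳ (replicate (suc j) (v , v)) (here refl))))) v≢0 w≢0 vw)
      sorted u v w i j k q odd p ((uv ∷ uw ∷ []) ∷ (vw ∷ []) ∷ _) v≢0 w≢0 with cl u ≟ᵏ 0ᵏ
      sorted u v w i zero k q odd p ((uv ∷ uw ∷ []) ∷ (vw ∷ []) ∷ _) v≢0 w≢0 | yes u0 =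
        inj₂ (shape u w v i k u0 w≢0 v≢0 (λ e → vw (sym e)) odd q (↭-trans p (P.++⁺ˡ (flatC P) (prep u (swap v w ↭-refl)))))
      sorted u v w i (suc j) zero q odd p ((uv ∷ uw ∷ []) ∷ (vw ∷ []) ∷ _) v≢0 w≢0 | yes u0 =
        inj₂ (shape u v w i (suc j) u0 v≢0 w≢0 vw odd (↭-trans q (↭-reflexive (cong (replicate i (u , u) ++_) (Lₚ.++-identityʳ _)))) p)
      sorted u v w i (suc j) (suc k) q odd p ((uv ∷ uw ∷ []) ∷ (vw ∷ []) ∷ _) v≢0 w≢0 | yes u0 = inj₁ (win-P p
        (∈-flat (P.∈-resp-↭ (↭-sym q) (∈-++⁺ʳ (replicate i (u , u)) (here refl))))
        (∈-flat (P.∈-resp-↭ (↭-sym q) (∈-++⁺ʳ (replicate i (u , u)) (∈-++⁺ʳ (replicate (suc j) (v , v)) (here refl))))) v≢0 w≢0 vw)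
      sorted u v w (suc i) (suc j) k q odd p ((uv ∷ uw ∷ []) ∷ (vw ∷ []) ∷ _) v≢0 w≢0 | no u≢0 = inj₁ (win-P p
        (∈-flat (P.∈-resp-↭ (↭-sym q) (here refl)))
        (∈-flat (P.∈-resp-↭ (↭-sym q) (∈-++⁺ʳ (replicate (suc i) (u , u)) (here refl)))) u≢0 v≢0 uv)
      sorted u v w (suc i) zero (suc k) q odd p ((uv ∷ uw ∷ []) ∷ (vw ∷ []) ∷ _) v≢0 w≢0 | no u≢0 = inj₁ (win-P p
        (∈-flat (P.∈-resp-↭ (↭-sym q) (here refl)))
        (∈-flat (P.∈-resp-↭ (↭-sym q) (∈-++⁺ʳ (replicate (suc i) (u , u)) (here refl)))) u≢0 w≢0 uw)
      sorted u v w zero (suc j) (suc k) q odd p ((uv ∷ uw ∷ []) ∷ (vw ∷ []) ∷ _) v≢0 w≢0 | no u≢0 = inj₁ (win-P p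
        (∈-flat (P.∈-resp-↭ (↭-sym q) (here refl)))
        (∈-flat (P.∈-resp-↭ (↭-sym q) (∈-++⁺ʳ (replicate (suc j) (v , v)) (here refl)))) v≢0 w≢0 vw)
      sorted u v w (suc i) zero zero q odd p _ v≢0 w≢0 | no u≢0 =
        ⊥-elim (one-class odd (suc i) u u≢0 (↭-trans q (↭-reflexive (Lₚ.++-identityʳ _))))
      sorted u v w zero (suc j) zero q odd p _ v≢0 w≢0 | no u≢0 =
        ⊥-elim (one-class odd (suc j) v v≢0 (↭-trans q (↭-reflexive (Lₚ.++-identityʳ _))))
      sorted u v w zero zero k q odd p _ v≢0 w≢0 | no u≢0 = ⊥-elim (one-class odd k w w≢0 q)

      Equal : Code → Code → Code → Code × Code → Set
      Equal u v w q = q ≡ (u , u) ⊎ q ≡ (v , v) ⊎ q ≡ (w , w)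

      equal? : ∀ u v w → Decidable (Equal u v w)
      equal? u v w q with ≡-dec _≟ᶜ_ _≟ᶜ_ q (u , u) | ≡-dec _≟ᶜ_ _≟ᶜ_ q (v , v) | ≡-dec _≟ᶜ_ _≟ᶜ_ q (w , w)
      ... | yes e | _ | _ = yes (inj₁ e)
      ... | no _ | yes e | _ = yes (inj₂ (inj₁ e))
      ... | no _ | no _ | yes e = yes (inj₂ (inj₂ e))
      ... | no a | no b | no c = no λ { (inj₁ e) → a e ; (inj₂ (inj₁ e)) → b e ; (inj₂ (inj₂ e)) → c e }

      -- A term of an odd class that differs from the unpaired term of that class may replace it in its pair.
      replace : ∀ {r R′} g h P′ → P ↭ (g , h) ∷ P′ → L ↭ flatC P ++ r ∷ R′ → cl g ≡ cl r → parity P ≡ true →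
        (g , h) ≢ (r , r) → POC (2 ℕ.* K) L
      replace {r} {R′} g h P′ q p e odd ne = choose (g ≟ᶜ r) (h ≟ᶜ r)
        where
        all′ : All Same ((g , h) ∷ P′)
        all′ = P.All-resp-↭ q same
        gh : cl g ≡ cl h
        gh = All.head all′
        L↭ : flatC P ++ r ∷ R′ ↭ L
        L↭ = ↭-sym p
        |P′| : suc (length P′) ≡ K
        |P′| = ≡.trans (sym (P.↭-length q)) |P|
        flip : ∀ {a a′} → a′ ≡ not a → a xor parity P′ ≡ true → a′ xor parity P′ ≡ false
        flip {false} refl odd′ = cong not odd′
        flip {true}  refl odd′ = ≡.trans (sym (𝔹.not-involutive _)) (cong not odd′)
        odd′ : bitp (g , h) xor parity P′ ≡ true
        odd′ = ≡.trans (sym (parity-↭ q)) odd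
        choose : Dec (g ≡ r) → Dec (h ≡ r) → POC (2 ℕ.* K) L
        choose (yes refl) (yes refl) = ⊥-elim (ne refl)
        choose (no g≢r) _ = win-even {P = (r , h) ∷ P′} (≼-respʳ L↭ (≼-respˡ (P.++-comm (flatC P′) (r ∷ h ∷ []))
            (≼-respʳ (↭-trans (psolve 5 (λ g h f r t → (f ⊕ (r ⊕ h)) ⊕ (g ⊕ t) ⊜ (g ⊕ (h ⊕ f)) ⊕ (r ⊕ t)) ↭-refl [ g ] [ h ] (flatC P′) [ r ] R′)
              (P.++⁺ʳ (r ∷ R′) (flatC-↭ (↭-sym q)))) (≼-++ˡ (flatC P′ ++ r ∷ h ∷ []) (g ∷ R′)))))
            (≡.trans (sym e) gh ∷ All.tail all′) |P′| (flip (bitp-swapˡ g r e g≢r h gh) odd′)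
        choose (yes refl) (no h≢r) = win-even {P = (g , r) ∷ P′} (≼-respʳ L↭ (≼-respˡ (P.++-comm (flatC P′) (g ∷ r ∷ []))
            (≼-respʳ (↭-trans (psolve 5 (λ g h f r t → (f ⊕ (g ⊕ r)) ⊕ (h ⊕ t) ⊜ (g ⊕ (h ⊕ f)) ⊕ (r ⊕ t)) ↭-refl [ g ] [ h ] (flatC P′) [ r ] R′)
              (P.++⁺ʳ (r ∷ R′) (flatC-↭ (↭-sym q)))) (≼-++ˡ (flatC P′ ++ g ∷ r ∷ []) (h ∷ R′)))))
            (refl ∷ All.tail all′) |P′| (flip (bitp-swapʳ h r (sym gh) h≢r g (sym gh)) odd′)

      -- A pair other than (u, u), (v, v), (w, w) always helps: if its class is that of an unpaired
      -- term, that term can be exchanged into the pair and flips its bit; if not, all four classes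
      -- are present. Without such a pair, the central class, if it occurs, is moved to the front
      -- for `sorted`.
      three : ∀ u v w → L ↭ flatC P ++ u ∷ v ∷ w ∷ [] → Distinct (u ∷ v ∷ w ∷ []) → parity P ≡ true → Result
      three u v w p d@((uv ∷ uw ∷ []) ∷ (vw ∷ []) ∷ _) odd with All.all? (equal? u v w) P
      ... | no ¬all with find (Allₚ.¬All⇒Any¬ (equal? u v w) P ¬all)
      ... | (g , h) , q∈ , ne with ∈⇒↭ q∈
      ... | P′ , q with cl g ≟ᵏ cl u | cl g ≟ᵏ cl v | cl g ≟ᵏ cl w
      ... | yes e | _ | _ = inj₁ (replace g h P′ q p e odd (λ e → ne (inj₁ e)))
      ... | no _ | yes e | _ = inj₁ (replace g h P′ q (↭-trans p (P.++⁺ˡ (flatC P) (swap u v ↭-refl))) e odd (λ e → ne (inj₂ (inj₁ e))))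
      ... | no _ | no _ | yes e = inj₁ (replace g h P′ q (↭-trans p (P.++⁺ˡ (flatC P) (P.shift w (u ∷ v ∷ []) []))) e odd (λ e → ne (inj₂ (inj₂ e))))
      ... | no gu | no gv | no gw = inj₁ (win-four g u v w (take (K ℕ.∸ 2) P′) ((gu ∷ gv ∷ gw ∷ []) ∷ d)
            (All.tabulate (λ i → All.lookup (All.tail (P.All-resp-↭ q same)) (≼-∈ (≼-take (K ℕ.∸ 2) P′) i)))
            (rest-take {P′} (ℕₚ.≤-trans (eq≤ (≡.trans (sym |P|) (P.↭-length q))) (ℕₚ.n≤1+n _)))
            (≼-respʳ (↭-sym (↭-trans p (P.++-comm (flatC P) _))) (≼-respˡ (P.shift g (u ∷ v ∷ w ∷ []) (flatC (take (K ℕ.∸ 2) P′))) (≼-++⁺ {X = u ∷ v ∷ w ∷ []} ≼-refl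
              (≼-respʳ (flatC-↭ (↭-sym q)) (≼-∷ (≼-trans (flatC-≼ (≼-take (K ℕ.∸ 2) P′)) (≼-++ʳ [ h ] (flatC P′)))))))))
      three u v w p d@((uv ∷ uw ∷ []) ∷ (vw ∷ []) ∷ _) odd | yes all with sort₃ P all
      ... | i , j , k , q with cl v ≟ᵏ 0ᵏ | cl w ≟ᵏ 0ᵏ
      ... | no v≢0 | no w≢0 = sorted u v w i j k q odd p d v≢0 w≢0
      ... | yes v0 | _ = sorted v u w j i k
            (↭-trans q (P.shifts (replicate i (u , u)) (replicate j (v , v)))) odd
            (↭-trans p (P.++⁺ˡ (flatC P) (swap u v ↭-refl)))
            (((λ e → uv (sym e)) ∷ vw ∷ []) ∷ (uw ∷ []) ∷ [] ∷ [])
            (λ u0 → uv (≡.trans u0 (sym v0))) (λ w0 → vw (≡.trans v0 (sym w0)))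
      ... | no v≢0 | yes w0 = sorted w u v k i j
            (↭-trans q (psolve 3 (λ a b c → a ⊕ (b ⊕ c) ⊜ c ⊕ (a ⊕ b)) ↭-refl (replicate i (u , u)) (replicate j (v , v)) (replicate k (w , w)))) odd
            (↭-trans p (P.++⁺ˡ (flatC P) (P.shift w (u ∷ v ∷ []) [])))
            (((λ e → uw (sym e)) ∷ (λ e → vw (sym e)) ∷ []) ∷ (uv ∷ []) ∷ [] ∷ [])
            (λ u0 → uw (≡.trans u0 (sym w0))) v≢0

    -- The number of unpaired terms is odd, at most four, and at least three when there are at most
    -- K pairs. So there are three of them and exactly K pairs, and parity 1 is the only case left
    -- open.
    classify₂ : ∀ L → length L ≡ 2 ℕ.* K ℕ.+ 3 → POC (2 ℕ.* K) L ⊎ Shape₂ L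
    classify₂ L len with pair-classes L
    ... | P , R , p , same , d with suc K ℕ.≤? length P
    ... | yes K< = inj₁ (win-many (≼-respʳ (↭-sym p) (≼-++ˡ (flatC P) R)) same K<)
    ... | no K≮ = go R d p (≡.trans (sym (≡.trans (P.↭-length p) (≡.trans (Lₚ.length-++ (flatC P)) (cong (ℕ._+ length R) (length-flatC P))))) len)
      where
      P≤ : length P ≤ K
      P≤ = ℕₚ.≤-pred (ℕₚ.≰⇒> K≮)
      R≥3 : ∀ r → 2 ℕ.* length P ℕ.+ r ≡ 2 ℕ.* K ℕ.+ 3 → 3 ≤ r
      R≥3 r e = comb 0 (P≤ ⊹ P≤ ⊹ eq≥ e) (lem (length P) r K)
        where
        lem : ∀ p r K → 3 ℕ.+ (K ℕ.+ K ℕ.+ (2 ℕ.* p ℕ.+ r)) ℕ.+ 0 ≡ r ℕ.+ (p ℕ.+ p ℕ.+ (2 ℕ.* K ℕ.+ 3))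
        lem = solve-∀
      short : ∀ {r} → r < 3 → 2 ℕ.* length P ℕ.+ r ≡ 2 ℕ.* K ℕ.+ 3 → ⊥
      short r< e = ℕₚ.<-irrefl refl (ℕₚ.≤-trans r< (R≥3 _ e))
      odd≢even : ∀ a b → 2 ℕ.* a ℕ.+ 4 ≢ 2 ℕ.* b ℕ.+ 3
      odd≢even a b e = ℕₚ.even≢odd (a ℕ.+ 2) (b ℕ.+ 1) (≡.trans (lem a) (≡.trans e (lem′ b)))
        where
        lem : ∀ a → 2 ℕ.* (a ℕ.+ 2) ≡ 2 ℕ.* a ℕ.+ 4
        lem = solve-∀
        lem′ : ∀ b → 2 ℕ.* b ℕ.+ 3 ≡ suc (2 ℕ.* (b ℕ.+ 1))
        lem′ = solve-∀
      go : ∀ R → Distinct R → L ↭ flatC P ++ R → 2 ℕ.* length P ℕ.+ length R ≡ 2 ℕ.* K ℕ.+ 3 → POC (2 ℕ.* K) L ⊎ Shape₂ L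
      go [] d p e = ⊥-elim (short (s≤s z≤n) e)
      go (_ ∷ []) d p e = ⊥-elim (short (s≤s (s≤s z≤n)) e)
      go (_ ∷ _ ∷ []) d p e = ⊥-elim (short (s≤s (s≤s (s≤s z≤n))) e)
      go (_ ∷ _ ∷ _ ∷ _ ∷ []) d p e = ⊥-elim (odd≢even (length P) K e)
      go (_ ∷ _ ∷ _ ∷ _ ∷ _ ∷ _) d p e = ⊥-elim (ℕₚ.<-irrefl refl (ℕₚ.≤-trans (s≤s (s≤s (s≤s (s≤s (s≤s z≤n))))) (distinct-length d)))
      go (u ∷ v ∷ w ∷ []) d p e with parity P in odd
      ... | false = inj₁ (win-even (≼-respʳ (↭-sym p) (≼-++ˡ (flatC P) _)) same (ℕₚ.*-cancelˡ-≡ _ _ 2 (ℕₚ.+-cancelʳ-≡ 3 _ _ e)) odd)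
      ... | true  = Three.three L P same (ℕₚ.*-cancelˡ-≡ _ _ 2 (ℕₚ.+-cancelʳ-≡ 3 _ _ e)) u v w p d odd

-- Extremal sequences over the quaternion group.

module QuaternionSequences (G : FinGroup) (order≡ : FinGroup.order G ≡ 4 ℕ.* 2)
  (α τ : FinGroup.Carrier G) (presentation : DicPresentation G 2 α τ) where
  open FinGroup G
  open Model G 2 order≡ α τ presentation
  open Quaternion G order≡ α τ presentation
  open EvenGroup 𝔾 using (Z; _≟_; ν; 0#)
  open ManyOutside 𝔾 using (oddᵇ; nu; nu-xor; xor-cancel; module Parity)

  open Dec≡ _≟ᶜ_
  open Parity bitp

  ev-code-map : ∀ S → map ev (map code S) ≡ S
  ev-code-map S = ≡.trans (sym (Lₚ.map-∘ S)) (≡.trans (Lₚ.map-cong ev-code S) (Lₚ.map-id S))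

  map-≼ᶜ : ∀ {A B : Set} (f : A → B) {X Y} → X ≼ Y → map f X ≼ map f Y
  map-≼ᶜ f {X} (R , p) = map f R , ↭-trans (P.map⁺ f p) (↭-reflexive (Lₚ.map-++ f X R))

  prod-ev : ∀ L → prod G (map ev L) ≡ ev (prodC L)
  prod-ev []      = sym φ-0
  prod-ev (g ∷ L) = ≡.trans (cong (ev g ∙_) (prod-ev L)) (sym (ev-⊗ g (prodC L)))

  POC⇒PO : ∀ {M S} → POC M (map code S) → HasPOSub G M S
  POC⇒PO {M} {S} (T , s , len , T′ , p , e) = map ev T , subst (map ev T ≼_) (ev-code-map S) (map-≼ᶜ ev s)
    , ≡.trans (Lₚ.length-map ev T) len , map ev T′ , P.map⁺ ev p , ≡.trans (prod-ev T′) (≡.trans (cong ev e) φ-0)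

  PO⇒POC : ∀ {M S} → HasPOSub G M S → POC M (map code S)
  PO⇒POC {M} {S} (T , s , len , T′ , p , e) = map code T , map-≼ᶜ code s , ≡.trans (Lₚ.length-map code T) len , map code T′ , P.map⁺ code p
    , ev-injective (≡.trans (sym (prod-ev (map code T′))) (≡.trans (cong (prod G) (ev-code-map T′)) (≡.trans e (sym φ-0))))

  Independent : Code → Code → Code → Set
  Independent x c d = cl x ≡ 0ᵏ × cl c ≢ 0ᵏ × cl d ≢ 0ᵏ × cl c ≢ cl d

  clsum-xc : ∀ {x c} → cl x ≡ 0ᵏ → cl c ≢ 0ᵏ → ∀ T → All (λ g → g ≡ x ⊎ g ≡ c) T →
    clsum T ≡ (if oddᵇ (count c T) then cl c else 0ᵏ)
  clsum-xc x0 c≢0 [] [] = refl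
  clsum-xc {x} {c} x0 c≢0 (g ∷ T) (e ∷ es) with c ≟ᶜ g | clsum-xc x0 c≢0 T es
  ... | yes refl | ih = ≡.trans (cong (cl c +ᵏ_) ih) (table (oddᵇ (count c T)))
    where
    table : ∀ o → cl c +ᵏ (if o then cl c else 0ᵏ) ≡ (if not o then cl c else 0ᵏ)
    table true  = +ᵏ-self (cl c)
    table false = ≡.trans (+ᵏ-comm (cl c) 0ᵏ) refl
  ... | no c≢g | ih with e
  ... | inj₂ refl = ⊥-elim (c≢g refl)
  ... | inj₁ refl = ≡.trans (cong (_+ᵏ clsum T) x0) ih

  prodC-xc : ∀ {x c} → cl x ≡ 0ᵏ → cl c ≢ 0ᵏ → ∀ T → All (λ g → g ≡ x ⊎ g ≡ c) T →
    prodC T ≡ prodC (replicate (count x T) x) ⊗ prodC (replicate (count c T) c) × length T ≡ count x T ℕ.+ count c T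
  prodC-xc x0 c≢0 [] [] = sym (cen-false (cen false)) , refl
  prodC-xc {x} {c} x0 c≢0 (g ∷ T) (e ∷ es) with x ≟ᶜ g | c ≟ᶜ g | prodC-xc x0 c≢0 T es
  ... | yes refl | yes refl | _ = ⊥-elim (c≢0 x0)
  ... | yes refl | no _ | ih , len = ≡.trans (cong (x ⊗_) ih) (sym (⊗-assoc x _ _)) , cong suc len
  ... | no _ | yes refl | ih , len = (begin
      c ⊗ prodC T            ≡⟨ cong (c ⊗_) ih ⟩
      c ⊗ (X ⊗ C)            ≡⟨ ⊗-assoc c X C ⟨
      (c ⊗ X) ⊗ C            ≡⟨ cong (_⊗ C) (central-commutes X cl-X c) ⟨
      (X ⊗ c) ⊗ C            ≡⟨ ⊗-assoc X c C ⟩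
      X ⊗ (c ⊗ C)            ∎) , ≡.trans (cong suc len) (sym (ℕₚ.+-suc _ _))
    where
    open ≡.≡-Reasoning
    X = prodC (replicate (count x T) x)
    C = prodC (replicate (count c T) c)
    clsum-rep : ∀ k → clsum (replicate k x) ≡ 0ᵏ
    clsum-rep zero    = refl
    clsum-rep (suc k) = ≡.trans (cong₂ _+ᵏ_ x0 (clsum-rep k)) refl
    cl-X : cl X ≡ 0ᵏ
    cl-X = ≡.trans (cl-prodC (replicate (count x T) x)) (clsum-rep (count x T))
  ... | no x≢g | no c≢g | _ with e
  ... | inj₁ refl = ⊥-elim (x≢g refl)
  ... | inj₂ refl = ⊥-elim (c≢g refl)

  prodC-even : ∀ k g → prodC (replicate (2 ℕ.* k) g) ≡ cen (oddᵇ k ∧ bitp (g , g))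
  prodC-even k g = ≡.trans (cong prodC (sym (flatC-replicate k g))) (≡.trans (prodC-flatC {replicate k (g , g)} (Allₚ.replicate⁺ k refl))
    (cong cen (≡.trans (parity-constant {b = bitp (g , g)} {Q = replicate k (g , g)} (Allₚ.replicate⁺ k refl)) (cong (λ k → oddᵇ k ∧ bitp (g , g)) (Lₚ.length-replicate k)))))

  even-half : ∀ q → oddᵇ q ≡ false → ∃ λ h → q ≡ 2 ℕ.* h
  even-half zero _ = 0 , refl
  even-half (suc (suc q)) e with even-half q (≡.trans (sym (𝔹.not-involutive _)) e)
  ... | h , refl = suc h , double-suc h

  -- If `d` is used, the other terms contribute the class 0 or that of c, and neither cancels the
  -- class of `d`. If not, c occurs an even number of times, the multiplicities force x^(2i) c^(2j),
  -- and its product is z^j = z in every order.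
  no-POC : ∀ K {L x c d} i j → Independent x c d → i ℕ.+ j ≡ K → oddᵇ j ≡ true →
    L ↭ replicate (suc (2 ℕ.* i)) x ++ replicate (suc (2 ℕ.* j)) c ++ [ d ] → ¬ POC (2 ℕ.* K) L
  no-POC K {L} {x} {c} {d} i j (x0 , c≢0 , d≢0 , c≢d) i+j odd p (T , s , len , T′ , q , e) with d ∈? T
  ... | yes d∈ with ∈⇒↭ d∈
  ... | T₁ , r = contra (≡.trans (clsum-↭ (↭-trans (↭-sym r) q)) (≡.trans (sym (cl-prodC T′)) (cong cl e)))
    where
    T₁≼ : T₁ ≼ replicate (suc (2 ℕ.* i)) x ++ replicate (suc (2 ℕ.* j)) c
    T₁≼ = proj₁ s , P.drop-∷ (↭-trans (↭-trans (P.++-comm [ d ] _) (↭-trans (P.++-assoc (replicate (suc (2 ℕ.* i)) x) _ _) (↭-sym p))) (↭-trans (proj₂ s) (P.++⁺ʳ (proj₁ s) r)))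
    members : All (λ g → g ≡ x ⊎ g ≡ c) T₁
    members = All.tabulate λ k → All.lookup {P = λ g → g ≡ x ⊎ g ≡ c}
      (Allₚ.++⁺ (Allₚ.replicate⁺ (suc (2 ℕ.* i)) (inj₁ refl)) (Allₚ.replicate⁺ (suc (2 ℕ.* j)) (inj₂ refl))) (≼-∈ T₁≼ k)
    contra : cl d +ᵏ clsum T₁ ≢ 0ᵏ
    contra e with oddᵇ (count c T₁) | clsum-xc x0 c≢0 T₁ members
    ... | false | e₁ = d≢0 (≡.trans (sym (≡.trans (+ᵏ-comm (cl d) 0ᵏ) refl)) (≡.trans (cong (cl d +ᵏ_) (sym e₁)) e))
    ... | true  | e₁ = c≢d (≡.trans (sym (cong (_+ᵏ cl c) (≡.trans (cong (cl d +ᵏ_) (sym e₁)) e)))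
        (≡.trans (+ᵏ-assoc (cl d) (cl c) (cl c)) (≡.trans (cong (cl d +ᵏ_) (+ᵏ-self (cl c))) (≡.trans (+ᵏ-comm (cl d) 0ᵏ) refl))))
  no-POC K {L} {x} {c} {d} i j (x0 , c≢0 , d≢0 , c≢d) i+j odd p (T , s , len , T′ , q , e) | no d∉ = finish
    where
    A = replicate (suc (2 ℕ.* i)) x
    C = replicate (suc (2 ℕ.* j)) c
    x≢c : x ≢ c
    x≢c refl = c≢0 x0
    T≼ : T ≼ A ++ C
    T≼ = remove-≼ d∉ (↭-trans p (↭-trans (↭-sym (P.++-assoc A C [ d ])) (P.++-comm (A ++ C) [ d ]))) s
    T′≼ : T′ ≼ A ++ C
    T′≼ = ≼-respˡ q T≼
    members : All (λ g → g ≡ x ⊎ g ≡ c) T′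
    members = All.tabulate λ k → All.lookup {P = λ g → g ≡ x ⊎ g ≡ c}
      (Allₚ.++⁺ (Allₚ.replicate⁺ (suc (2 ℕ.* i)) (inj₁ refl)) (Allₚ.replicate⁺ (suc (2 ℕ.* j)) (inj₂ refl))) (≼-∈ T′≼ k)
    nx = count x T′
    nc = count c T′
    nx≤ : nx ≤ suc (2 ℕ.* i)
    nx≤ = ℕₚ.≤-trans (count-≼ x T′≼) (eq≤ (≡.trans (count-++ x A C) (≡.trans (cong₂ ℕ._+_ (count-replicate x (suc (2 ℕ.* i))) (count-replicate-≢ (suc (2 ℕ.* j)) x≢c)) (ℕₚ.+-identityʳ _))))
    nc≤ : nc ≤ suc (2 ℕ.* j)
    nc≤ = ℕₚ.≤-trans (count-≼ c T′≼) (eq≤ (≡.trans (count-++ c A C) (cong₂ ℕ._+_ (count-replicate-≢ (suc (2 ℕ.* i)) (λ e → x≢c (sym e))) (count-replicate c (suc (2 ℕ.* j))))))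
    total : nx ℕ.+ nc ≡ 2 ℕ.* i ℕ.+ 2 ℕ.* j
    total = ≡.trans (sym (proj₂ (prodC-xc x0 c≢0 T′ members))) (≡.trans (sym (P.↭-length q)) (≡.trans len (≡.trans (cong (2 ℕ.*_) (sym i+j)) (ℕₚ.*-distribˡ-+ 2 i j))))
    nc-even : oddᵇ nc ≡ false
    nc-even with oddᵇ nc | clsum-xc x0 c≢0 T′ members
    ... | false | _ = refl
    ... | true  | e₁ = ⊥-elim (c≢0 (≡.trans (sym e₁) (≡.trans (sym (cl-prodC T′)) (cong cl e))))
    finish : ⊥
    finish with even-half nc nc-even
    ... | h , nc≡ = true≢false (≡.trans (sym (≡.trans (cong₂ _⊗_ (≡.trans (cong (λ k → prodC (replicate k x)) nx≡) (≡.trans (prodC-even i x) (cong cen (≡.trans (cong (oddᵇ i ∧_) (bitp-central x x0)) (𝔹.∧-zeroʳ _)))))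
          (≡.trans (cong (λ k → prodC (replicate k c)) (≡.trans nc≡ (cong (2 ℕ.*_) h≡j))) (≡.trans (prodC-even j c) (cong cen (≡.trans (cong₂ _∧_ odd (bitp-noncentral c c≢0)) refl)))))
          (cen-false (cen true)))) (≡.trans (sym (proj₁ (prodC-xc x0 c≢0 T′ members))) e))
      where
      true≢false : cen true ≢ cen false
      true≢false ()
      h≤j : h ≤ j
      h≤j = halve {h} {j} (ℕₚ.≤-trans (eq≤ (sym nc≡)) nc≤)
      j≤h : j ≤ h
      j≤h = halve {j} {h} (comb 0 (nx≤ ⊹ eq≥ total ⊹ eq≤ nc≡) (lem nx nc i j h))
        where
        lem : ∀ nx nc i j h → 2 ℕ.* j ℕ.+ (suc (2 ℕ.* i) ℕ.+ (nx ℕ.+ nc) ℕ.+ 2 ℕ.* h) ℕ.+ 0 ≡ suc (2 ℕ.* h) ℕ.+ (nx ℕ.+ (2 ℕ.* i ℕ.+ 2 ℕ.* j) ℕ.+ nc)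
        lem = solve-∀
      h≡j : h ≡ j
      h≡j = ℕₚ.≤-antisym h≤j j≤h
      nx≡ : nx ≡ 2 ℕ.* i
      nx≡ = ℕₚ.+-cancelʳ-≡ (2 ℕ.* j) nx (2 ℕ.* i) (≡.trans (cong (nx ℕ.+_) (sym (≡.trans nc≡ (cong (2 ℕ.*_) h≡j)))) total)

  Even⇒ : ∀ {k} → 2 ∣ k → oddᵇ k ≡ false
  Even⇒ (divides zero refl)    = refl
  Even⇒ (divides (suc q) refl) = ≡.trans (𝔹.not-involutive _) (Even⇒ (divides q refl))

  ⇒Even : ∀ {k} → oddᵇ k ≡ false → 2 ∣ k
  ⇒Even {k} e with even-half k e
  ... | h , refl = divides h (ℕₚ.*-comm 2 h)

  Odd⇒ : ∀ {k} → ¬ (2 ∣ k) → oddᵇ k ≡ true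
  Odd⇒ {k} ¬2∣ with oddᵇ k in e
  ... | true  = refl
  ... | false = ⊥-elim (¬2∣ (⇒Even e))

  ⇒Odd : ∀ {k} → oddᵇ k ≡ true → ¬ (2 ∣ k)
  ⇒Odd e d with ≡.trans (sym e) (Even⇒ d)
  ... | ()

  Exponents : ℕ → ℕ → ℕ → ℕ → Set
  Exponents t₁ t₂ t₃ t₄ = t₁ < 4 × t₂ < 4 × t₃ < 4 × t₄ < 4 × 2 ∣ t₁ × ¬ (2 ∣ t₂) × (2 ∣ t₃ × ¬ (2 ∣ t₄) ⊎ ¬ (2 ∣ t₃) × 2 ∣ t₄)

  Kind : ℕ → ℕ → ℕ → Carrier → Carrier → Set
  Kind t₂ t₃ t₄ c d = (c ≡ pow G α t₂ × d ≡ pow G α t₃ ∙ τ) ⊎ (c ≡ pow G α t₃ ∙ τ × d ≡ pow G α t₂) ⊎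
    (c ≡ pow G α t₃ ∙ τ × d ≡ pow G α t₄ ∙ τ)

  Family : Carrier → Carrier → Carrier → Set
  Family x c d = ∃ λ t₁ → ∃ λ t₂ → ∃ λ t₃ → ∃ λ t₄ → Exponents t₁ t₂ t₃ t₄ × x ≡ pow G α t₁ ×
    Kind t₂ t₃ t₄ c d

  other : ∀ t → ∃ λ t′ → t′ < 4 × (2 ∣ t × ¬ (2 ∣ t′) ⊎ ¬ (2 ∣ t) × 2 ∣ t′)
  other t with oddᵇ t in e
  ... | false = 1 , s≤s (s≤s z≤n) , inj₁ (⇒Even e , ⇒Odd {1} refl)
  ... | true  = 0 , s≤s z≤n , inj₂ (⇒Odd {t} e , ⇒Even {0} refl)

  -- Two odd powers of α lie in one class, which excludes that form. An exponent that the chosen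
  -- form does not mention must still satisfy the parity conditions; `other` or the constant 1
  -- supplies it.
  family : ∀ x c d → Independent x c d → Family (ev x) (ev c) (ev d)
  family (inj₂ _) c d (() , _)
  family (inj₁ x) (inj₁ y) (inj₁ y′) (x0 , c≢0 , d≢0 , c≢d) with oddᵇ (toℕ y) | oddᵇ (toℕ y′)
  ... | false | _     = ⊥-elim (c≢0 refl)
  ... | true  | false = ⊥-elim (d≢0 refl)
  ... | true  | true  = ⊥-elim (c≢d refl)
  family (inj₁ x) (inj₁ y) (inj₂ e) (x0 , c≢0 , d≢0 , c≢d) with other (toℕ e)
  ... | t₄ , t₄< , opp = toℕ x , toℕ y , toℕ e , t₄ , (Finₚ.toℕ<n x , Finₚ.toℕ<n y , Finₚ.toℕ<n e , t₄<
      , ⇒Even (cong proj₂ x0) , (λ d → c≢0 (cong (false ,_) (Even⇒ d))) , opp) , refl , inj₁ (refl , refl)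
  family (inj₁ x) (inj₂ e) (inj₁ y) (x0 , c≢0 , d≢0 , c≢d) with other (toℕ e)
  ... | t₄ , t₄< , opp = toℕ x , toℕ y , toℕ e , t₄ , (Finₚ.toℕ<n x , Finₚ.toℕ<n y , Finₚ.toℕ<n e , t₄<
      , ⇒Even (cong proj₂ x0) , (λ d → d≢0 (cong (false ,_) (Even⇒ d))) , opp) , refl , inj₂ (inj₁ (refl , refl))
  family (inj₁ x) (inj₂ e) (inj₂ e′) (x0 , c≢0 , d≢0 , c≢d) = toℕ x , 1 , toℕ e , toℕ e′ , (Finₚ.toℕ<n x , s≤s (s≤s z≤n) , Finₚ.toℕ<n e , Finₚ.toℕ<n e′
      , ⇒Even (cong proj₂ x0) , ⇒Odd {1} refl , opposite) , refl , inj₂ (inj₂ (refl , refl))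
    where
    opposite : 2 ∣ toℕ e × ¬ (2 ∣ toℕ e′) ⊎ ¬ (2 ∣ toℕ e) × 2 ∣ toℕ e′
    opposite with oddᵇ (toℕ e) in p | oddᵇ (toℕ e′) in q
    ... | false | true  = inj₁ (⇒Even p , ⇒Odd {toℕ e′} q)
    ... | true  | false = inj₂ (⇒Odd {toℕ e} p , ⇒Even q)
    ... | false | false = ⊥-elim (c≢d refl)
    ... | true  | true  = ⊥-elim (c≢d refl)

  family⁻¹ : ∀ {x c d} → Family x c d → ∃ λ x′ → ∃₂ λ c′ d′ → Independent x′ c′ d′ × x ≡ ev x′ × c ≡ ev c′ × d ≡ ev d′
  family⁻¹ (t₁ , t₂ , t₃ , t₄ , (t₁< , t₂< , t₃< , t₄< , e₁ , o₂ , opp) , x≡ , cases) = build cases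
    where
    rot : ∀ {t} → t < 4 → Code
    rot t< = inj₁ (fromℕ< t<)
    ref : ∀ {t} → t < 4 → Code
    ref t< = inj₂ (fromℕ< t<)
    cl-rot : ∀ {t} (t< : t < 4) → cl (rot t<) ≡ (false , oddᵇ t)
    cl-rot t< = cong (λ k → false , oddᵇ k) (Finₚ.toℕ-fromℕ< t<)
    cl-ref : ∀ {t} (t< : t < 4) → cl (ref t<) ≡ (true , oddᵇ t)
    cl-ref t< = cong (λ k → true , oddᵇ k) (Finₚ.toℕ-fromℕ< t<)
    pow≡ : ∀ {t} (t< : t < 4) → pow G α t ≡ φ (fromℕ< t<)
    pow≡ t< = cong (pow G α) (sym (Finₚ.toℕ-fromℕ< t<))
    x0 : cl (rot t₁<) ≡ 0ᵏ
    x0 = ≡.trans (cl-rot t₁<) (cong (false ,_) (Even⇒ e₁))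
    cl₂ : cl (rot t₂<) ≡ (false , true)
    cl₂ = ≡.trans (cl-rot t₂<) (cong (false ,_) (Odd⇒ o₂))
    ref≢0 : ∀ {t} (t< : t < 4) → cl (ref t<) ≢ 0ᵏ
    ref≢0 t< ()
    rot₂≢0 : cl (rot t₂<) ≢ 0ᵏ
    rot₂≢0 e with ≡.trans (sym cl₂) e
    ... | ()
    differ : 2 ∣ t₃ × ¬ (2 ∣ t₄) ⊎ ¬ (2 ∣ t₃) × 2 ∣ t₄ → oddᵇ t₃ ≢ oddᵇ t₄
    differ (inj₁ (a , b)) e with ≡.trans (sym (Even⇒ a)) (≡.trans e (Odd⇒ b))
    ... | ()
    differ (inj₂ (a , b)) e with ≡.trans (sym (Odd⇒ a)) (≡.trans e (Even⇒ b))
    ... | ()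
    build : _ → _
    build (inj₁ (c≡ , d≡)) = rot t₁< , rot t₂< , ref t₃< , (x0 , rot₂≢0 , ref≢0 t₃< , λ ()) , ≡.trans x≡ (pow≡ t₁<) , ≡.trans c≡ (pow≡ t₂<) , ≡.trans d≡ (cong (_∙ τ) (pow≡ t₃<))
    build (inj₂ (inj₁ (c≡ , d≡))) = rot t₁< , ref t₃< , rot t₂< , (x0 , ref≢0 t₃< , rot₂≢0 , λ ()) , ≡.trans x≡ (pow≡ t₁<) , ≡.trans c≡ (cong (_∙ τ) (pow≡ t₃<)) , ≡.trans d≡ (pow≡ t₂<)
    build (inj₂ (inj₂ (c≡ , d≡))) = rot t₁< , ref t₃< , ref t₄< , (x0 , ref≢0 t₃< , ref≢0 t₄<
      , λ e → differ opp (cong proj₂ (≡.trans (sym (cl-ref t₃<)) (≡.trans e (cl-ref t₄<))))) , ≡.trans x≡ (pow≡ t₁<) , ≡.trans c≡ (cong (_∙ τ) (pow≡ t₃<)) , ≡.trans d≡ (cong (_∙ τ) (pow≡ t₄<))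

  -- The sequences x^(2i+1) c^(2j+1) d of the theorem for n = 2.
  Special : ℕ → Seq G → Set
  Special K S = ∃ λ x → ∃₂ λ c d → ∃₂ λ i j → Family x c d × i ℕ.+ j ≡ K × oddᵇ j ≡ true ×
    S ↭ replicate (suc (2 ℕ.* i)) x ++ replicate (suc (2 ℕ.* j)) c ++ [ d ]

  map-shape : ∀ {B C : Set} (f : B → C) i j x c d → map f (replicate i x ++ replicate j c ++ [ d ]) ≡ replicate i (f x) ++ replicate j (f c) ++ [ f d ]
  map-shape f i j x c d = ≡.trans (Lₚ.map-++ f (replicate i x) _) (cong₂ _++_ (Lₚ.map-replicate f i x)
    (≡.trans (Lₚ.map-++ f (replicate j c) _) (cong (_++ [ f d ]) (Lₚ.map-replicate f j c))))

  special-classify : ∀ K → 2 ≤ K → oddᵇ K ≡ false → ∀ S → length S ≡ 2 ℕ.* K ℕ.+ 3 → HasPOSub G (2 ℕ.* K) S ⊎ Special K S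
  special-classify K 2≤K even S len with classify₂ K 2≤K even (map code S) (≡.trans (Lₚ.length-map code S) len)
  ... | inj₁ po = inj₁ (POC⇒PO po)
  ... | inj₂ (x , c , d , i , j , x0 , c≢0 , d≢0 , c≢d , i+j , odd , p) = inj₂ (ev x , ev c , ev d , i , j
      , family x c d (x0 , c≢0 , d≢0 , c≢d) , i+j , odd
      , ↭-trans (↭-reflexive (sym (ev-code-map S))) (↭-trans (P.map⁺ ev p) (↭-reflexive (map-shape ev (suc (2 ℕ.* i)) (suc (2 ℕ.* j)) x c d))))

  special-no-PO : ∀ K S → Special K S → ¬ HasPOSub G (2 ℕ.* K) S
  special-no-PO K S (x , c , d , i , j , fam , i+j , odd , p) po with family⁻¹ fam
  ... | x′ , c′ , d′ , ind , refl , refl , refl = no-POC K i j ind i+j odd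
      (↭-trans (P.map⁺ code p) (↭-reflexive (≡.trans (map-shape code (suc (2 ℕ.* i)) (suc (2 ℕ.* j)) (ev x′) (ev c′) (ev d′))
        (cong₂ (λ A B → A ++ B) (cong (replicate (suc (2 ℕ.* i))) (code-ev x′)) (cong₂ (λ A B → A ++ [ B ]) (cong (replicate (suc (2 ℕ.* j))) (code-ev c′)) (code-ev d′))))))
      (PO⇒POC po)

  special-forced : ∀ K → 2 ≤ K → oddᵇ K ≡ false → Forces G (2 ℕ.* K) (2 ℕ.* K ℕ.+ 4)
  special-forced K 2≤K even S len = lift (POC⇒PO (forced₂ K 2≤K even (map code S₁) (≡.trans (Lₚ.length-map code S₁) (length-take≤ _ S len))))
    where
    S₁ = take (2 ℕ.* K ℕ.+ 4) S
    lift : HasPOSub G (2 ℕ.* K) S₁ → HasPOSub G (2 ℕ.* K) S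
    lift (T , s , rest) = T , ≼-trans s (≼-take (2 ℕ.* K ℕ.+ 4) S) , rest

  special-length : ∀ K S → Special K S → length S ≡ 2 ℕ.* K ℕ.+ 3
  special-length K S (x , c , d , i , j , _ , i+j , _ , p) = ≡.trans (P.↭-length p) (≡.trans (Lₚ.length-++ (replicate (suc (2 ℕ.* i)) x))
    (≡.trans (cong₂ ℕ._+_ (Lₚ.length-replicate (suc (2 ℕ.* i))) (≡.trans (Lₚ.length-++ (replicate (suc (2 ℕ.* j)) c)) (cong (ℕ._+ 1) (Lₚ.length-replicate (suc (2 ℕ.* j))))))
      (≡.trans (lem i j) (cong (λ k → 2 ℕ.* k ℕ.+ 3) i+j))))
    where
    lem : ∀ i j → suc (2 ℕ.* i) ℕ.+ (suc (2 ℕ.* j) ℕ.+ 1) ≡ 2 ℕ.* (i ℕ.+ j) ℕ.+ 3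
    lem = solve-∀

  special-example : ∀ i → Special (i ℕ.+ 1) (replicate (suc (2 ℕ.* i)) (pow G α 0) ++ replicate 3 (pow G α 1) ++ [ pow G α 0 ∙ τ ])
  special-example i = pow G α 0 , pow G α 1 , pow G α 0 ∙ τ , i , 1 , (0 , 1 , 0 , 1
    , (s≤s z≤n , s≤s (s≤s z≤n) , s≤s z≤n , s≤s (s≤s z≤n) , ⇒Even {0} refl , ⇒Odd {1} refl , inj₁ (⇒Even {0} refl , ⇒Odd {1} refl)) , refl , inj₁ (refl , refl)) , refl , refl , ↭-refl

-- The sequence `S₀` of length N - 1 shows that no smaller length forces, and `forced` gives N
-- itself, so s = N. Only then is s - 1 the length to which `classify` applies.
characterize : ∀ {G k N} {Shape : Seq G → Set} →
  (∀ S → suc (length S) ≡ N → HasPOSub G k S ⊎ Shape S) →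
  (∀ S → Shape S → suc (length S) ≡ N × ¬ HasPOSub G k S) →
  Forces G k N → ∃ Shape →
  ∀ {s} → IsLeast (Forces G k) s → ∀ S → (length S ≡ s ∸ 1 × ¬ HasPOSub G k S) ⇔ Shape S
characterize {G} {k} {N} {Shape} classify sound forced (S₀ , shape₀) {s} (forced-s , least) S = mk⇔ to from
  where
  N≡ : suc (length S₀) ≡ N
  N≡ = proj₁ (sound S₀ shape₀)
  s≡N : s ≡ N
  s≡N with s ℕ.≤? length S₀
  ... | yes s≤ = ⊥-elim (proj₂ (sound S₀ shape₀) (forced-s S₀ s≤))
  ... | no s≰  = ℕₚ.≤-antisym (least N forced) (ℕₚ.≤-trans (eq≥ N≡) (ℕₚ.≰⇒> s≰))
  length≡ : ∀ {l} → l ≡ s ∸ 1 → suc l ≡ N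
  length≡ e = ≡.trans (cong suc (≡.trans e (cong (_∸ 1) (≡.trans s≡N (sym N≡))))) N≡
  to : length S ≡ s ∸ 1 × ¬ HasPOSub G k S → Shape S
  to (len , no-po) with classify S (length≡ len)
  ... | inj₁ po    = ⊥-elim (no-po po)
  ... | inj₂ shape = shape
  from : Shape S → length S ≡ s ∸ 1 × ¬ HasPOSub G k S
  from shape = ≡.trans (cong (_∸ 1) (proj₁ (sound S shape))) (cong (_∸ 1) (sym s≡N)) , proj₂ (sound S shape)

-- The case n = 2 in the terms of the theorem.

module Order8 {G : FinGroup} (order≡ : FinGroup.order G ≡ 8) where
  open FinGroup G
  open Shapes G

  module _ {α τ : Carrier} (presentation : DicPresentation G 2 α τ) where
    open QuaternionSequences G order≡ α τ presentation public using (Special; Family; Kind; special-classify; special-no-PO; special-forced; special-length; special-example)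

  -- i + j = 2 with j odd leaves only i = j = 1, which gives the multiplicities 3 and 3.
  special⇒1b : ∀ {α τ} (p : DicPresentation G 2 α τ) {S} → Special p 2 S → Cond1b 2 S
  special⇒1b p (_ , _ , _ , 1 , 1 , (t₁ , t₂ , t₃ , t₄ , (l₁ , l₂ , l₃ , l₄ , e₁ , o₂ , opp) , refl , inj₁ (refl , refl)) , refl , _ , q) =
    _ , _ , p , inj₂ (refl , t₁ , t₂ , t₃ , t₄ , l₁ , l₂ , l₃ , l₄ , e₁ , o₂ , opp , inj₁ q)
  special⇒1b p (_ , _ , _ , 1 , 1 , (t₁ , t₂ , t₃ , t₄ , (l₁ , l₂ , l₃ , l₄ , e₁ , o₂ , opp) , refl , inj₂ (inj₁ (refl , refl))) , refl , _ , q) =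
    _ , _ , p , inj₂ (refl , t₁ , t₂ , t₃ , t₄ , l₁ , l₂ , l₃ , l₄ , e₁ , o₂ , opp , inj₂ (inj₁ q))
  special⇒1b p (_ , _ , _ , 1 , 1 , (t₁ , t₂ , t₃ , t₄ , (l₁ , l₂ , l₃ , l₄ , e₁ , o₂ , opp) , refl , inj₂ (inj₂ (refl , refl))) , refl , _ , q) =
    _ , _ , p , inj₂ (refl , t₁ , t₂ , t₃ , t₄ , l₁ , l₂ , l₃ , l₄ , e₁ , o₂ , opp , inj₂ (inj₂ q))
  special⇒1b p (_ , _ , _ , 2 , 0 , _ , _ , () , _)
  special⇒1b p (_ , _ , _ , 0 , 2 , _ , _ , () , _)

  1b⇒special : ∀ {S} → Cond1b 2 S → ∃₂ λ α τ → ∃ λ (p : DicPresentation G 2 α τ) → Special p 2 S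
  1b⇒special (α , τ , p , inj₁ (s≤s (s≤s ()) , _))
  1b⇒special (α , τ , p , inj₂ (_ , t₁ , t₂ , t₃ , t₄ , l₁ , l₂ , l₃ , l₄ , e₁ , o₂ , opp , inj₁ q)) =
    α , τ , p , _ , _ , _ , 1 , 1 , (t₁ , t₂ , t₃ , t₄ , (l₁ , l₂ , l₃ , l₄ , e₁ , o₂ , opp) , refl , inj₁ (refl , refl)) , refl , refl , q
  1b⇒special (α , τ , p , inj₂ (_ , t₁ , t₂ , t₃ , t₄ , l₁ , l₂ , l₃ , l₄ , e₁ , o₂ , opp , inj₂ (inj₁ q))) =
    α , τ , p , _ , _ , _ , 1 , 1 , (t₁ , t₂ , t₃ , t₄ , (l₁ , l₂ , l₃ , l₄ , e₁ , o₂ , opp) , refl , inj₂ (inj₁ (refl , refl))) , refl , refl , q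
  1b⇒special (α , τ , p , inj₂ (_ , t₁ , t₂ , t₃ , t₄ , l₁ , l₂ , l₃ , l₄ , e₁ , o₂ , opp , inj₂ (inj₂ q))) =
    α , τ , p , _ , _ , _ , 1 , 1 , (t₁ , t₂ , t₃ , t₄ , (l₁ , l₂ , l₃ , l₄ , e₁ , o₂ , opp) , refl , inj₂ (inj₂ (refl , refl))) , refl , refl , q

  extend-x : ∀ (x c d : Carrier) → (replicate 3 x ++ replicate 3 c ++ [ d ]) ++ replicate 4 x ↭ replicate 7 x ++ replicate 3 c ++ [ d ]
  extend-x x c d = psolve 4 (λ x₃ x₄ c d → (x₃ ⊕ (c ⊕ d)) ⊕ x₄ ⊜ (x₃ ⊕ x₄) ⊕ (c ⊕ d)) ↭-refl (replicate 3 x) (replicate 4 x) (replicate 3 c) [ d ]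

  extend-c : ∀ (x c d : Carrier) → (replicate 3 x ++ replicate 3 c ++ [ d ]) ++ replicate 4 c ↭ replicate 3 x ++ replicate 7 c ++ [ d ]
  extend-c x c d = psolve 4 (λ x c₃ c₄ d → (x ⊕ (c₃ ⊕ d)) ⊕ c₄ ⊜ x ⊕ ((c₃ ⊕ c₄) ⊕ d)) ↭-refl (replicate 3 x) (replicate 3 c) (replicate 4 c) [ d ]

  -- i + j = 4 with j odd leaves (3, 1) and (1, 3). Compared with multiplicities 3 and 3, the
  -- additional fourth power falls on x or on c: these are the two choices of `S₀` or `S₁`.
  special⇒2b : ∀ {α τ} (p : DicPresentation G 2 α τ) {S} → Special p 4 S → Cond2b 2 S
  special⇒2b p (_ , c , d , 3 , 1 , (t₁ , t₂ , t₃ , t₄ , (l₁ , l₂ , l₃ , l₄ , e₁ , o₂ , opp) , refl , inj₁ (refl , refl)) , refl , _ , q) =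
    _ , _ , p , inj₂ (refl , t₁ , t₂ , t₃ , t₄ , l₁ , l₂ , l₃ , l₄ , e₁ , o₂ , opp , inj₁ (_ , inj₁ refl , ↭-trans q (↭-sym (extend-x _ _ _))))
  special⇒2b p (_ , c , d , 3 , 1 , (t₁ , t₂ , t₃ , t₄ , (l₁ , l₂ , l₃ , l₄ , e₁ , o₂ , opp) , refl , inj₂ (inj₁ (refl , refl))) , refl , _ , q) =
    _ , _ , p , inj₂ (refl , t₁ , t₂ , t₃ , t₄ , l₁ , l₂ , l₃ , l₄ , e₁ , o₂ , opp , inj₂ (_ , inj₁ refl , inj₁ (↭-trans q (↭-sym (extend-x _ _ _)))))
  special⇒2b p (_ , c , d , 3 , 1 , (t₁ , t₂ , t₃ , t₄ , (l₁ , l₂ , l₃ , l₄ , e₁ , o₂ , opp) , refl , inj₂ (inj₂ (refl , refl))) , refl , _ , q) =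
    _ , _ , p , inj₂ (refl , t₁ , t₂ , t₃ , t₄ , l₁ , l₂ , l₃ , l₄ , e₁ , o₂ , opp , inj₂ (_ , inj₁ refl , inj₂ (↭-trans q (↭-sym (extend-x _ _ _)))))
  special⇒2b p (_ , c , d , 1 , 3 , (t₁ , t₂ , t₃ , t₄ , (l₁ , l₂ , l₃ , l₄ , e₁ , o₂ , opp) , refl , inj₁ (refl , refl)) , refl , _ , q) =
    _ , _ , p , inj₂ (refl , t₁ , t₂ , t₃ , t₄ , l₁ , l₂ , l₃ , l₄ , e₁ , o₂ , opp , inj₁ (_ , inj₂ refl , ↭-trans q (↭-sym (extend-c _ _ _))))
  special⇒2b p (_ , c , d , 1 , 3 , (t₁ , t₂ , t₃ , t₄ , (l₁ , l₂ , l₃ , l₄ , e₁ , o₂ , opp) , refl , inj₂ (inj₁ (refl , refl))) , refl , _ , q) =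
    _ , _ , p , inj₂ (refl , t₁ , t₂ , t₃ , t₄ , l₁ , l₂ , l₃ , l₄ , e₁ , o₂ , opp , inj₂ (_ , inj₂ refl , inj₁ (↭-trans q (↭-sym (extend-c _ _ _)))))
  special⇒2b p (_ , c , d , 1 , 3 , (t₁ , t₂ , t₃ , t₄ , (l₁ , l₂ , l₃ , l₄ , e₁ , o₂ , opp) , refl , inj₂ (inj₂ (refl , refl))) , refl , _ , q) =
    _ , _ , p , inj₂ (refl , t₁ , t₂ , t₃ , t₄ , l₁ , l₂ , l₃ , l₄ , e₁ , o₂ , opp , inj₂ (_ , inj₂ refl , inj₂ (↭-trans q (↭-sym (extend-c _ _ _)))))
  special⇒2b p (_ , _ , _ , 4 , 0 , _ , _ , () , _)
  special⇒2b p (_ , _ , _ , 2 , 2 , _ , _ , () , _)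
  special⇒2b p (_ , _ , _ , 0 , 4 , _ , _ , () , _)

  2b⇒special : ∀ {S} → Cond2b 2 S → ∃₂ λ α τ → ∃ λ (p : DicPresentation G 2 α τ) → Special p 4 S
  2b⇒special (α , τ , p , inj₁ (s≤s (s≤s ()) , _))
  2b⇒special (α , τ , p , inj₂ (_ , t₁ , t₂ , t₃ , t₄ , l₁ , l₂ , l₃ , l₄ , e₁ , o₂ , opp , inj₁ (_ , inj₁ refl , q))) =
    α , τ , p , _ , _ , _ , 3 , 1 , (t₁ , t₂ , t₃ , t₄ , (l₁ , l₂ , l₃ , l₄ , e₁ , o₂ , opp) , refl , inj₁ (refl , refl)) , refl , refl , ↭-trans q (extend-x _ _ _)
  2b⇒special (α , τ , p , inj₂ (_ , t₁ , t₂ , t₃ , t₄ , l₁ , l₂ , l₃ , l₄ , e₁ , o₂ , opp , inj₂ (_ , inj₁ refl , inj₁ q))) =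
    α , τ , p , _ , _ , _ , 3 , 1 , (t₁ , t₂ , t₃ , t₄ , (l₁ , l₂ , l₃ , l₄ , e₁ , o₂ , opp) , refl , inj₂ (inj₁ (refl , refl))) , refl , refl , ↭-trans q (extend-x _ _ _)
  2b⇒special (α , τ , p , inj₂ (_ , t₁ , t₂ , t₃ , t₄ , l₁ , l₂ , l₃ , l₄ , e₁ , o₂ , opp , inj₂ (_ , inj₁ refl , inj₂ q))) =
    α , τ , p , _ , _ , _ , 3 , 1 , (t₁ , t₂ , t₃ , t₄ , (l₁ , l₂ , l₃ , l₄ , e₁ , o₂ , opp) , refl , inj₂ (inj₂ (refl , refl))) , refl , refl , ↭-trans q (extend-x _ _ _)
  2b⇒special (α , τ , p , inj₂ (_ , t₁ , t₂ , t₃ , t₄ , l₁ , l₂ , l₃ , l₄ , e₁ , o₂ , opp , inj₁ (_ , inj₂ refl , q))) =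
    α , τ , p , _ , _ , _ , 1 , 3 , (t₁ , t₂ , t₃ , t₄ , (l₁ , l₂ , l₃ , l₄ , e₁ , o₂ , opp) , refl , inj₁ (refl , refl)) , refl , refl , ↭-trans q (extend-c _ _ _)
  2b⇒special (α , τ , p , inj₂ (_ , t₁ , t₂ , t₃ , t₄ , l₁ , l₂ , l₃ , l₄ , e₁ , o₂ , opp , inj₂ (_ , inj₂ refl , inj₁ q))) =
    α , τ , p , _ , _ , _ , 1 , 3 , (t₁ , t₂ , t₃ , t₄ , (l₁ , l₂ , l₃ , l₄ , e₁ , o₂ , opp) , refl , inj₂ (inj₁ (refl , refl))) , refl , refl , ↭-trans q (extend-c _ _ _)
  2b⇒special (α , τ , p , inj₂ (_ , t₁ , t₂ , t₃ , t₄ , l₁ , l₂ , l₃ , l₄ , e₁ , o₂ , opp , inj₂ (_ , inj₂ refl , inj₂ q))) =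
    α , τ , p , _ , _ , _ , 1 , 3 , (t₁ , t₂ , t₃ , t₄ , (l₁ , l₂ , l₃ , l₄ , e₁ , o₂ , opp) , refl , inj₂ (inj₂ (refl , refl))) , refl , refl , ↭-trans q (extend-c _ _ _)

  module _ {α τ : Carrier} (p : DicPresentation G 2 α τ) where

    part1 : ∀ {s} → IsLeast (Forces G 4) s → ∀ S → (length S ≡ s ∸ 1 × ¬ HasPOSub G 4 S) ⇔ Cond1b 2 S
    part1 = characterize {G = G} {Shape = Cond1b 2} classify sound (special-forced p 2 (s≤s (s≤s z≤n)) refl) (_ , special⇒1b p (special-example p 1))
      where
      classify : ∀ S → suc (length S) ≡ 8 → HasPOSub G 4 S ⊎ Cond1b 2 S
      classify S len with special-classify p 2 (s≤s (s≤s z≤n)) refl S (ℕₚ.suc-injective len)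
      ... | inj₁ po = inj₁ po
      ... | inj₂ s  = inj₂ (special⇒1b p s)
      sound : ∀ S → Cond1b 2 S → suc (length S) ≡ 8 × ¬ HasPOSub G 4 S
      sound S c with 1b⇒special c
      ... | _ , _ , p′ , s = cong suc (special-length p′ 2 S s) , special-no-PO p′ 2 S s

    part2 : ∀ {s} → IsLeast (Forces G 8) s → ∀ S → (length S ≡ s ∸ 1 × ¬ HasPOSub G 8 S) ⇔ Cond2b 2 S
    part2 = characterize {G = G} {Shape = Cond2b 2} classify sound (special-forced p 4 (s≤s (s≤s z≤n)) refl) (_ , special⇒2b p (special-example p 3))
      where
      classify : ∀ S → suc (length S) ≡ 12 → HasPOSub G 8 S ⊎ Cond2b 2 S
      classify S len with special-classify p 4 (s≤s (s≤s z≤n)) refl S (ℕₚ.suc-injective len)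
      ... | inj₁ po = inj₁ po
      ... | inj₂ s  = inj₂ (special⇒2b p s)
      sound : ∀ S → Cond2b 2 S → suc (length S) ≡ 12 × ¬ HasPOSub G 8 S
      sound S c with 2b⇒special c
      ... | _ , _ , p′ , s = cong suc (special-length p′ 4 S s) , special-no-PO p′ 4 S s

-- The case n ≥ 3 in the terms of the theorem.

module Large {G : FinGroup} {n : ℕ} (3≤n : 3 ≤ n) (order≡ : FinGroup.order G ≡ 4 * n)
  {α τ : FinGroup.Carrier G} (p : DicPresentation G n α τ) where
  open FinGroup G
  open Shapes G

  instance
    n≢0 : NonZero n
    n≢0 = ℕ.>-nonZero (ℕₚ.≤-trans (s≤s z≤n) 3≤n)

  n≢2 : n ≢ 2
  n≢2 refl = ℕₚ.<-irrefl refl 3≤n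

  open FewOutside (residues n) using (Target)

  -- One fixed presentation suffices to exhibit the shape of a sequence, but a given shape brings
  -- its own α′ and τ′; so `from` returns a presentation, and soundness is shown for that one.
  general : ∀ (𝕋 : Target) {Shape : Seq G → Set} → let open Target 𝕋 in
    (∀ {S} → Sequences.General G n order≡ α τ p M S → Shape S) →
    (∀ {S} → Shape S → ∃₂ λ α τ → ∃ λ p → Sequences.General G n order≡ α τ p M S) →
    ∀ {s} → IsLeast (Forces G M) s → ∀ S → (length S ≡ s ∸ 1 × ¬ HasPOSub G M S) ⇔ Shape S
  general 𝕋 {Shape} to from = characterize {G = G} {Shape = Shape} classify sound C.forced (_ , to (proj₂ C.example))
    where
    open Target 𝕋
    module C = Sequences.Classification G n order≡ α τ p 𝕋
    classify : ∀ S → suc (length S) ≡ M ℕ.+ 2 * n → HasPOSub G M S ⊎ Shape S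
    classify S len with C.classify S len
    ... | inj₁ po = inj₁ po
    ... | inj₂ g  = inj₂ (to g)
    sound : ∀ S → Shape S → suc (length S) ≡ M ℕ.+ 2 * n × ¬ HasPOSub G M S
    sound S s with from s
    ... | α′ , τ′ , p′ , g = Sequences.general-length G n order≡ α′ τ′ p′ C.1≤M g , Sequences.general-no-PO G n order≡ α′ τ′ p′ M· C.1≤M g

  target₁ : 2 ∣ n → Target
  target₁ (divides q n≡) = record { M = 2 * n ; K = n ; M≡2K = refl ; 3≤n = 3≤n ; n≤K = ℕₚ.≤-refl
    ; K-even = q , ≡.trans n≡ (ℕₚ.*-comm q 2) ; kind = inj₁ (refl , q , ≡.trans n≡ (ℕₚ.*-comm q 2)) }

  target₂ : Target
  target₂ = record { M = 4 * n ; K = 2 * n ; M≡2K = lem n ; 3≤n = 3≤n ; n≤K = ℕₚ.m≤m+n n _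
    ; K-even = n , refl ; kind = inj₂ (lem n) }
    where
    lem : ∀ n → 4 * n ≡ 2 * (2 * n)
    lem = solve-∀

  4≤n : 2 ∣ n → 4 ≤ n
  4≤n (divides q n≡) = ℕₚ.≤∧≢⇒< 3≤n (λ { refl → three q n≡ })
    where
    three : ∀ q → 3 ≢ q * 2
    three (suc zero) ()
    three (suc (suc q)) ()

  part1 : 2 ∣ n → ∀ {s} → IsLeast (Forces G (2 * n)) s → ∀ S → (length S ≡ s ∸ 1 × ¬ HasPOSub G (2 * n) S) ⇔ Cond1b n S
  part1 2∣n = general (target₁ 2∣n) (λ g → α , τ , p , inj₁ (4≤n 2∣n , g)) from
    where
    from : ∀ {S} → Cond1b n S → ∃₂ λ α τ → ∃ λ p → Sequences.General G n order≡ α τ p (2 * n) S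
    from (α′ , τ′ , p′ , inj₁ (_ , g))   = α′ , τ′ , p′ , g
    from (α′ , τ′ , p′ , inj₂ (e , _)) = ⊥-elim (n≢2 e)

  part2 : ∀ {s} → IsLeast (Forces G (4 * n)) s → ∀ S → (length S ≡ s ∸ 1 × ¬ HasPOSub G (4 * n) S) ⇔ Cond2b n S
  part2 = general target₂ (λ g → α , τ , p , inj₁ (3≤n , g)) from
    where
    from : ∀ {S} → Cond2b n S → ∃₂ λ α τ → ∃ λ p → Sequences.General G n order≡ α τ p (4 * n) S
    from (α′ , τ′ , p′ , inj₁ (_ , g))   = α′ , τ′ , p′ , g
    from (α′ , τ′ , p′ , inj₂ (e , _)) = ⊥-elim (n≢2 e)

theorem1p3 : (G : FinGroup) (n : ℕ) → 2 ≤ n → IsDicyclic G n → (S : Seq G) →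
    ((2 ∣ n → (e s : ℕ) → IsExp G e → IsLeast (Forces G e) s →
    ((length S ≡ s ∸ 1 × ¬ HasPOSub G e S) ⇔ Shapes.Cond1b G n S))
    × ((E : ℕ) → IsLeast (Forces G (FinGroup.order G)) E →
    ((length S ≡ E ∸ 1 × ¬ HasPOSub G (FinGroup.order G) S) ⇔ Shapes.Cond2b G n S)))
theorem1p3 G n 2≤n (order≡ , α , τ , p) S with n ℕ.≟ 2
... | yes refl = (λ 2∣2 e s isExp least → first (Sequences.exponent G 2 order≡ α τ p 2∣2 isExp) least)
    , λ E least → second order≡ least
  where
  first : ∀ {e s} → e ≡ 4 → IsLeast (Forces G e) s → (length S ≡ s ∸ 1 × ¬ HasPOSub G e S) ⇔ Shapes.Cond1b G 2 S
  first refl least = Order8.part1 order≡ p least S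
  second : ∀ {k E} → k ≡ 8 → IsLeast (Forces G k) E → (length S ≡ E ∸ 1 × ¬ HasPOSub G k S) ⇔ Shapes.Cond2b G 2 S
  second refl least = Order8.part2 order≡ p least S
... | no n≢2 = (λ 2∣n e s isExp least → first 2∣n (Sequences.exponent G n {{n≢0}} order≡ α τ p 2∣n isExp) least)
    , λ E least → second order≡ least
  where
  3≤n : 3 ≤ n
  3≤n = ℕₚ.≤∧≢⇒< 2≤n (λ e → n≢2 (sym e))
  n≢0 : NonZero n
  n≢0 = ℕ.>-nonZero (ℕₚ.≤-trans (s≤s z≤n) 3≤n)
  first : ∀ {e s} → 2 ∣ n → e ≡ 2 * n → IsLeast (Forces G e) s → (length S ≡ s ∸ 1 × ¬ HasPOSub G e S) ⇔ Shapes.Cond1b G n S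
  first 2∣n refl least = Large.part1 3≤n order≡ p 2∣n least S
  second : ∀ {k E} → k ≡ 4 * n → IsLeast (Forces G k) E → (length S ≡ E ∸ 1 × ¬ HasPOSub G k S) ⇔ Shapes.Cond2b G n S
  second refl least = Large.part2 3≤n order≡ p least S
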